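{- Let $\Gamma=(X,\mathcal E)$ be the Pappus graph (the distance-regular graph with $18$ vertices and intersection array $\{3,2,2,1;1,1,2,3\}$); the spectrum of its adjacency matrix $A$ is $3^1(\sqrt3)^60^4(-\sqrt3)^6(-3)^1$. Let $x\in X$ and $T=T(x)$. Order the three vertices of $\Gamma_1(x)$ arbitrarily. Order $\Gamma_2(x)$ as $y_1,\dots,y_6$ so that each of the pairs $\{y_1,y_2\},\{y_3,y_4\},\{y_5,y_6\}$ has a common neighbor in $\Gamma_1(x)$, and any two consecutive vertices in the cyclic sequence $y_1,y_3,y_5,y_2,y_4,y_6$ have a common neighbor in $\Gamma_3(x)$. Order $\Gamma_3(x)$ as $z_1,\dots,z_6$ so that $z_1,z_4,z_6$ are the neighbors of one of the two vertices of $\Gamma_4(x)$, and $z_2,z_3,z_5$ are the neighbors of the other. Then the standard module $V=\mathbb C^X$ is an orthogonal direct sum of irreducible $T$-modules $V=W_0\oplus W_{1,a}\oplus W_{1,b}\oplus W_{2,a}\oplus W_{2,b}\oplus W_{2,c}\oplus W_3$, where two summands are isomorphic if and only if they have the same type in the following list, and the data are as listed. Each listed basis is a pure basis of the module. For each summand other than $W_0$, the seed vector $\nu$ spans $E_r^*W$ (so $\dim E_r^*W=1$), where $r$ is the endpoint of the summand $W$, and is given by its essential part. Type I ($W_0$): endpoint 0, multiplicity 1, dimension 5, diameter 4, shape $(1,1,1,1,1)$; basis $e_0^*,\dots,e_4^*$; matrix representing $A$: $\begin{pmatrix}0&3&0&0&0\\1&0&2&0&0\\0&1&0&2&0\\0&0&2&0&1\\0&0&0&3&0\end{pmatrix}$,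 with eigenvalues $3,\sqrt3,0,-\sqrt3,-3$. Type II ($W_{1,a},W_{1,b}$): endpoint 1, multiplicity 2, dimension 3, diameter 2, shape $(1,1,1)$; basis $\nu,A\nu,E_3^*A^2\nu$ (with $A\nu=E_2^*A\nu$), where $\nu=[1,-1,0]$ for $W_{1,a}$ and $\nu=[1,1,-2]$ for $W_{1,b}$; matrix representing $A$: $\begin{pmatrix}0&2&0\\1&0&1\\0&1&0\end{pmatrix}$, with eigenvalues $\sqrt3,0,-\sqrt3$. Type III ($W_{2,a}$): endpoint 2, multiplicity 1, dimension 1, diameter 0, shape $(1)$; basis $\nu$, where $\nu=[-1,1,1,-1,-1,1]$; matrix representing $A$: $\begin{pmatrix}0\end{pmatrix}$, with eigenvalue $0$. Type IV ($W_{2,b},W_{2,c}$): endpoint 2, multiplicity 2, dimension 2, diameter 1, shape $(1,1)$; basis $\nu,A\nu$ (with $A\nu=E_3^*A\nu$), where $\nu=[1,-1,0,0,-1,1]$ for $W_{2,b}$ and $\nu=[1,-1,2,-2,1,-1]$ for $W_{2,c}$; matrix representing $A$: $\begin{pmatrix}0&3\\1&0\end{pmatrix}$, with eigenvalues $\sqrt3,-\sqrt3$. Type V ($W_3$): endpoint 3, multiplicity 1, dimension 2, diameter 1, shape $(1,1)$; basis $\nu,A\nu$ (with $A\nu=E_4^*A\nu$), where $\nu=[1,-1,-1,1,-1,1]$; matrix representing $A$: $\begin{pmatrix}0&3\\1&0\end{pmatrix}$. Moreover $\dim T=5^2+3^2+1^2+2^2+2^2=43$.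
   Context: Let $\Gamma=(X,\mathcal E)$ be a finite undirected connected graph without loops or multiple edges, with path-length distance $d$ and diameter $D\ge1$; put $\Gamma_i(x)=\{y\in X:d(x,y)=i\}$. $\Gamma$ is distance-regular if for all $0\le h,i,j\le D$ the number $p^h_{i,j}=|\Gamma_i(y)\cap\Gamma_j(z)|$ is the same for all $y,z\in X$ with $d(y,z)=h$. Its intersection array is $\{b_0,\dots,b_{D-1};c_1,\dots,c_D\}$ with $b_i=p^i_{1,i+1}$, $c_i=p^i_{1,i-1}$. $A\in\mathrm{Mat}_X(\mathbb C)$ is the adjacency matrix; in its spectrum, exponents denote multiplicities. The standard module $V=\mathbb C^X$ (column vectors) carries the Hermitian inner product $\langle u,v\rangle=u^t\bar v$. Fix a base vertex $x\in X$. For $0\le i\le D$, $E_i^*=E_i^*(x)$ is the diagonal matrix with $(y,y)$-entry $1$ if $d(x,y)=i$ and $0$ otherwise, and $e_i^*\in V$ is the vector with $y$-entry $1$ if $d(x,y)=i$ and $0$ otherwise. The Terwilliger algebra $T=T(x)$ is the subalgebra of $\mathrm{Mat}_X(\mathbb C)$ generated by $A$ and $E_0^*,\dots,E_D^*$. A $T$-module is a subspace $W\subseteq V$ with $BW\subseteq W$ for all $B\in T$; it is irreducible if $W\ne0$ and it properly contains no nonzero $T$-module. Isomorphisms of $T$-modules are vector space isomorphisms commuting with every $B\in T$. The endpoint of $W$ is $r=\min\{i:E_i^*W\ne0\}$; the diameter of an irreducible $W$ is $\delta=|\{i:E_i^*W\ne0\}|-1$, and its shape is $(\dim E_r^*W,\dots,\dim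 E_{r+\delta}^*W)$. The multiplicity of an irreducible module is the number of summands isomorphic to it in an orthogonal decomposition of $V$ into irreducible $T$-modules. A nonzero vector is pure with support $i$ if it lies in $E_i^*V$; its essential part is the row vector of its coordinates at the vertices of $\Gamma_i(x)$, in the chosen order (all its other coordinates are $0$). A pure basis of an irreducible $T$-module is an ordered basis of pure vectors with weakly increasing supports. The matrix $B$ representing $A$ with respect to a basis $v_1,\dots,v_\ell$ is given by $Av_j=\sum_iB_{ij}v_i$. -}

module Defs where

open import Algebra.Apartness.Bundles using (HeytingCommutativeRing; HeytingField)
open import Algebra.Bundles using (CommutativeRing)
open import Algebra.Bundles.Raw using (RawMonoid)
import Algebra.Definitions.RawMonoid as RawMonoidDefinitions
open import Data.Bool.Base using (if_then_else_)
open import Data.Fin.Base as Fin using (Fin; zero; suc; toℕ)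
open import Data.Fin.Patterns using (0F; 1F; 2F; 3F; 4F; 5F; 6F)
import Data.Fin.Properties as Fin
open import Data.Integer.Base using (ℤ; +_; -[1+_])
open import Data.List.Base as List using (List)
open import Data.List.Relation.Unary.All using (All)
open import Data.List.Relation.Unary.Any using (Any)
open import Data.Maybe.Base using (Maybe; just; nothing)
import Data.Maybe.Relation.Unary.All as Maybe
open import Data.Nat.Base using (ℕ; zero; suc; _≤_; z≤n; s≤s)
import Data.Nat.Base as ℕ
import Data.Nat.Properties as ℕ
open import Data.Product.Base using (Σ; ∃; ∃₂; ∃-syntax; _×_; _,_; proj₁; proj₂)
open import Data.Sum.Base using (_⊎_)
open import Data.Vec.Base as Vec using (Vec; []; _∷_; lookup)
import Data.Vec.Functional as F
open import Function.Base using (_∘_)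
open import Function.Bundles using (Inverse; _⇔_)
open import Function.Definitions using (Injective)
open import Level using (0ℓ)
open import Relation.Binary.Bundles using (Setoid)
open import Relation.Binary.Core using (Rel)
open import Relation.Binary.Definitions using (Decidable; Symmetric)
open import Relation.Binary.PropositionalEquality using (_≡_; _≢_)
open import Relation.Binary.Structures using (IsStrictPartialOrder)
open import Relation.Nullary using (¬_; does; yes; no; contradiction)
open import Relation.Nullary.Decidable using (_×-dec_)
open import Relation.Unary using (Pred; _⊆_)
import Relation.Unary as U

-- A listing without repetition of exactly the elements satisfying P:
-- |{a : P a}| = m, together with a choice of order.
record Enumeration {A : Set} (P : A → Set) (m : ℕ) : Set where
  field
    elem      : Fin m → A
    injective : Injective _≡_ _≡_ elem
    sound     : ∀ k → P (elem k)
    complete  : ∀ a → P a → ∃[ k ] elem k ≡ a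

open Enumeration public using (elem)

least : {P : ℕ → Set} → U.Decidable P → ∀ k → P k →
        ∃[ j ] (P j × (∀ i → P i → j ≤ i))
least P? zero    p = zero , p , λ _ _ → z≤n
least P? (suc k) p with P? zero
... | yes p₀ = zero , p₀ , λ _ _ → z≤n
... | no ¬p₀ with least (P? ∘ suc) k p
...   | j , pⱼ , min = suc j , pⱼ , λ where
          zero    p₀ → contradiction p₀ ¬p₀
          (suc i) pᵢ → s≤s (min i pᵢ)

Walk : {X : Set} → Rel X 0ℓ → ℕ → Rel X 0ℓ
Walk _∼_ zero    y z = y ≡ z
Walk _∼_ (suc k) y z = ∃[ w ] (y ∼ w × Walk _∼_ k w z)

record Graph (n : ℕ) : Set₁ where
  infix 4 _∼_ _∼?_
  field
    _∼_       : Rel (Fin n) 0ℓ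
    _∼?_      : Decidable _∼_
    sym       : Symmetric _∼_
    irrefl    : ∀ {y} → ¬ (y ∼ y)
    connected : ∀ y z → ∃[ k ] Walk _∼_ k y z

  walk? : ∀ k → Decidable (Walk _∼_ k)
  walk? zero    y z = y Fin.≟ z
  walk? (suc k) y z = Fin.any? (λ w → (y ∼? w) ×-dec walk? k w z)

  shortest : ∀ y z →
    ∃[ k ] (Walk _∼_ k y z × (∀ i → Walk _∼_ i y z → k ≤ i))
  shortest y z = let (k , w) = connected y z in least (λ i → walk? i y z) k w

  d : Fin n → Fin n → ℕ
  d y z = proj₁ (shortest y z)

module _ {n : ℕ} (Γ : Graph n) where
  open Graph Γ

  Sphere : ℕ → Fin n → Pred (Fin n) 0ℓ
  Sphere i y z = d y z ≡ i

  IsDiameter : ℕ → Set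
  IsDiameter D = (∀ y z → d y z ≤ D) × ∃₂ λ y z → d y z ≡ D

  record IsDistanceRegular (D : ℕ) : Set where
    field
      isDiameter : IsDiameter D
      p          : ℕ → ℕ → ℕ → ℕ
      regular    : ∀ h i j → h ≤ D → i ≤ D → j ≤ D →
                   ∀ y z → d y z ≡ h →
                   Enumeration (λ w → Sphere i y w × Sphere j z w) (p h i j)

  record HasIntersectionArray {D : ℕ} (bs cs : Vec ℕ D) : Set where
    field
      isDistanceRegular : IsDistanceRegular D
    open IsDistanceRegular isDistanceRegular public
    field
      -- b₀ … b_{D-1} and c₁ … c_D
      b-array : Vec.tabulate {n = D} (λ i → p (toℕ i) 1 (suc (toℕ i))) ≡ bs
      c-array : Vec.tabulate {n = D} (λ i → p (suc (toℕ i)) 1 (toℕ i)) ≡ cs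

IsPappus : Graph 18 → Set
IsPappus Γ = HasIntersectionArray Γ (3 ∷ 2 ∷ 2 ∷ 1 ∷ []) (1 ∷ 1 ∷ 2 ∷ 3 ∷ [])

-- The real numbers, axiomatised as a Cauchy-complete Archimedean ordered
-- field.  Over classical logic this determines them up to isomorphism; the
-- axioms are phrased with apartness so that the Cauchy reals of constructive
-- mathematics are also a model.
record Reals : Set₁ where
  field
    heytingField : HeytingField 0ℓ 0ℓ 0ℓ
  open HeytingField heytingField public
    using (Carrier; _≈_; _#_; _+_; _*_; -_; _-_; 0#; 1#; isEquivalence)
  open HeytingCommutativeRing
    (HeytingField.heytingCommutativeRing heytingField) public
    using (commutativeRing)
  open CommutativeRing commutativeRing public using (+-rawMonoid)
  open RawMonoidDefinitions +-rawMonoid public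
    using () renaming (_×_ to _·ℕ_)
  infix 4 _<_
  field
    _<_                  : Rel Carrier 0ℓ
    isStrictPartialOrder : IsStrictPartialOrder _≈_ _<_
    #⇔<⊎>                : ∀ a b → (a # b) ⇔ (a < b ⊎ b < a)
    +-mono-<             : ∀ a {b c} → b < c → a + b < a + c
    *-pos                : ∀ {a b} → 0# < a → 0# < b → 0# < a * b
    archimedean          : ∀ a → ∃[ k ] a < k ·ℕ 1#

  ∣_∣<_ : Carrier → Carrier → Set
  ∣ a ∣< ε = a < ε × - a < ε

  field
    complete : (f : ℕ → Carrier) →
      (∀ ε → 0# < ε → ∃[ N ] ∀ i j → N ≤ i → N ≤ j → ∣ f i - f j ∣< ε) →
      ∃[ l ] ∀ ε → 0# < ε → ∃[ N ] ∀ i → N ≤ i → ∣ f i - l ∣< ε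

  fromℤ : ℤ → Carrier
  fromℤ (+ k)    = k ·ℕ 1#
  fromℤ -[1+ k ] = - (suc k ·ℕ 1#)

  IsSqrt : Carrier → ℤ → Set
  IsSqrt s a = (0# < s) × (s * s ≈ fromℤ a)

module Complex (ℝ : Reals) where
  private module R = Reals ℝ

  infix  4 _≈_ _#_
  infixl 6 _+_
  infixl 7 _*_

  record ℂ : Set where
    constructor _+i_
    field
      re im : R.Carrier
  open ℂ public

  _≈_ _#_ : Rel ℂ 0ℓ
  u ≈ v = (re u R.≈ re v) × (im u R.≈ im v)
  u # v = (re u R.# re v) ⊎ (im u R.# im v)

  _+_ _*_ : ℂ → ℂ → ℂ
  u + v = (re u R.+ re v) +i (im u R.+ im v)
  u * v = (re u R.* re v R.- im u R.* im v) +i (re u R.* im v R.+ im u R.* re v)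

  conj : ℂ → ℂ
  conj u = re u +i (R.- im u)

  real : R.Carrier → ℂ
  real a = a +i R.0#

  0ℂ 1ℂ : ℂ
  0ℂ = real R.0#
  1ℂ = real R.1#

  fromℤ : ℤ → ℂ
  fromℤ a = real (R.fromℤ a)

  setoid : Setoid 0ℓ 0ℓ
  setoid = record
    { Carrier = ℂ
    ; _≈_ = _≈_
    ; isEquivalence = record
      { refl  = E.refl , E.refl
      ; sym   = λ (p , q) → E.sym p , E.sym q
      ; trans = λ (p , q) (p′ , q′) → E.trans p p′ , E.trans q q′
      }
    }
    where module E = HeytingField R.heytingField

  +-rawMonoid : RawMonoid 0ℓ 0ℓ
  +-rawMonoid = record { _≈_ = _≈_ ; _∙_ = _+_ ; ε = 0ℂ }

  open RawMonoidDefinitions +-rawMonoid public using (sum)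

-- Subspaces are predicates satisfying IsSubspace; being nonzero is expressed
-- by apartness, which classically is the same as ≉.
module LinearAlgebra (ℝ : Reals) where
  open Complex ℝ

  ℂ^ : Set → Set
  ℂ^ I = I → ℂ

  -- Matrices have rows and columns indexed by Fin n, and form the coordinate
  -- space ℂ^(Fin n × Fin n), so that dimension makes sense for them.
  Mat : ℕ → Set
  Mat n = ℂ^ (Fin n × Fin n)

  infix 4 _≋_
  infixl 6 _⊕_
  infixr 7 _⊛_ _·_ _⊗_

  _≋_ : {I : Set} → Rel (ℂ^ I) 0ℓ
  u ≋ v = ∀ i → u i ≈ v i

  _⊕_ : {I : Set} → ℂ^ I → ℂ^ I → ℂ^ I
  (u ⊕ v) i = u i + v i

  _⊛_ : {I : Set} → ℂ → ℂ^ I → ℂ^ I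
  (a ⊛ v) i = a * v i

  𝟎 : {I : Set} → ℂ^ I
  𝟎 _ = 0ℂ

  Nonzero : {I : Set} → ℂ^ I → Set
  Nonzero v = ∃[ i ] v i # 0ℂ

  ∑ : {I : Set} {k : ℕ} → (Fin k → ℂ^ I) → ℂ^ I
  ∑ v i = sum (λ j → v j i)

  lincomb : {I : Set} {k : ℕ} → (Fin k → ℂ) → (Fin k → ℂ^ I) → ℂ^ I
  lincomb c v = ∑ (λ j → c j ⊛ v j)

  _·_ : {n : ℕ} → Mat n → ℂ^ (Fin n) → ℂ^ (Fin n)
  (B · v) i = sum (λ j → B (i , j) * v j)

  _⊗_ : {n : ℕ} → Mat n → Mat n → Mat n
  (B ⊗ C) (i , k) = sum (λ j → B (i , j) * C (j , k))

  𝟏 : {n : ℕ} → Mat n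
  𝟏 (i , j) = if does (i Fin.≟ j) then 1ℂ else 0ℂ

  unit : {n : ℕ} → Fin n → ℂ^ (Fin n)
  unit i j = 𝟏 (i , j)

  fromRows : {n : ℕ} → Vec (Vec ℤ n) n → Mat n
  fromRows B (i , j) = fromℤ (lookup (lookup B i) j)

  ⟨_,_⟩ : {n : ℕ} → ℂ^ (Fin n) → ℂ^ (Fin n) → ℂ
  ⟨ u , v ⟩ = sum (λ i → u i * conj (v i))

  record IsSubspace {I : Set} (W : Pred (ℂ^ I) 0ℓ) : Set where
    field
      resp    : ∀ {u v} → u ≋ v → W u → W v
      zero∈   : W 𝟎
      ⊕-closed : ∀ {u v} → W u → W v → W (u ⊕ v)
      ⊛-closed : ∀ a {v} → W v → W (a ⊛ v)

  NonzeroSpace : {I : Set} → Pred (ℂ^ I) 0ℓ → Set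
  NonzeroSpace W = ∃[ v ] (W v × Nonzero v)

  record IsBasis {I : Set} {k : ℕ}
                 (W : Pred (ℂ^ I) 0ℓ) (v : Fin k → ℂ^ I) : Set where
    field
      member      : ∀ j → W (v j)
      independent : ∀ c → lincomb c v ≋ 𝟎 → ∀ j → c j ≈ 0ℂ
      spanning    : ∀ {u} → W u → ∃[ c ] u ≋ lincomb c v

  HasDim : {I : Set} → Pred (ℂ^ I) 0ℓ → ℕ → Set
  HasDim {I} W k = Σ (Fin k → ℂ^ I) (IsBasis W)

  Image : {n : ℕ} → Mat n → Pred (ℂ^ (Fin n)) 0ℓ → Pred (ℂ^ (Fin n)) 0ℓ
  Image B W u = ∃[ w ] (W w × u ≋ B · w)

  Eigenspace : {n : ℕ} → Mat n → ℂ → Pred (ℂ^ (Fin n)) 0ℓ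
  Eigenspace B θ v = B · v ≋ θ ⊛ v

  IsEigenvalue : {n : ℕ} → Mat n → ℂ → Set
  IsEigenvalue B θ = NonzeroSpace (Eigenspace B θ)

  HasEigenvalues : {n : ℕ} → Mat n → List ℂ → Set
  HasEigenvalues B θs = ∀ θ → IsEigenvalue B θ ⇔ Any (θ ≈_) θs

  -- For real symmetric B; multiplicities are dimensions of eigenspaces.
  HasSpectrum : {n : ℕ} → Mat n → List (ℂ × ℕ) → Set
  HasSpectrum B θms = HasEigenvalues B (List.map proj₁ θms)
                    × All (λ (θ , m) → HasDim (Eigenspace B θ) m) θms

  -- Represents B C v: the map u ↦ B · u has matrix C with respect to v.
  Represents : {n ℓ : ℕ} → Mat n → Mat ℓ → (Fin ℓ → ℂ^ (Fin n)) → Set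
  Represents B C v = ∀ j → B · v j ≋ lincomb (λ i → C (i , j)) v

  adjacency : {n : ℕ} → Graph n → Mat n
  adjacency Γ (y , z) = if does (y ∼? z) then 1ℂ else 0ℂ
    where open Graph Γ

-- D is the diameter of Γ and x the base vertex.
module Terwilliger (ℝ : Reals) {n : ℕ} (Γ : Graph n) (D : ℕ) (x : Fin n) where
  open Complex ℝ
  open LinearAlgebra ℝ
  open Graph Γ

  V : Set
  V = ℂ^ (Fin n)

  A : Mat n
  A = adjacency Γ

  e* : ℕ → V
  e* i y = if does (d x y ℕ.≟ i) then 1ℂ else 0ℂ

  E* : ℕ → Mat n
  E* i (y , z) = if does (y Fin.≟ z) then e* i y else 0ℂ

  data T : Pred (Mat n) 0ℓ where
    A∈T   : T A
    E*∈T  : ∀ i → i ≤ D → T (E* i)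
    𝟏∈T   : T 𝟏
    ⊕-closed : ∀ {B C} → T B → T C → T (B ⊕ C)
    ⊛-closed : ∀ a {B} → T B → T (a ⊛ B)
    ⊗-closed : ∀ {B C} → T B → T C → T (B ⊗ C)
    resp  : ∀ {B C} → B ≋ C → T B → T C

  record IsTModule (W : Pred V 0ℓ) : Set where
    field
      isSubspace : IsSubspace W
      closed     : ∀ {B v} → T B → W v → W (B · v)

  -- minimal is the positive form of: W properly contains no nonzero T-module.
  record IsIrreducible (W : Pred V 0ℓ) : Set₁ where
    field
      isTModule : IsTModule W
      nonzero   : NonzeroSpace W
      minimal   : ∀ (U : Pred V 0ℓ) → IsTModule U → NonzeroSpace U →
                  U ⊆ W → W ⊆ U

  asSetoid : Pred V 0ℓ → Setoid 0ℓ 0ℓ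
  asSetoid W = record
    { Carrier = ∃ W
    ; _≈_ = λ u v → proj₁ u ≋ proj₁ v
    ; isEquivalence = record
      { refl  = λ i → C.refl
      ; sym   = λ p i → C.sym (p i)
      ; trans = λ p q i → C.trans (p i) (q i)
      }
    }
    where module C = Setoid setoid

  -- The operations of W are expressed by ≋ between underlying vectors; for
  -- W and W′ closed under them this says that f.to commutes with ⊕, ⊛ and T.
  infix 4 _≅_
  record _≅_ (W W′ : Pred V 0ℓ) : Set where
    field
      inverse : Inverse (asSetoid W) (asSetoid W′)
    module f = Inverse inverse
    field
      additive    : ∀ u v w → proj₁ w ≋ proj₁ u ⊕ proj₁ v →
                    proj₁ (f.to w) ≋ proj₁ (f.to u) ⊕ proj₁ (f.to v)
      homogeneous : ∀ a u w → proj₁ w ≋ a ⊛ proj₁ u →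
                    proj₁ (f.to w) ≋ a ⊛ proj₁ (f.to u)
      T-linear    : ∀ {B} → T B → ∀ u w → proj₁ w ≋ B · proj₁ u →
                    proj₁ (f.to w) ≋ B · proj₁ (f.to u)

  Supported : Pred V 0ℓ → Pred ℕ 0ℓ
  Supported W i = i ≤ D × NonzeroSpace (Image (E* i) W)

  HasEndpoint : Pred V 0ℓ → ℕ → Set
  HasEndpoint W r = Supported W r × (∀ i → Supported W i → r ≤ i)

  ModuleDiameter : Pred V 0ℓ → ℕ → Set
  ModuleDiameter W δ = Enumeration (Supported W) (suc δ)

  HasShape : Pred V 0ℓ → (r : ℕ) {δ : ℕ} → Vec ℕ (suc δ) → Set
  HasShape W r shape =
    ∀ k → HasDim (Image (E* (r ℕ.+ toℕ k)) W) (lookup shape k)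

  Pure : ℕ → Pred V 0ℓ
  Pure i v = i ≤ D × Nonzero v × Image (E* i) U.U v

  IsPureBasis : {ℓ : ℕ} → Pred V 0ℓ → (Fin ℓ → V) → Set
  IsPureBasis {ℓ} W v = IsBasis W v ×
    Σ (Fin ℓ → ℕ) λ supp → (∀ j → Pure (supp j) (v j)) ×
                           (∀ (i j : Fin ℓ) → i Fin.≤ j → supp i ≤ supp j)

  record IsOrthogonalDecomposition {k : ℕ} (W : Fin k → Pred V 0ℓ) : Set₁ where
    field
      irreducible : ∀ s → IsIrreducible (W s)
      orthogonal  : ∀ s t → s ≢ t → ∀ {u v} → W s u → W t v → ⟨ u , v ⟩ ≈ 0ℂ
      direct      : ∀ (w : Fin k → V) → (∀ s → W s (w s)) → ∑ w ≋ 𝟎 →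
                    ∀ s → w s ≋ 𝟎
      total       : ∀ v → ∃[ w ] ((∀ s → W s (w s)) × v ≋ ∑ w)

  -- The multiplicity of U, counted in the decomposition W.
  HasMultiplicity : {k : ℕ} → (Fin k → Pred V 0ℓ) → Pred V 0ℓ → ℕ → Set
  HasMultiplicity W U m = Enumeration (λ t → W t ≅ U) m

  -- The vector of ℂ^X with the given coordinates at the listed vertices and
  -- 0 elsewhere.
  fromEssentialPart : {m : ℕ} → (Fin m → Fin n) → Vec ℤ m → V
  fromEssentialPart o a = lincomb (fromℤ ∘ lookup a) (unit ∘ o)

module _ {n : ℕ} (Γ : Graph n) (x : Fin n) where
  open Graph Γ

  CommonNeighborIn : ℕ → Fin n → Fin n → Set
  CommonNeighborIn i y z = ∃[ w ] (Sphere Γ i x w × y ∼ w × z ∼ w)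

  -- Indices are shifted by one: y 0F, …, y 5F are y₁, …, y₆.
  record AdmissibleΓ₂ (y : Fin 6 → Fin n) : Set where
    field
      pair₁₂ : CommonNeighborIn 1 (y 0F) (y 1F)
      pair₃₄ : CommonNeighborIn 1 (y 2F) (y 3F)
      pair₅₆ : CommonNeighborIn 1 (y 4F) (y 5F)
      cycle₁₃ : CommonNeighborIn 3 (y 0F) (y 2F)
      cycle₃₅ : CommonNeighborIn 3 (y 2F) (y 4F)
      cycle₅₂ : CommonNeighborIn 3 (y 4F) (y 1F)
      cycle₂₄ : CommonNeighborIn 3 (y 1F) (y 3F)
      cycle₄₆ : CommonNeighborIn 3 (y 3F) (y 5F)
      cycle₆₁ : CommonNeighborIn 3 (y 5F) (y 0F)

  record AdmissibleΓ₃ (z : Fin 6 → Fin n) : Set where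
    field
      Γ₄ : Enumeration (Sphere Γ 4 x) 2
      neighbors₁₄₆ : ∀ v → (v ∼ elem Γ₄ 0F) ⇔ (v ≡ z 0F ⊎ v ≡ z 3F ⊎ v ≡ z 5F)
      neighbors₂₃₅ : ∀ v → (v ∼ elem Γ₄ 1F) ⇔ (v ≡ z 1F ⊎ v ≡ z 2F ⊎ v ≡ z 4F)

  OrderingΓ₁ OrderingΓ₂ OrderingΓ₃ : Set
  OrderingΓ₁ = Enumeration (Sphere Γ 1 x) 3
  OrderingΓ₂ = Σ (Enumeration (Sphere Γ 2 x) 6) (AdmissibleΓ₂ ∘ elem)
  OrderingΓ₃ = Σ (Enumeration (Sphere Γ 3 x) 6) (AdmissibleΓ₃ ∘ elem)

data Kind : Set where
  I II III IV V : Kind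

-- The summands W₀, W₁ₐ, W₁ᵦ, W₂ₐ, W₂ᵦ, W₂꜀, W₃ in this order.
kind : Fin 7 → Kind
kind 0F = I
kind 1F = II
kind 2F = II
kind 3F = III
kind 4F = IV
kind 5F = IV
kind 6F = V

module PappusModules (ℝ : Reals) (√3 : Reals.Carrier ℝ)
                     (Γ : Graph 18) (x : Fin 18)
                     (Γ₁ : OrderingΓ₁ Γ x) (Γ₂ : OrderingΓ₂ Γ x)
                     (Γ₃ : OrderingΓ₃ Γ x) where
  open Complex ℝ
  open LinearAlgebra ℝ
  open Terwilliger ℝ Γ 4 x renaming (V to ℂˣ)

  record TypeData : Set where
    field
      endpoint multiplicity dimension diameter : ℕ
      shape       : Vec ℕ (suc diameter)
      matrix      : Vec (Vec ℤ dimension) dimension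
      eigenvalues : Maybe (List ℂ)

  +√3 -√3 : ℂ
  +√3 = real √3
  -√3 = real (Reals.-_ ℝ √3)

  typeData : Kind → TypeData
  typeData I = record
    { endpoint = 0 ; multiplicity = 1 ; dimension = 5 ; diameter = 4
    ; shape  = 1 ∷ 1 ∷ 1 ∷ 1 ∷ 1 ∷ []
    ; matrix = (+ 0 ∷ + 3 ∷ + 0 ∷ + 0 ∷ + 0 ∷ [])
             ∷ (+ 1 ∷ + 0 ∷ + 2 ∷ + 0 ∷ + 0 ∷ [])
             ∷ (+ 0 ∷ + 1 ∷ + 0 ∷ + 2 ∷ + 0 ∷ [])
             ∷ (+ 0 ∷ + 0 ∷ + 2 ∷ + 0 ∷ + 1 ∷ [])
             ∷ (+ 0 ∷ + 0 ∷ + 0 ∷ + 3 ∷ + 0 ∷ [])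
             ∷ []
    ; eigenvalues = just (fromℤ (+ 3) List.∷ +√3 List.∷ 0ℂ List.∷ -√3
                          List.∷ fromℤ -[1+ 2 ] List.∷ List.[])
    }
  typeData II = record
    { endpoint = 1 ; multiplicity = 2 ; dimension = 3 ; diameter = 2
    ; shape  = 1 ∷ 1 ∷ 1 ∷ []
    ; matrix = (+ 0 ∷ + 2 ∷ + 0 ∷ [])
             ∷ (+ 1 ∷ + 0 ∷ + 1 ∷ [])
             ∷ (+ 0 ∷ + 1 ∷ + 0 ∷ [])
             ∷ []
    ; eigenvalues = just (+√3 List.∷ 0ℂ List.∷ -√3 List.∷ List.[])
    }
  typeData III = record
    { endpoint = 2 ; multiplicity = 1 ; dimension = 1 ; diameter = 0
    ; shape  = 1 ∷ []
    ; matrix = (+ 0 ∷ []) ∷ []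
    ; eigenvalues = just (0ℂ List.∷ List.[])
    }
  typeData IV = record
    { endpoint = 2 ; multiplicity = 2 ; dimension = 2 ; diameter = 1
    ; shape  = 1 ∷ 1 ∷ []
    ; matrix = (+ 0 ∷ + 3 ∷ [])
             ∷ (+ 1 ∷ + 0 ∷ [])
             ∷ []
    ; eigenvalues = just (+√3 List.∷ -√3 List.∷ List.[])
    }
  typeData V = record
    { endpoint = 3 ; multiplicity = 1 ; dimension = 2 ; diameter = 1
    ; shape  = 1 ∷ 1 ∷ []
    ; matrix = (+ 0 ∷ + 3 ∷ [])
             ∷ (+ 1 ∷ + 0 ∷ [])
             ∷ []
    ; eigenvalues = nothing
    }

  pattern -1ℤ = -[1+ 0 ]
  pattern -2ℤ = -[1+ 1 ]

  -- seed s belongs to the summand with index suc s; W₀, with index zero,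
  -- has none.
  seed : Fin 6 → ℂˣ
  seed 0F = fromEssentialPart (elem Γ₁)         (+ 1 ∷ -1ℤ ∷ + 0 ∷ [])
  seed 1F = fromEssentialPart (elem Γ₁)         (+ 1 ∷ + 1 ∷ -2ℤ ∷ [])
  seed 2F = fromEssentialPart (elem (proj₁ Γ₂)) (-1ℤ ∷ + 1 ∷ + 1 ∷ -1ℤ ∷ -1ℤ ∷ + 1 ∷ [])
  seed 3F = fromEssentialPart (elem (proj₁ Γ₂)) (+ 1 ∷ -1ℤ ∷ + 0 ∷ + 0 ∷ -1ℤ ∷ + 1 ∷ [])
  seed 4F = fromEssentialPart (elem (proj₁ Γ₂)) (+ 1 ∷ -1ℤ ∷ + 2 ∷ -2ℤ ∷ + 1 ∷ -1ℤ ∷ [])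
  seed 5F = fromEssentialPart (elem (proj₁ Γ₃)) (+ 1 ∷ -1ℤ ∷ -1ℤ ∷ + 1 ∷ -1ℤ ∷ + 1 ∷ [])

  basisII : ℂˣ → Fin 3 → ℂˣ
  basisII ν = ν F.∷ A · ν F.∷ E* 3 · A · A · ν F.∷ F.[]

  basisIV-V : ℂˣ → Fin 2 → ℂˣ
  basisIV-V ν = ν F.∷ A · ν F.∷ F.[]

  basis : (s : Fin 7) → Fin (TypeData.dimension (typeData (kind s))) → ℂˣ
  basis 0F = e* ∘ toℕ
  basis 1F = basisII (seed 0F)
  basis 2F = basisII (seed 1F)
  basis 3F = seed 2F F.∷ F.[]
  basis 4F = basisIV-V (seed 3F)
  basis 5F = basisIV-V (seed 4F)
  basis 6F = basisIV-V (seed 5F)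

  record HasTypeData (W : Pred ℂˣ 0ℓ) (τ : TypeData)
                     (v : Fin (TypeData.dimension τ) → ℂˣ) : Set where
    open TypeData τ
    field
      hasEndpoint    : HasEndpoint W endpoint
      hasDimension   : HasDim W dimension
      hasDiameter    : ModuleDiameter W diameter
      hasShape       : HasShape W endpoint shape
      isPureBasis    : IsPureBasis W v
      represents     : Represents A (fromRows matrix) v
      hasEigenvalues : Maybe.All (HasEigenvalues (fromRows matrix)) eigenvalues

module Submission where

-- From the intersection array every vertex has three neighbours and the graph
-- is bipartite, as bᵢ + cᵢ = 3.  Counting neighbours at prescribed distances
-- shows that, seen from x, the six vertices of Γ₂(x) lie on a hexagon of links
-- through Γ₃(x) whose antipodal vertices have a common neighbour in Γ₁(x), and
-- that the two vertices of Γ₄(x) are adjacent to alternate links.  Hence the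
-- graph is unique and all of its data can be computed in labels.
--
-- The vectors listed in the theorem form an orthogonal basis of V on which A
-- and the Eᵢ* act by small integer matrices that depend only on the type.
-- For every type there are words in A and the Eᵢ* that act on the modules
-- of this type as multiples of the matrix units and kill all the others.
-- This yields irreducibility, the isomorphism classes and, since T acts
-- faithfully on V, a basis of T.

open import Defs
open import Algebra.Apartness.Bundles using (HeytingCommutativeRing; HeytingField)
import Algebra.Apartness.Properties.HeytingCommutativeRing as HeytingProperties
open import Algebra.Bundles using (CommutativeRing)
open import Algebra.Bundles.Raw using (RawMonoid)
import Algebra.Definitions.RawMonoid as RawMonoidDefinitions
import Algebra.Properties.CommutativeSemigroup as CommutativeSemigroupProperties
import Algebra.Properties.Ring as RingProperties
import Algebra.Properties.Semiring.Mult as SemiringMult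
import Algebra.Properties.Semiring.Sum as SemiringSum
import Algebra.Solver.Ring as RingSolver
open import Algebra.Solver.Ring.AlmostCommutativeRing using (fromCommutativeRing; _-Raw-AlmostCommutative⟶_)
open import Data.Bool.Base using (Bool; true; false; if_then_else_)
open import Data.Empty using (⊥-elim)
open import Data.Fin using (#_; _≤?_)
open import Data.Fin.Base as Fin using (Fin; zero; suc; toℕ; splitAt; join)
open import Data.Fin.Patterns
import Data.Fin.Properties as Fin
open import Data.Integer.Base as ℤ using (ℤ; +_; -[1+_]; 0ℤ)
import Data.Integer.Properties as ℤ
import Data.List.Base as List
open import Data.List.Relation.Unary.All using ([]; _∷_)
open import Data.List.Relation.Unary.Any using (Any)
import Data.List.Relation.Unary.Any.Properties as Any
open import Data.Maybe.Base as Maybe using (Maybe)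
open import Data.Maybe.Relation.Unary.All using (just; nothing)
open import Data.Nat.Base as ℕ using (ℕ; zero; suc; _≤_; z≤n; s≤s)
import Data.Nat.Properties as ℕ
open import Data.Product.Base using (Σ; ∃; ∃₂; ∃-syntax; _×_; _,_; proj₁; proj₂; uncurry)
import Data.Product.Properties as Product
open import Data.Sum.Base as Sum using (_⊎_; inj₁; inj₂; [_,_]′)
open import Data.Unit.Base using (⊤; tt)
open import Data.Vec.Base as Vec using (Vec; []; _∷_; lookup)
import Data.Vec.Functional as F
open import Data.Vec.Properties as VecProperties using (lookup∘tabulate)
open import Function.Base using (_∘_; id; case_of_)
open import Function.Bundles using (_⇔_; mk⇔; Equivalence)
open import Function.Definitions using (Injective)
open import Level using (0ℓ)
open import Relation.Binary.Bundles using (Setoid)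
open import Relation.Binary.Core using (Rel)
open import Relation.Binary.PropositionalEquality as ≡ using (_≡_; _≢_)
import Relation.Binary.Reasoning.Setoid as SetoidReasoning
open import Relation.Binary.Structures using (IsStrictPartialOrder)
open import Relation.Nullary using (¬_; Dec; yes; no; does; contradiction)
open import Relation.Nullary.Decidable using (map′; from-yes; _→-dec_; _×-dec_; _⊎-dec_; ¬?; dec-true; dec-false; does-⇔)
open import Relation.Nullary.Decidable.Core using (dec⇒maybe)
open import Relation.Unary using (Pred)
import Relation.Unary as U

-- As the reals come only with an apartness relation, equality in ℂ cannot be decided. What has to
-- be checked is therefore an identity between integers, or in ℤ[√3], indexed by labels and settled
-- by exhaustion; it reaches ℂ with denominators cleared (36 for the basis of V, 72 for the
-- eigenvectors). Nonvanishing is used positively: a sum apart from 0 has a term apart from 0, which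
-- supplies the coordinate that irreducibility, supports and eigenvalues start from. The links form
-- one hexagon and not two triangles: every vertex of Γ₂(x) is linked to one vertex of each of the
-- other two pairs, and triangles of links are excluded. An admissible ordering of Γ₂(x) fixes the
-- labelling, while the orderings of Γ₁(x) and Γ₃(x) enter the seeds only through a permutation of
-- three coordinates and a sign; the tables are verified for all 6 · 2 combinations. Words can
-- separate the types because every module is thin: a word that starts and ends on one level acts
-- there on each module as a scalar, and a polynomial in it can be chosen to vanish on all types but
-- one.

module PappusLabelling where
  open ≡
  open import Data.Vec.Relation.Unary.All as All using (All; []; _∷_)
  open import Data.Vec.Membership.DecPropositional (Product.≡-dec (Fin._≟_ {18}) (Fin._≟_ {18})) using (_∈_; _∈?_)

  -- Enumerations

  module Enumerations where
    ∷-injective : {A : Set} {m : ℕ} {a : A} {f : Fin m → A} →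
                  (∀ k → f k ≢ a) → Injective _≡_ _≡_ f → Injective _≡_ _≡_ (a F.∷ f)
    ∷-injective f≢a inj {zero}  {zero}  _  = refl
    ∷-injective f≢a inj {zero}  {suc l} eq = contradiction (sym eq) (f≢a l)
    ∷-injective f≢a inj {suc k} {zero}  eq = contradiction eq (f≢a k)
    ∷-injective f≢a inj {suc k} {suc l} eq = cong suc (inj eq)

    pair-injective : {A : Set} {a b : A} → a ≢ b → Injective _≡_ _≡_ (a F.∷ b F.∷ F.[])
    pair-injective a≢b = ∷-injective {m = 1} (λ { 0F b≡a → a≢b (sym b≡a) }) (∷-injective {m = 0} (λ ()) λ { {()} })

    ++-All : {A B : Set} (R : A → B → Set) {m k : ℕ} (f : Fin m → A) (f′ : Fin m → B)
             {g : Fin k → A} {g′ : Fin k → B} →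
             (∀ i → R (f i) (f′ i)) → (∀ j → R (g j) (g′ j)) →
             ∀ l → R ((f F.++ g) l) ((f′ F.++ g′) l)
    ++-All R {m} f f′ Rf Rg l with splitAt m l
    ... | inj₁ i = Rf i
    ... | inj₂ j = Rg j

    ++-injective : {A : Set} {m k : ℕ} {f : Fin m → A} {g : Fin k → A} →
                   Injective _≡_ _≡_ f → Injective _≡_ _≡_ g → (∀ i j → f i ≢ g j) →
                   Injective _≡_ _≡_ (f F.++ g)
    ++-injective {m = m} {k} {f} {g} f-inj g-inj f≢g {i} {j} eq = begin
      i  ≡⟨ Fin.join-splitAt m k i ⟨
      join m k (splitAt m i) ≡⟨ cong (join m k) (split (splitAt m i) (splitAt m j) eq) ⟩
      join m k (splitAt m j) ≡⟨ Fin.join-splitAt m k j ⟩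
      j  ∎
      where
      open ≡-Reasoning
      split : ∀ s t → [ f , g ]′ s ≡ [ f , g ]′ t → s ≡ t
      split (inj₁ a) (inj₁ b) e = cong inj₁ (f-inj e)
      split (inj₁ a) (inj₂ b) e = contradiction e (f≢g a b)
      split (inj₂ a) (inj₁ b) e = contradiction (sym e) (f≢g b a)
      split (inj₂ a) (inj₂ b) e = cong inj₂ (g-inj e)

    Enumeration-⇔ : {A : Set} {P Q : A → Set} {m : ℕ} → (∀ {a} → P a → Q a) → (∀ {a} → Q a → P a) →
                    Enumeration P m → Enumeration Q m
    Enumeration-⇔ P⇒Q Q⇒P e = record
      { elem = Enumeration.elem e ; injective = Enumeration.injective e
      ; sound = P⇒Q ∘ Enumeration.sound e ; complete = λ a → Enumeration.complete e a ∘ Q⇒P }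

    Enumeration-⊎ : {A : Set} {P Q : A → Set} {m k : ℕ} → (∀ {a} → P a → ¬ Q a) →
                    Enumeration P m → Enumeration Q k → Enumeration (λ a → P a ⊎ Q a) (m ℕ.+ k)
    Enumeration-⊎ {P = P} {Q} {m} {k} P⇒¬Q e f = record
      { elem      = E₁.elem F.++ E₂.elem
      ; injective = ++-injective E₁.injective E₂.injective
                      (λ i j eq → P⇒¬Q (subst P eq (E₁.sound i)) (E₂.sound j))
      ; sound     = ++-All (λ a _ → P a ⊎ Q a) E₁.elem E₁.elem {g′ = E₂.elem} (inj₁ ∘ E₁.sound) (inj₂ ∘ E₂.sound)
      ; complete  = λ a → λ where
          (inj₁ p) → let i , eq = E₁.complete a p in
                     i Fin.↑ˡ k , trans (cong [ _ , _ ]′ (Fin.splitAt-↑ˡ m i k)) eq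
          (inj₂ q) → let j , eq = E₂.complete a q in
                     m Fin.↑ʳ j , trans (cong [ _ , _ ]′ (Fin.splitAt-↑ʳ m k j)) eq }
      where
      module E₁ = Enumeration e
      module E₂ = Enumeration f

    module _ {n : ℕ} {P : Fin n → Set} {m : ℕ} (e : Enumeration P m) where
      open Enumeration e hiding (elem; injective)

      abstract
        -- Pigeonhole: a missed element `a` would make `a F.∷ f` injective, and its indices in the
        -- enumeration would inject `Fin (suc m)` into `Fin m`. This turns the numbers of the
        -- intersection array into statements about all neighbours of a vertex.
        covers : {f : Fin m → Fin n} → Injective _≡_ _≡_ f → (∀ k → P (f k)) →
                 ∀ {a} → P a → ∃[ k ] f k ≡ a
        covers {f} f-inj Pf {a} Pa with Fin.any? (λ k → f k Fin.≟ a)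
        ... | yes found = found
        ... | no ¬found = ⊥-elim (Fin.<⇒notInjective (ℕ.n<1+n m) (λ {k} {l} → index-inj {k} {l}))
          where
          g : Fin (suc m) → Fin n
          g = a F.∷ f
          Pg : ∀ k → P (g k)
          Pg zero    = Pa
          Pg (suc k) = Pf k
          index : Fin (suc m) → Fin m
          index k = proj₁ (complete (g k) (Pg k))
          index-inj : Injective _≡_ _≡_ index
          index-inj {k} {l} eq = ∷-injective (λ i fi≡a → ¬found (i , fi≡a)) f-inj
            (trans (sym (proj₂ (complete (g k) (Pg k))))
                   (trans (cong (elem e) eq) (proj₂ (complete (g l) (Pg l)))))

    unique : {n : ℕ} {P : Fin n → Set} → Enumeration P 1 → ∀ {a b} → P a → P b → a ≡ b
    unique e {a} {b} Pa Pb with Enumeration.complete e a Pa | Enumeration.complete e b Pb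
    ... | 0F , a≡ | 0F , b≡ = trans (sym a≡) b≡

    one-of-two : {n : ℕ} {P : Fin n → Set} → Enumeration P 2 →
                 ∀ {a b} → a ≢ b → P a → P b → ∀ {c} → P c → c ≡ a ⊎ c ≡ b
    one-of-two e a≢b Pa Pb Pc
      with covers e (pair-injective a≢b) (λ { 0F → Pa ; 1F → Pb }) Pc
    ... | 0F , eq = inj₁ (sym eq)
    ... | 1F , eq = inj₂ (sym eq)

    another : {n : ℕ} {P : Fin n → Set} → Enumeration P 2 → ∀ a → ∃[ b ] (b ≢ a × P b)
    another e a with elem e 0F Fin.≟ a
    ... | no e₀≢a  = elem e 0F , e₀≢a , Enumeration.sound e 0F
    ... | yes e₀≡a = elem e 1F
                   , (λ e₁≡a → contradiction (Enumeration.injective e (trans e₀≡a (sym e₁≡a))) λ ())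
                   , Enumeration.sound e 1F

    injective⇒surjective : {n : ℕ} {f : Fin n → Fin n} → Injective _≡_ _≡_ f → ∀ a → ∃[ k ] f k ≡ a
    injective⇒surjective {n} inj a = covers {P = λ _ → Fin n} all-of-them inj id a
      where
      all-of-them : Enumeration (λ _ → Fin n) n
      all-of-them = record { elem = id ; injective = id ; sound = id ; complete = λ a _ → a , refl }

  open Enumerations

  -- Distance

  module Distance {n : ℕ} (Γ : Graph n) where
    open Graph Γ public renaming (sym to ∼-sym)

    snoc : ∀ {k y w z} → Walk _∼_ k y w → w ∼ z → Walk _∼_ (suc k) y z
    snoc {zero}  refl         w∼z = _ , w∼z , refl
    snoc {suc k} (v , e , es) w∼z = v , e , snoc {k} es w∼z

    reverse : ∀ {k y z} → Walk _∼_ k y z → Walk _∼_ k z y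
    reverse {zero}  refl         = refl
    reverse {suc k} (w , e , es) = snoc {k} (reverse {k} es) (∼-sym e)

    d-walk : ∀ y z → Walk _∼_ (d y z) y z
    d-walk y z = proj₁ (proj₂ (shortest y z))

    d-least : ∀ {k y z} → Walk _∼_ k y z → d y z ≤ k
    d-least {k} {y} {z} = proj₂ (proj₂ (shortest y z)) k

    d-sym : ∀ {y z} → d y z ≡ d z y
    d-sym {y} {z} = ℕ.≤-antisym (d-least (reverse {d z y} (d-walk z y)))
                                (d-least (reverse {d y z} (d-walk y z)))

    d-refl : ∀ y → d y y ≡ 0
    d-refl y = ℕ.n≤0⇒n≡0 (d-least {0} refl)

    d≡0⇒≡ : ∀ {y z} → d y z ≡ 0 → y ≡ z
    d≡0⇒≡ {y} {z} eq with d y z | d-walk y z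
    ... | zero | y≡z = y≡z

    d≡1⇒∼ : ∀ {y z} → d y z ≡ 1 → y ∼ z
    d≡1⇒∼ {y} {z} eq with d y z | d-walk y z
    d≡1⇒∼ refl | 1 | w , y∼w , refl = y∼w

    d≡2⇒walk : ∀ {y z} → d y z ≡ 2 → ∃[ w ] (y ∼ w × w ∼ z)
    d≡2⇒walk {y} {z} eq with d y z | d-walk y z
    d≡2⇒walk refl | 2 | w , y∼w , _ , w∼z , refl = w , y∼w , w∼z

    d-step : ∀ {y w z} → w ∼ z → d y z ≤ suc (d y w)
    d-step {y} {w} w∼z = d-least (snoc {d y w} (d-walk y w) w∼z)

    ∼⇒≢ : ∀ {y z} → y ∼ z → y ≢ z
    ∼⇒≢ y∼z refl = irrefl y∼z

    ∼⇒d≡1 : ∀ {y z} → y ∼ z → d y z ≡ 1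
    ∼⇒d≡1 {y} {z} y∼z with d y z in eq | d-least {1} (z , y∼z , refl)
    ... | 0           | _       = contradiction (d≡0⇒≡ eq) (∼⇒≢ y∼z)
    ... | 1           | _       = refl
    ... | suc (suc _) | s≤s ()

  -- The Pappus graph: the local structure seen from a vertex

  -- Keeping d a variable here prevents its definition as a search for a
  -- shortest walk from being unfolded.
  record PappusMetric (_∼_ : Rel (Fin 18) 0ℓ) (d : Fin 18 → Fin 18 → ℕ) : Set where
    field
      ∼-sym    : ∀ {y z} → y ∼ z → z ∼ y
      d-sym    : ∀ {y z} → d y z ≡ d z y
      d-refl   : ∀ y → d y y ≡ 0
      d≡0⇒≡    : ∀ {y z} → d y z ≡ 0 → y ≡ z
      d≡1⇒∼    : ∀ {y z} → d y z ≡ 1 → y ∼ z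
      ∼⇒d≡1    : ∀ {y z} → y ∼ z → d y z ≡ 1
      d≡2⇒walk : ∀ {y z} → d y z ≡ 2 → ∃[ w ] (y ∼ w × w ∼ z)
      d-step   : ∀ {y w z} → w ∼ z → d y z ≤ suc (d y w)
      d≤4      : ∀ y z → d y z ≤ 4
      forward  : ∀ (h : Fin 4) {z w} → d z w ≡ toℕ h →
                 Enumeration (λ v → w ∼ v × d z v ≡ suc (toℕ h)) (lookup (3 ∷ 2 ∷ 2 ∷ 1 ∷ []) h)
      backward : ∀ (h : Fin 4) {z w} → d z w ≡ suc (toℕ h) →
                 Enumeration (λ v → w ∼ v × d z v ≡ toℕ h) (lookup (1 ∷ 1 ∷ 2 ∷ 3 ∷ []) h)

  -- The numbers b and c count the neighbours of `w` by their distance from `z`, so `regular` is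
  -- applied to the pair `w`, `z` in this order, whence the use of `d-sym`.
  pappusMetric : {Γ : Graph 18} → IsPappus Γ → PappusMetric (Graph._∼_ Γ) (Graph.d Γ)
  pappusMetric {Γ} pappus = record
    { ∼-sym = ∼-sym ; d-sym = d-sym ; d-refl = d-refl ; d≡0⇒≡ = d≡0⇒≡ ; d≡1⇒∼ = d≡1⇒∼
    ; ∼⇒d≡1 = ∼⇒d≡1 ; d≡2⇒walk = d≡2⇒walk ; d-step = λ {y} → d-step {y} ; d≤4 = proj₁ isDiameter
    ; forward  = λ h {z} {w} eq →
        Enumeration-⇔ (λ (a , b) → d≡1⇒∼ a , b) (λ (a , b) → ∼⇒d≡1 a , b)
          (subst (Enumeration _) (trans (sym (lookup∘tabulate (λ i → p (toℕ i) 1 (suc (toℕ i))) h)) (cong (λ bs → lookup bs h) b-array))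
            (regular (toℕ h) 1 (suc (toℕ h)) (ℕ.<⇒≤ (Fin.toℕ<n h)) (s≤s z≤n) (Fin.toℕ<n h)
                     w z (trans (d-sym {w} {z}) eq)))
    ; backward = λ h {z} {w} eq →
        Enumeration-⇔ (λ (a , b) → d≡1⇒∼ a , b) (λ (a , b) → ∼⇒d≡1 a , b)
          (subst (Enumeration _) (trans (sym (lookup∘tabulate (λ i → p (suc (toℕ i)) 1 (toℕ i)) h)) (cong (λ cs → lookup cs h) c-array))
            (regular (suc (toℕ h)) 1 (toℕ h) (Fin.toℕ<n h) (s≤s z≤n) (ℕ.<⇒≤ (Fin.toℕ<n h))
                     w z (trans (d-sym {w} {z}) eq)))
    }
    where
    open Distance Γ
    open HasIntersectionArray pappus

  module Pappus {_∼_ : Rel (Fin 18) 0ℓ} {d : Fin 18 → Fin 18 → ℕ} (metric : PappusMetric _∼_ d) where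
    open PappusMetric metric

    d≢ : ∀ {z v w a b} → d z v ≡ a → d z w ≡ b → a ≢ b → v ≢ w
    d≢ eq₁ eq₂ a≢b refl = a≢b (trans (sym eq₁) eq₂)

    neighbors : ∀ w → Enumeration (w ∼_) 3
    neighbors w = Enumeration-⇔ proj₁ (λ e → e , ∼⇒d≡1 e) (forward 0F (d-refl w))

    -- aᵢ = 0 for i = 1, 2, 3
    level-step : ∀ (h : Fin 3) {z w v} → d z w ≡ suc (toℕ h) → w ∼ v →
                 d z v ≡ suc (suc (toℕ h)) ⊎ d z v ≡ toℕ h
    level-step h {z} {w} {v} eq e = Sum.map proj₂ proj₂
      (subst (λ v → (w ∼ v × d z v ≡ suc (suc (toℕ h))) ⊎ (w ∼ v × d z v ≡ toℕ h))
             (proj₂ found) (E.sound (proj₁ found)))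
      where
      -- The two array entries add up to 3, the valency, so the neighbours one step further and one
      -- step closer are all there are. The sum computes only once `h` is a literal.
      both : ∀ h → d z w ≡ suc (toℕ h) → Enumeration (λ v → (w ∼ v × d z v ≡ suc (suc (toℕ h)))
                                                          ⊎ (w ∼ v × d z v ≡ toℕ h)) 3
      both 0F eq = Enumeration-⊎ (λ (_ , a) (_ , b) → case trans (sym a) b of λ ()) (forward 1F eq) (backward 0F eq)
      both 1F eq = Enumeration-⊎ (λ (_ , a) (_ , b) → case trans (sym a) b of λ ()) (forward 2F eq) (backward 1F eq)
      both 2F eq = Enumeration-⊎ (λ (_ , a) (_ , b) → case trans (sym a) b of λ ()) (forward 3F eq) (backward 2F eq)
      module E = Enumeration (both h eq)
      found = covers (neighbors w) E.injective (λ k → [ proj₁ , proj₁ ]′ (E.sound k)) e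

    next : ∀ (h : Fin 4) {z w} → d z w ≡ toℕ h → ∃[ v ] (w ∼ v × d z v ≡ suc (toℕ h))
    next 0F eq = elem (forward 0F eq) 0F , Enumeration.sound (forward 0F eq) 0F
    next 1F eq = elem (forward 1F eq) 0F , Enumeration.sound (forward 1F eq) 0F
    next 2F eq = elem (forward 2F eq) 0F , Enumeration.sound (forward 2F eq) 0F
    next 3F eq = elem (forward 3F eq) 0F , Enumeration.sound (forward 3F eq) 0F

    prev : ∀ (h : Fin 4) {z w} → d z w ≡ suc (toℕ h) → ∃[ v ] (w ∼ v × d z v ≡ toℕ h)
    prev 0F eq = elem (backward 0F eq) 0F , Enumeration.sound (backward 0F eq) 0F
    prev 1F eq = elem (backward 1F eq) 0F , Enumeration.sound (backward 1F eq) 0F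
    prev 2F eq = elem (backward 2F eq) 0F , Enumeration.sound (backward 2F eq) 0F
    prev 3F eq = elem (backward 3F eq) 0F , Enumeration.sound (backward 3F eq) 0F

    -- This is c₂ = 1: the graph has no quadrilaterals.
    common-unique : ∀ {z w a b} → d z w ≡ 2 → z ∼ a → a ∼ w → z ∼ b → b ∼ w → a ≡ b
    common-unique eq z∼a a∼w z∼b b∼w =
      unique (backward 1F eq) (∼-sym a∼w , ∼⇒d≡1 z∼a) (∼-sym b∼w , ∼⇒d≡1 z∼b)

    module From (x : Fin 18) where
      abstract
        -- As c₄ = 3, every neighbour of `x` is one step closer to `u`.
        Γ₄-Γ₁ : ∀ {u p} → d x u ≡ 4 → d x p ≡ 1 → d u p ≡ 3
        Γ₄-Γ₁ {u} {p} xu xp =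
          let k , eq = covers (neighbors x) (Enumeration.injective e)
                              (λ k → proj₁ (Enumeration.sound e k)) (d≡1⇒∼ xp)
          in subst (λ v → d u v ≡ 3) eq (proj₂ (Enumeration.sound e k))
          where
          e : Enumeration (λ v → x ∼ v × d u v ≡ 3) 3
          e = backward 3F (trans d-sym xu)

        -- The parent p of y is at distance 3 from u, so two of its three
        -- neighbours are at distance 2 from u; x is not among them.
        Γ₄-Γ₂ : ∀ {u y} → d x u ≡ 4 → d x y ≡ 2 → d u y ≡ 2
        Γ₄-Γ₂ {u} {y} xu xy = conclude
          (covers (neighbors p) (∷-injective e≢x (Enumeration.injective e)) pe (∼-sym y∼p))
          where
          p : Fin 18
          p = proj₁ (prev 1F xy)
          y∼p : y ∼ p
          y∼p = proj₁ (proj₂ (prev 1F xy))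
          xp : d x p ≡ 1
          xp = proj₂ (proj₂ (prev 1F xy))
          e : Enumeration (λ v → p ∼ v × d u v ≡ 2) 2
          e = backward 2F (Γ₄-Γ₁ xu xp)
          e≢x : ∀ k → elem e k ≢ x
          e≢x k = d≢ (proj₂ (Enumeration.sound e k)) (trans d-sym xu) (λ ())
          pe : ∀ k → p ∼ (x F.∷ elem e) k
          pe zero    = ∼-sym (d≡1⇒∼ xp)
          pe (suc k) = proj₁ (Enumeration.sound e k)
          conclude : (∃[ k ] (x F.∷ elem e) k ≡ y) → d u y ≡ 2
          conclude (zero  , eq) = contradiction eq (d≢ (d-refl x) xy (λ ()))
          conclude (suc k , eq) = subst (λ v → d u v ≡ 2) eq (proj₂ (Enumeration.sound e k))

        -- A common neighbour of `u` and `y` exists by `Γ₄-Γ₂`. Seen from `y` it has level 1 or 3,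
        -- and level 1 is excluded because `u` has level 4.
        Γ₄-covers-Γ₂ : ∀ {u y} → d x u ≡ 4 → d x y ≡ 2 → ∃[ q ] (d x q ≡ 3 × y ∼ q × u ∼ q)
        Γ₄-covers-Γ₂ {u} {y} xu xy =
          let q , u∼q , q∼y = d≡2⇒walk (Γ₄-Γ₂ xu xy)
          in q , [ id , (λ xq → contradiction xq (above-1 u∼q)) ]′ (level-step 1F xy (∼-sym q∼y)) , ∼-sym q∼y , u∼q
          where
          above-1 : ∀ {q} → u ∼ q → d x q ≢ 1
          above-1 u∼q xq = case subst₂ (λ a b → a ≤ suc b) xu xq (d-step (∼-sym u∼q)) of λ { (s≤s (s≤s ())) }

        -- As b₂ = 2, `q` and `q′` are all the neighbours of `y` on level 3, and by `Γ₄-covers-Γ₂`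
        -- at least one of them reaches `u`.
        Γ₄-choice : ∀ {u y q q′} → d x u ≡ 4 → d x y ≡ 2 → d x q ≡ 3 → d x q′ ≡ 3 → q ≢ q′ →
                    y ∼ q → y ∼ q′ → ¬ (q ∼ u) → q′ ∼ u
        Γ₄-choice {u} {y} {q} {q′} xu xy xq xq′ q≢q′ y∼q y∼q′ q≁u =
          let r , xr , y∼r , u∼r = Γ₄-covers-Γ₂ xu xy
          in conclude u∼r (one-of-two (forward 2F xy) q≢q′ (y∼q , xq) (y∼q′ , xq′) (y∼r , xr))
          where
          conclude : ∀ {r} → u ∼ r → r ≡ q ⊎ r ≡ q′ → q′ ∼ u
          conclude u∼r (inj₁ refl) = contradiction (∼-sym u∼r) q≁u
          conclude u∼r (inj₂ refl) = ∼-sym u∼r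

        -- The counterpart of `Γ₄-choice`: at most one of them reaches `u`, since `u` and `y` are at
        -- distance 2 and c₂ = 1.
        Γ₄-single : ∀ {u y q q′} → d x u ≡ 4 → d x y ≡ 2 → q ≢ q′ → y ∼ q → y ∼ q′ →
                    q ∼ u → ¬ (q′ ∼ u)
        Γ₄-single xu xy q≢q′ y∼q y∼q′ q∼u q′∼u = q≢q′
          (common-unique (Γ₄-Γ₂ xu xy) (∼-sym q∼u) (∼-sym y∼q) (∼-sym q′∼u) (∼-sym y∼q′))

        -- This lemma and the next two express c₃ = 2, b₃ = 1 and c₂ = 1.
        two-below : ∀ {q a b c} → d x q ≡ 3 → a ≢ b → q ∼ a × d x a ≡ 2 → q ∼ b × d x b ≡ 2 →
                    q ∼ c × d x c ≡ 2 → c ≡ a ⊎ c ≡ b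
        two-below xq a≢b qa qb = one-of-two (backward 2F xq) a≢b qa qb

        up-unique : ∀ {q u u′} → d x q ≡ 3 → d x u ≡ 4 → d x u′ ≡ 4 → q ∼ u → q ∼ u′ → u ≡ u′
        up-unique xq xu xu′ q∼u q∼u′ = unique (forward 3F xq) (q∼u , xu) (q∼u′ , xu′)

        parent-unique : ∀ {y p p′} → d x y ≡ 2 → d x p ≡ 1 → d x p′ ≡ 1 → y ∼ p → y ∼ p′ → p ≡ p′
        parent-unique xy xp xp′ y∼p y∼p′ = unique (backward 1F xy) (y∼p , xp) (y∼p′ , xp′)

  -- Labellings

  pairs : Fin 3 → Fin 2 → Fin 6
  pairs i = lookup (lookup ((0F ∷ 1F ∷ []) ∷ (2F ∷ 3F ∷ []) ∷ (4F ∷ 5F ∷ []) ∷ []) i)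

  -- The directed sides of the hexagon y₁, y₃, y₅, y₂, y₄, y₆, each ending where the next begins.
  -- Antipodal vertices of it are the `pairs`.
  arcs : Fin 6 → Fin 2 → Fin 6
  arcs i = lookup (lookup ((0F ∷ 2F ∷ []) ∷ (2F ∷ 4F ∷ []) ∷ (4F ∷ 1F ∷ []) ∷
                           (1F ∷ 3F ∷ []) ∷ (3F ∷ 5F ∷ []) ∷ (5F ∷ 0F ∷ []) ∷ []) i)

  -- Labels 0; 1, 2, 3; 4, …, 9; 10, …, 15; 16, 17 stand for x; the parents of
  -- the pairs; y₁, …, y₆; the common neighbours of the consecutive vertices of
  -- y₁, y₃, y₅, y₂, y₄, y₆; and the two vertices of Γ₄(x).
  level : Fin 18 → ℕ
  level = F.replicate 1 0 F.++ F.replicate 3 1 F.++ F.replicate 6 2 F.++ F.replicate 6 3 F.++ F.replicate 2 4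

  -- In the rows of the level 3 labels 10 to 15, position 2F holds the neighbour on level 4; later
  -- steps rely on this.
  neighbor : Fin 18 → Fin 3 → Fin 18
  neighbor i = lookup (lookup
    ( (# 1  ∷ # 2  ∷ # 3  ∷ [])
    ∷ (# 0  ∷ # 4  ∷ # 5  ∷ []) ∷ (# 0  ∷ # 6  ∷ # 7  ∷ []) ∷ (# 0  ∷ # 8  ∷ # 9  ∷ [])
    ∷ (# 1  ∷ # 10 ∷ # 15 ∷ []) ∷ (# 1  ∷ # 12 ∷ # 13 ∷ []) ∷ (# 2  ∷ # 10 ∷ # 11 ∷ [])
    ∷ (# 2  ∷ # 13 ∷ # 14 ∷ []) ∷ (# 3  ∷ # 11 ∷ # 12 ∷ []) ∷ (# 3  ∷ # 14 ∷ # 15 ∷ [])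
    ∷ (# 4  ∷ # 6  ∷ # 16 ∷ []) ∷ (# 6  ∷ # 8  ∷ # 17 ∷ []) ∷ (# 5  ∷ # 8  ∷ # 16 ∷ [])
    ∷ (# 5  ∷ # 7  ∷ # 17 ∷ []) ∷ (# 7  ∷ # 9  ∷ # 16 ∷ []) ∷ (# 4  ∷ # 9  ∷ # 17 ∷ [])
    ∷ (# 10 ∷ # 12 ∷ # 14 ∷ []) ∷ (# 11 ∷ # 13 ∷ # 15 ∷ [])
    ∷ []) i)

  y-label : Fin 6 → Fin 18
  y-label k = 4 Fin.↑ʳ (k Fin.↑ˡ 8)

  abstract
    neighbor-injective : ∀ i j k → neighbor i j ≡ neighbor i k → j ≡ k
    neighbor-injective = from-yes (Fin.all? λ i → Fin.all? λ j → Fin.all? λ k →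
      (neighbor i j Fin.≟ neighbor i k) →-dec (j Fin.≟ k))

  -- Nonadjacency need not be recorded: the graph is cubic and the three neighbours listed for a
  -- label are distinct, so they exhaust its neighbours.
  record Labelling (_∼_ : Rel (Fin 18) 0ℓ) (d : Fin 18 → Fin 18 → ℕ) (x : Fin 18) : Set where
    field
      label           : Fin 18 → Fin 18
      label-injective : Injective _≡_ _≡_ label
      label-level     : ∀ i → d x (label i) ≡ level i
      edge            : ∀ i k → label i ∼ label (neighbor i k)

  edges : Vec (Fin 18 × Fin 18) 27
  edges = (# 0 , # 1) ∷ (# 0 , # 2) ∷ (# 0 , # 3)
        ∷ (# 1 , # 4) ∷ (# 1 , # 5) ∷ (# 2 , # 6) ∷ (# 2 , # 7) ∷ (# 3 , # 8) ∷ (# 3 , # 9)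
        ∷ (# 10 , # 4) ∷ (# 10 , # 6) ∷ (# 11 , # 6) ∷ (# 11 , # 8) ∷ (# 12 , # 8) ∷ (# 12 , # 5)
        ∷ (# 13 , # 5) ∷ (# 13 , # 7) ∷ (# 14 , # 7) ∷ (# 14 , # 9) ∷ (# 15 , # 9) ∷ (# 15 , # 4)
        ∷ (# 10 , # 16) ∷ (# 11 , # 17) ∷ (# 12 , # 16) ∷ (# 13 , # 17) ∷ (# 14 , # 16) ∷ (# 15 , # 17)
        ∷ []

  abstract
    edges-complete : ∀ i k → (i , neighbor i k) ∈ edges ⊎ (neighbor i k , i) ∈ edges
    edges-complete = from-yes (Fin.all? λ i → Fin.all? λ k →
      ((i , neighbor i k) ∈? edges) ⊎-dec ((neighbor i k , i) ∈? edges))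

    pairs-disjoint : ∀ i j → pairs j 0F ≡ pairs i 0F ⊎ pairs j 0F ≡ pairs i 1F → i ≡ j
    pairs-disjoint = from-yes (Fin.all? λ i → Fin.all? λ j →
      ((pairs j 0F Fin.≟ pairs i 0F) ⊎-dec (pairs j 0F Fin.≟ pairs i 1F)) →-dec (i Fin.≟ j))

    pairs-distinct : ∀ i → pairs i 0F ≢ pairs i 1F
    pairs-distinct = from-yes (Fin.all? λ i → ¬? (pairs i 0F Fin.≟ pairs i 1F))

    arcs-distinct : ∀ k → arcs k 0F ≢ arcs k 1F
    arcs-distinct = from-yes (Fin.all? λ k → ¬? (arcs k 0F Fin.≟ arcs k 1F))

    arcs-determined : ∀ k l → arcs l 0F ≡ arcs k 0F ⊎ arcs l 0F ≡ arcs k 1F →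
                      arcs l 1F ≡ arcs k 0F ⊎ arcs l 1F ≡ arcs k 1F → k ≡ l
    arcs-determined = from-yes (Fin.all? λ k → Fin.all? λ l →
      ((arcs l 0F Fin.≟ arcs k 0F) ⊎-dec (arcs l 0F Fin.≟ arcs k 1F)) →-dec
      (((arcs l 1F Fin.≟ arcs k 0F) ⊎-dec (arcs l 1F Fin.≟ arcs k 1F)) →-dec (k Fin.≟ l)))

  module _ {_∼_ : Rel (Fin 18) 0ℓ} {d : Fin 18 → Fin 18 → ℕ} (metric : PappusMetric _∼_ d) {x : Fin 18} where
    open PappusMetric metric
    open Pappus metric
    open From x

    -- The part of a labelling that an admissible ordering of Γ₂(x) provides directly: parents of
    -- the pairs and links along the hexagon. The two vertices of level 4 and their adjacencies are
    -- derived from it.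
    record Frame : Set where
      field
        p : Fin 3 → Fin 18
        y : Fin 6 → Fin 18
        q : Fin 6 → Fin 18
        y-injective : Injective _≡_ _≡_ y
        xp  : ∀ i → d x (p i) ≡ 1
        xy  : ∀ i → d x (y i) ≡ 2
        xq  : ∀ i → d x (q i) ≡ 3
        p∼y : ∀ i e → p i ∼ y (pairs i e)
        q∼y : ∀ i e → q i ∼ y (arcs i e)

    module FromFrame (frame : Frame) where
      open Frame frame

      -- As b₁ = 2, a parent has only the two vertices of its own pair above it, so equal parents
      -- would have a vertex of two pairs in common.
      p-injective : Injective _≡_ _≡_ p
      p-injective {i} {j} pᵢ≡pⱼ = pairs-disjoint i j (Sum.map y-injective y-injective
        (one-of-two (forward 1F (xp i)) (pairs-distinct i ∘ y-injective)
          (p∼y i 0F , xy _) (p∼y i 1F , xy _) (subst (_∼ _) (sym pᵢ≡pⱼ) (p∼y j 0F) , xy _)))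

      -- As c₃ = 2, a link determines the side of the hexagon below it.
      q-injective : Injective _≡_ _≡_ q
      q-injective {k} {l} qₖ≡qₗ = arcs-determined k l (below 0F) (below 1F)
        where
        below : ∀ e → arcs l e ≡ arcs k 0F ⊎ arcs l e ≡ arcs k 1F
        below e = Sum.map y-injective y-injective
          (two-below (xq k) (arcs-distinct k ∘ y-injective)
            (q∼y k 0F , xy _) (q∼y k 1F , xy _) (subst (_∼ _) (sym qₖ≡qₗ) (q∼y l e) , xy _))

      q≢ : ∀ {k l} → k ≢ l → q k ≢ q l
      q≢ k≢l = k≢l ∘ q-injective

      u v : Fin 18
      u = proj₁ (next 3F (xq 0F))
      v = proj₁ (next 3F (xq 1F))

      xu : d x u ≡ 4
      xu = proj₂ (proj₂ (next 3F (xq 0F)))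
      xv : d x v ≡ 4
      xv = proj₂ (proj₂ (next 3F (xq 1F)))

      q₀∼u : q 0F ∼ u
      q₀∼u = proj₁ (proj₂ (next 3F (xq 0F)))
      q₁∼v : q 1F ∼ v
      q₁∼v = proj₁ (proj₂ (next 3F (xq 1F)))

      -- The first two links meet in `y 2F`, and a vertex of Γ₄(x) is adjacent to only one of the
      -- links at a given vertex.
      u≢v : u ≢ v
      u≢v u≡v = Γ₄-single xu (xy 2F) (q≢ λ ()) (∼-sym (q∼y 0F 1F)) (∼-sym (q∼y 1F 0F))
                          q₀∼u (subst (q 1F ∼_) (sym u≡v) q₁∼v)

      not-u : ∀ {k} → q k ∼ v → ¬ (q k ∼ u)
      not-u qv qu = u≢v (up-unique (xq _) xu xv qu qv)
      not-v : ∀ {k} → q k ∼ u → ¬ (q k ∼ v)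
      not-v qu qv = u≢v (up-unique (xq _) xu xv qu qv)

      -- Consecutive links share a vertex of the hexagon, where one of them must be adjacent to `w`.
      -- Together with `not-u` and `not-v` this makes `u` and `v` alternate along the hexagon.
      choose : ∀ {w} → d x w ≡ 4 → ∀ k l → k ≢ l → arcs k 1F ≡ arcs l 0F → ¬ (q k ∼ w) → q l ∼ w
      choose xw k l k≢l eq = Γ₄-choice xw (xy (arcs l 0F)) (xq k) (xq l) (q≢ k≢l)
        (subst (λ i → y i ∼ q k) eq (∼-sym (q∼y k 1F))) (∼-sym (q∼y l 0F))

      q₂∼u : q 2F ∼ u
      q₂∼u = choose xu 1F 2F (λ ()) refl (not-u q₁∼v)
      q₃∼v : q 3F ∼ v
      q₃∼v = choose xv 2F 3F (λ ()) refl (not-v q₂∼u)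
      q₄∼u : q 4F ∼ u
      q₄∼u = choose xu 3F 4F (λ ()) refl (not-u q₃∼v)
      q₅∼v : q 5F ∼ v
      q₅∼v = choose xv 4F 5F (λ ()) refl (not-v q₄∼u)

      f : Fin 18 → Fin 18
      f = (x F.∷ F.[]) F.++ p F.++ y F.++ q F.++ (u F.∷ v F.∷ F.[])

      x∼p : ∀ i → x ∼ p i
      x∼p i = d≡1⇒∼ (xp i)

      all-edges : All (λ (i , j) → f i ∼ f j) edges
      all-edges = x∼p 0F ∷ x∼p 1F ∷ x∼p 2F
                ∷ p∼y 0F 0F ∷ p∼y 0F 1F ∷ p∼y 1F 0F ∷ p∼y 1F 1F ∷ p∼y 2F 0F ∷ p∼y 2F 1F
                ∷ q∼y 0F 0F ∷ q∼y 0F 1F ∷ q∼y 1F 0F ∷ q∼y 1F 1F ∷ q∼y 2F 0F ∷ q∼y 2F 1F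
                ∷ q∼y 3F 0F ∷ q∼y 3F 1F ∷ q∼y 4F 0F ∷ q∼y 4F 1F ∷ q∼y 5F 0F ∷ q∼y 5F 1F
                ∷ q₀∼u ∷ q₁∼v ∷ q₂∼u ∷ q₃∼v ∷ q₄∼u ∷ q₅∼v ∷ []

      levels : ∀ i → d x (f i) ≡ level i
      levels =
        ++-All At (x F.∷ F.[]) (F.replicate 1 0) (λ { 0F → d-refl x })
          (++-All At p (F.replicate 3 1) xp
            (++-All At y (F.replicate 6 2) xy
              (++-All At q (F.replicate 6 3) xq (λ { 0F → xu ; 1F → xv }))))
        where
        At : Fin 18 → ℕ → Set
        At w h = d x w ≡ h

      labelling : Labelling _∼_ d x
      labelling = record
        { label = f
        ; label-injective =
            ++-injective (∷-injective {m = 0} (λ ()) λ { {()} })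
              (++-injective p-injective
                (++-injective y-injective
                  (++-injective q-injective (pair-injective u≢v)
                    λ i j → d≢ (xq i) (levels (16 Fin.↑ʳ j)) (from-yes (Fin.all? λ j → ¬? (3 ℕ.≟ level (16 Fin.↑ʳ j))) j))
                  λ i j → d≢ (xy i) (levels (10 Fin.↑ʳ j)) (from-yes (Fin.all? λ j → ¬? (2 ℕ.≟ level (10 Fin.↑ʳ j))) j))
                λ i j → d≢ (xp i) (levels (4 Fin.↑ʳ j)) (from-yes (Fin.all? λ j → ¬? (1 ℕ.≟ level (4 Fin.↑ʳ j))) j))
              λ { 0F j → d≢ (d-refl x) (levels (1 Fin.↑ʳ j)) (from-yes (Fin.all? λ j → ¬? (0 ℕ.≟ level (1 Fin.↑ʳ j))) j) }
        ; label-level = levels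
        ; edge = λ i k → [ All.lookup all-edges , ∼-sym ∘ All.lookup all-edges ]′ (edges-complete i k)
        }

  -- Existence of an admissible ordering of Γ₂(x)

  module AdmissibleOrdering where
    one-or-opposite : ∀ (e f : Fin 2) → f ≡ e ⊎ f ≡ Fin.opposite e
    one-or-opposite 0F 0F = inj₁ refl
    one-or-opposite 0F 1F = inj₂ refl
    one-or-opposite 1F 0F = inj₂ refl
    one-or-opposite 1F 1F = inj₁ refl

    -- Here `e` and `f` name the children of the second and third parent that are linked to y₁.
    -- These children become y₃ and y₆, the hexagon neighbours of y₁; their siblings become y₄ and
    -- y₅.
    child-index : Fin 2 → Fin 2 → Fin 6 → Fin 3 × Fin 2
    child-index e f = lookup ((0F , 0F) ∷ (0F , 1F) ∷ (1F , e) ∷ (1F , Fin.opposite e)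
                            ∷ (2F , Fin.opposite f) ∷ (2F , f) ∷ [])

    _≟ₚ_ : (a b : Fin 3 × Fin 2) → Dec (a ≡ b)
    _≟ₚ_ = Product.≡-dec Fin._≟_ Fin._≟_

    abstract
      child-index-injective : ∀ e f k l → child-index e f k ≡ child-index e f l → k ≡ l
      child-index-injective = from-yes (Fin.all? λ e → Fin.all? λ f → Fin.all? λ k → Fin.all? λ l →
        (child-index e f k ≟ₚ child-index e f l) →-dec (k Fin.≟ l))

      child-index-surjective : ∀ e f i g → ∃[ k ] child-index e f k ≡ (i , g)
      child-index-surjective = from-yes (Fin.all? λ e → Fin.all? λ f → Fin.all? λ i → Fin.all? λ g →
        Fin.any? λ k → child-index e f k ≟ₚ (i , g))

    module _ {_∼_ : Rel (Fin 18) 0ℓ} {d : Fin 18 → Fin 18 → ℕ} (metric : PappusMetric _∼_ d) (x : Fin 18) where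
      open PappusMetric metric
      open Pappus metric
      open From x

      Linked : Fin 18 → Fin 18 → Set
      Linked a b = ∃[ q ] (d x q ≡ 3 × q ∼ a × q ∼ b)

      Linked-sym : ∀ {a b} → Linked a b → Linked b a
      Linked-sym (q , xq , qa , qb) = q , xq , qb , qa

      abstract
        -- Bipartiteness puts `p` at distance 2 from `p′` and hence at distance 3 from `m`. As c₃ =
        -- 2, `m` has besides `p′` another neighbour `q` at distance 2 from `p`. It lies on level 3,
        -- since `m` has only one parent, and the midpoint between `p` and `q` is the required child
        -- of `p`.
        linked-to-child : ∀ {m p′ p} → d x m ≡ 2 → d x p′ ≡ 1 → m ∼ p′ → d x p ≡ 1 → ¬ (m ∼ p) →
                          ∃[ w ] (Linked m w × p ∼ w × d x w ≡ 2)
        linked-to-child {m} {p′} {p} xm xp′ m∼p′ xp m≁p = w , (q , xq , ∼-sym m∼q , ∼-sym w∼q) , p∼w , xw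
          where
          x∼p : x ∼ p
          x∼p = d≡1⇒∼ xp
          pp′ : d p p′ ≡ 2
          pp′ = [ id , (λ eq → contradiction (subst (m ∼_) (sym (d≡0⇒≡ eq)) m∼p′) m≁p) ]′
            (level-step 0F (∼⇒d≡1 (∼-sym x∼p)) (d≡1⇒∼ xp′))
          pm : d p m ≡ 3
          pm = [ id , (λ eq → contradiction (∼-sym (d≡1⇒∼ eq)) m≁p) ]′ (level-step 1F pp′ (∼-sym m∼p′))
          other : ∃[ q ] (q ≢ p′ × m ∼ q × d p q ≡ 2)
          other = another (backward 2F pm) p′
          q : Fin 18
          q = proj₁ other
          m∼q : m ∼ q
          m∼q = proj₁ (proj₂ (proj₂ other))
          xq : d x q ≡ 3
          xq = [ id , (λ eq → contradiction (parent-unique xm eq xp′ m∼q m∼p′) (proj₁ (proj₂ other))) ]′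
            (level-step 1F xm m∼q)
          mid : ∃[ w ] (p ∼ w × w ∼ q)
          mid = d≡2⇒walk (proj₂ (proj₂ (proj₂ other)))
          w : Fin 18
          w = proj₁ mid
          p∼w : p ∼ w
          p∼w = proj₁ (proj₂ mid)
          w∼q : w ∼ q
          w∼q = proj₂ (proj₂ mid)
          xw : d x w ≡ 2
          xw = [ id , (λ eq → contradiction (∼⇒d≡1 (subst (_∼ q) (sym (d≡0⇒≡ eq)) w∼q))
                                            (λ xq≡1 → case trans (sym xq) xq≡1 of λ ())) ]′
            (level-step 0F xp p∼w)

        -- A vertex of Γ₄(x) adjacent to the link of a and b would have to be
        -- adjacent to one of the other two links, as it reaches c.
        no-triangle : ∀ {a b c} → d x a ≡ 2 → d x b ≡ 2 → d x c ≡ 2 → a ≢ b → b ≢ c → a ≢ c →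
                      Linked a b → Linked b c → ¬ Linked c a
        no-triangle {a} {b} {c} xa xb xc a≢b b≢c a≢c (q , xq , qa , qb) (r , xr , rb , rc) (s , xs , sc , sa)
          with next 3F xq
        ... | u , q∼u , xu = Γ₄-single xu xa q≢s (∼-sym qa) (∼-sym sa) q∼u
          (Γ₄-choice xu xc xr xs r≢s (∼-sym rc) (∼-sym sc) (Γ₄-single xu xb q≢r (∼-sym qb) (∼-sym rb) q∼u))
          where
          ¬three : ∀ {t} → d x t ≡ 3 → t ∼ a → t ∼ b → ¬ (t ∼ c)
          ¬three xt ta tb tc = [ a≢c ∘ sym , b≢c ∘ sym ]′ (two-below xt a≢b (ta , xa) (tb , xb) (tc , xc))
          q≢r : q ≢ r
          q≢r refl = ¬three xq qa qb rc
          q≢s : q ≢ s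
          q≢s refl = ¬three xq qa qb sc
          r≢s : r ≢ s
          r≢s refl = ¬three xr sa rb rc

      record Ordered : Set where
        field
          frame    : Frame metric {x}
          complete : ∀ w → d x w ≡ 2 → ∃[ k ] Frame.y frame k ≡ w

      Γ₁ : Enumeration (λ v → x ∼ v × d x v ≡ 1) 3
      Γ₁ = forward 0F (d-refl x)

      module Children where
        xp : ∀ i → d x (elem Γ₁ i) ≡ 1
        xp i = proj₂ (Enumeration.sound Γ₁ i)

        children : ∀ i → Enumeration (λ v → elem Γ₁ i ∼ v × d x v ≡ 2) 2
        children i = forward 1F (xp i)

        child : Fin 3 → Fin 2 → Fin 18
        child i = elem (children i)

        p∼child : ∀ i e → elem Γ₁ i ∼ child i e
        p∼child i e = proj₁ (Enumeration.sound (children i) e)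

        xchild : ∀ i e → d x (child i e) ≡ 2
        xchild i e = proj₂ (Enumeration.sound (children i) e)

        child-injective : ∀ {i e j f} → child i e ≡ child j f → (i , e) ≡ (j , f)
        child-injective {i} {e} {j} {f} eq
          with Enumeration.injective Γ₁ (parent-unique (xchild i e) (xp i) (xp j) (∼-sym (p∼child i e))
                                          (subst (_∼ elem Γ₁ j) (sym eq) (∼-sym (p∼child j f))))
        ... | refl = cong (i ,_) (Enumeration.injective (children i) eq)

        child≢ : ∀ {i e j f} → i ≢ j → child i e ≢ child j f
        child≢ i≢j eq = i≢j (cong proj₁ (child-injective eq))

        child-complete : ∀ w → d x w ≡ 2 → ∃₂ λ i e → child i e ≡ w
        child-complete w xw with prev 1F xw
        ... | p , w∼p , xp with Enumeration.complete Γ₁ p (d≡1⇒∼ xp , xp)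
        ...   | i , refl = i , Enumeration.complete (children i) w (∼-sym w∼p , xw)

        link : ∀ i e j → i ≢ j → ∃[ f ] Linked (child i e) (child j f)
        link i e j i≢j with linked-to-child (xchild i e) (xp i) (∼-sym (p∼child i e)) (xp j)
          (λ c∼p → i≢j (Enumeration.injective Γ₁ (parent-unique (xchild i e) (xp i) (xp j) (∼-sym (p∼child i e)) c∼p)))
        ... | w , linked , p∼w , xw with Enumeration.complete (children j) w (p∼w , xw)
        ...   | f , refl = f , linked

        -- A path of links turns into the remaining pair, but avoids the vertex
        -- that would close a triangle.
        turn : ∀ {i j k e f g} → i ≢ j → i ≢ k → j ≢ k → Linked (child i e) (child j f) →
               Linked (child i e) (child k g) → Linked (child j f) (child k (Fin.opposite g))
        turn {i} {j} {k} {e} {f} {g} i≢j i≢k j≢k ab ac with link j f k j≢k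
        ... | h , bc with one-or-opposite g h
        ...   | inj₁ refl = contradiction (Linked-sym ac)
                              (no-triangle (xchild i e) (xchild j f) (xchild k g)
                                           (child≢ i≢j) (child≢ j≢k) (child≢ i≢k) ab bc)
        ...   | inj₂ refl = bc

        e f : Fin 2
        e = proj₁ (link 0F 0F 1F λ ())
        f = proj₁ (link 0F 0F 2F λ ())

        y : Fin 6 → Fin 18
        y = uncurry child ∘ child-index e f

        l₀₂ : Linked (y 0F) (y 2F)
        l₀₂ = proj₂ (link 0F 0F 1F λ ())
        l₅₀ : Linked (y 5F) (y 0F)
        l₅₀ = Linked-sym (proj₂ (link 0F 0F 2F λ ()))
        -- The remaining four links come from `turn`, applied twice at `y 0F`, then at `y 2F` and at
        -- `y 5F`; this closes the hexagon.
        l₂₄ : Linked (y 2F) (y 4F)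
        l₂₄ = turn (λ ()) (λ ()) (λ ()) l₀₂ (Linked-sym l₅₀)
        l₅₃ : Linked (y 5F) (y 3F)
        l₅₃ = turn (λ ()) (λ ()) (λ ()) (Linked-sym l₅₀) l₀₂
        l₄₁ : Linked (y 4F) (y 1F)
        l₄₁ = turn (λ ()) (λ ()) (λ ()) l₂₄ (Linked-sym l₀₂)
        l₁₃ : Linked (y 1F) (y 3F)
        l₁₃ = Linked-sym (turn (λ ()) (λ ()) (λ ()) l₅₃ l₅₀)

        arc : ∀ k → Linked (y (arcs k 0F)) (y (arcs k 1F))
        arc 0F = l₀₂
        arc 1F = l₂₄
        arc 2F = l₄₁
        arc 3F = l₁₃
        arc 4F = Linked-sym l₅₃
        arc 5F = l₅₀

        ordered : Ordered
        ordered = record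
          { frame = record
            { p = elem Γ₁ ; y = y ; q = proj₁ ∘ arc
            ; y-injective = λ {k} {l} eq → child-index-injective e f k l (child-injective eq)
            ; xp = xp
            ; xy = λ k → xchild (proj₁ (child-index e f k)) (proj₂ (child-index e f k))
            ; xq = proj₁ ∘ proj₂ ∘ arc
            ; p∼y = λ { 0F 0F → p∼child 0F 0F ; 0F 1F → p∼child 0F 1F
                      ; 1F 0F → p∼child 1F e  ; 1F 1F → p∼child 1F (Fin.opposite e)
                      ; 2F 0F → p∼child 2F (Fin.opposite f) ; 2F 1F → p∼child 2F f }
            ; q∼y = λ { k 0F → proj₁ (proj₂ (proj₂ (arc k))) ; k 1F → proj₂ (proj₂ (proj₂ (arc k))) }
            }
          ; complete = λ w xw →
              let i , g , eq = child-complete w xw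
                  k , eq′    = child-index-surjective e f i g
              in k , trans (cong (uncurry child) eq′) eq
          }

  open AdmissibleOrdering

  -- Vertices in terms of labels

  module Labelled {_∼_ : Rel (Fin 18) 0ℓ} {d : Fin 18 → Fin 18 → ℕ} (metric : PappusMetric _∼_ d)
                  {x : Fin 18} (labelling : Labelling _∼_ d x) where
    open PappusMetric metric
    open Pappus metric
    open Labelling labelling public

    index : Fin 18 → Fin 18
    index v = proj₁ (injective⇒surjective label-injective v)

    label-index : ∀ v → label (index v) ≡ v
    label-index v = proj₂ (injective⇒surjective label-injective v)

    index-label : ∀ i → index (label i) ≡ i
    index-label i = label-injective (label-index (label i))

    index-injective : ∀ {v w} → index v ≡ index w → v ≡ w
    index-injective {v} {w} eq = trans (sym (label-index v)) (trans (cong label eq) (label-index w))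

    -- The valency is 3 and the three listed neighbours are distinct.
    edge-complete : ∀ {i v} → label i ∼ v → ∃[ k ] label (neighbor i k) ≡ v
    edge-complete {i} = covers (neighbors (label i))
      (λ {j} {k} eq → neighbor-injective i j k (label-injective eq)) (edge i)

    sphere : ∀ {h m} (o : Fin m → Fin 18) → Injective _≡_ _≡_ o → (∀ k → level (o k) ≡ h) →
             (∀ i → level i ≡ h → ∃[ k ] o k ≡ i) → Enumeration (λ v → d x v ≡ h) m
    sphere o inj at-h all-h = record
      { elem      = label ∘ o
      ; injective = inj ∘ label-injective
      ; sound     = λ k → trans (label-level (o k)) (at-h k)
      ; complete  = λ v eq →
          let k , o≡ = all-h (index v) (trans (sym (label-level (index v))) (trans (cong (d x) (label-index v)) eq))
          in k , trans (cong label o≡) (label-index v)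
      }

  -- Labels 10, 12, 14 lie below 16 and labels 11, 13, 15 below 17, so z₁, z₄, z₆ receive the even
  -- ones and z₂, z₃, z₅ the odd ones.
  z-label : Fin 6 → Fin 18
  z-label = lookup (# 10 ∷ # 11 ∷ # 13 ∷ # 12 ∷ # 15 ∷ # 14 ∷ [])

  -- From admissible orderings to labellings, and the existence of all orderings

  module Orderings {Γ : Graph 18} (pappus : IsPappus Γ) (x : Fin 18) where
    open Graph Γ using (_∼_; d)

    metric : PappusMetric _∼_ d
    metric = pappusMetric pappus

    open PappusMetric metric using (∼-sym)

    frame : OrderingΓ₂ Γ x → Frame metric {x}
    frame (e , admissible) = record
      { p = λ i → proj₁ (pair i) ; y = elem e ; q = λ i → proj₁ (arc i)
      ; y-injective = Enumeration.injective e
      ; xp = λ i → proj₁ (proj₂ (pair i)) ; xy = Enumeration.sound e ; xq = λ i → proj₁ (proj₂ (arc i))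
      ; p∼y = λ { i 0F → ∼-sym (proj₁ (proj₂ (proj₂ (pair i)))) ; i 1F → ∼-sym (proj₂ (proj₂ (proj₂ (pair i)))) }
      ; q∼y = λ { i 0F → ∼-sym (proj₁ (proj₂ (proj₂ (arc i)))) ; i 1F → ∼-sym (proj₂ (proj₂ (proj₂ (arc i)))) }
      }
      where
      open AdmissibleΓ₂ admissible
      pair : ∀ i → CommonNeighborIn Γ x 1 (elem e (pairs i 0F)) (elem e (pairs i 1F))
      pair 0F = pair₁₂
      pair 1F = pair₃₄
      pair 2F = pair₅₆
      arc : ∀ i → CommonNeighborIn Γ x 3 (elem e (arcs i 0F)) (elem e (arcs i 1F))
      arc 0F = cycle₁₃
      arc 1F = cycle₃₅
      arc 2F = cycle₅₂
      arc 3F = cycle₂₄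
      arc 4F = cycle₄₆
      arc 5F = cycle₆₁

    abstract
      labellingOf : OrderingΓ₂ Γ x → Labelling _∼_ d x
      labellingOf Γ₂ = FromFrame.labelling metric (frame Γ₂)

      label-y : ∀ Γ₂ k → Labelling.label (labellingOf Γ₂) (y-label k) ≡ elem (proj₁ Γ₂) k
      label-y Γ₂ 0F = refl
      label-y Γ₂ 1F = refl
      label-y Γ₂ 2F = refl
      label-y Γ₂ 3F = refl
      label-y Γ₂ 4F = refl
      label-y Γ₂ 5F = refl

    abstract
     orderingΓ₁ : OrderingΓ₁ Γ x
     orderingΓ₁ = Enumeration-⇔ proj₂ (λ eq → PappusMetric.d≡1⇒∼ metric eq , eq) (Γ₁ metric x)

     orderingΓ₂ : OrderingΓ₂ Γ x
     orderingΓ₂ = record { elem = y ; injective = y-injective ; sound = xy ; complete = Ordered.complete ordered }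
                , record { pair₁₂ = pair 0F ; pair₃₄ = pair 1F ; pair₅₆ = pair 2F
                         ; cycle₁₃ = arc 0F ; cycle₃₅ = arc 1F ; cycle₅₂ = arc 2F
                         ; cycle₂₄ = arc 3F ; cycle₄₆ = arc 4F ; cycle₆₁ = arc 5F }
       where
       ordered : Ordered metric x
       ordered = Children.ordered metric x
       open Frame (Ordered.frame ordered)
       pair : ∀ i → CommonNeighborIn Γ x 1 (y (pairs i 0F)) (y (pairs i 1F))
       pair i = p i , xp i , ∼-sym (p∼y i 0F) , ∼-sym (p∼y i 1F)
       arc : ∀ i → CommonNeighborIn Γ x 3 (y (arcs i 0F)) (y (arcs i 1F))
       arc i = q i , xq i , ∼-sym (q∼y i 0F) , ∼-sym (q∼y i 1F)

    labelling⇒Γ₃ : Labelling _∼_ d x → OrderingΓ₃ Γ x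
    labelling⇒Γ₃ labelling = sphere z-label (λ {i} {j} → z-injective i j) z-level z-complete
               , record { Γ₄ = sphere (16 Fin.↑ʳ_) (λ {i} {j} → Fin.↑ʳ-injective 16 i j) u-level u-complete
                        ; neighbors₁₄₆ = λ v → mk⇔ (conclude ∘ edge-complete ∘ ∼-sym)
                            λ { (inj₁ refl) → edge (# 10) 2F ; (inj₂ (inj₁ refl)) → edge (# 12) 2F
                              ; (inj₂ (inj₂ refl)) → edge (# 14) 2F }
                        ; neighbors₂₃₅ = λ v → mk⇔ (conclude₂ ∘ edge-complete ∘ ∼-sym)
                            λ { (inj₁ refl) → edge (# 11) 2F ; (inj₂ (inj₁ refl)) → edge (# 13) 2F
                              ; (inj₂ (inj₂ refl)) → edge (# 15) 2F } }
      where
      open Labelled metric labelling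
      z-injective : ∀ i j → z-label i ≡ z-label j → i ≡ j
      z-injective = from-yes (Fin.all? λ i → Fin.all? λ j → (z-label i Fin.≟ z-label j) →-dec (i Fin.≟ j))
      z-level : ∀ k → level (z-label k) ≡ 3
      z-level = from-yes (Fin.all? λ k → level (z-label k) ℕ.≟ 3)
      z-complete : ∀ i → level i ≡ 3 → ∃[ k ] z-label k ≡ i
      z-complete = from-yes (Fin.all? λ i → (level i ℕ.≟ 3) →-dec Fin.any? λ k → z-label k Fin.≟ i)
      u-level : ∀ k → level (16 Fin.↑ʳ k) ≡ 4
      u-level = from-yes (Fin.all? {2} λ k → level (16 Fin.↑ʳ k) ℕ.≟ 4)
      u-complete : ∀ i → level i ≡ 4 → ∃[ k ] 16 Fin.↑ʳ k ≡ i
      u-complete = from-yes (Fin.all? λ i → (level i ℕ.≟ 4) →-dec Fin.any? λ k → (16 Fin.↑ʳ k) Fin.≟ i)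
      conclude : ∀ {v} → ∃[ k ] label (neighbor (# 16) k) ≡ v → v ≡ label (# 10) ⊎ v ≡ label (# 12) ⊎ v ≡ label (# 14)
      conclude (0F , eq) = inj₁ (sym eq)
      conclude (1F , eq) = inj₂ (inj₁ (sym eq))
      conclude (2F , eq) = inj₂ (inj₂ (sym eq))
      conclude₂ : ∀ {v} → ∃[ k ] label (neighbor (# 17) k) ≡ v → v ≡ label (# 11) ⊎ v ≡ label (# 13) ⊎ v ≡ label (# 15)
      conclude₂ (0F , eq) = inj₁ (sym eq)
      conclude₂ (1F , eq) = inj₂ (inj₁ (sym eq))
      conclude₂ (2F , eq) = inj₂ (inj₂ (sym eq))

    abstract
      orderingΓ₃ : OrderingΓ₃ Γ x
      orderingΓ₃ = labelling⇒Γ₃ (labellingOf orderingΓ₂)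

open PappusLabelling

-- Integer coordinates with respect to a labelling

open RawMonoidDefinitions ℤ.+-0-rawMonoid public using () renaming (sum to sumℤ)

kindIndex : Kind → Fin 5
kindIndex I   = 0F
kindIndex II  = 1F
kindIndex III = 2F
kindIndex IV  = 3F
kindIndex V   = 4F

kindAt : Fin 5 → Kind
kindAt = lookup (I ∷ II ∷ III ∷ IV ∷ V ∷ [])

kindAt-kindIndex : ∀ τ → kindAt (kindIndex τ) ≡ τ
kindAt-kindIndex I   = ≡.refl
kindAt-kindIndex II  = ≡.refl
kindAt-kindIndex III = ≡.refl
kindAt-kindIndex IV  = ≡.refl
kindAt-kindIndex V   = ≡.refl

_≟ₖ_ : (τ υ : Kind) → Dec (τ ≡ υ)
τ ≟ₖ υ = map′ (λ eq → ≡.trans (≡.sym (kindAt-kindIndex τ)) (≡.trans (≡.cong kindAt eq) (kindAt-kindIndex υ)))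
              (≡.cong kindIndex) (kindIndex τ Fin.≟ kindIndex υ)

-- These numbers and `actionOf` repeat entries of `typeData`, which depends on the reals and the
-- graph; the integer tables below must be closed.
diameterOf endpointOf multiplicityOf : Kind → ℕ
diameterOf I   = 4
diameterOf II  = 2
diameterOf III = 0
diameterOf IV  = 1
diameterOf V   = 1
endpointOf I   = 0
endpointOf II  = 1
endpointOf III = 2
endpointOf IV  = 2
endpointOf V   = 3
multiplicityOf I   = 1
multiplicityOf II  = 2
multiplicityOf III = 1
multiplicityOf IV  = 2
multiplicityOf V   = 1

dim : Kind → ℕ
dim τ = suc (diameterOf τ)

actionOf : ∀ τ → Vec (Vec ℤ (dim τ)) (dim τ)
actionOf I   = (+ 0 ∷ + 3 ∷ + 0 ∷ + 0 ∷ + 0 ∷ [])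
             ∷ (+ 1 ∷ + 0 ∷ + 2 ∷ + 0 ∷ + 0 ∷ [])
             ∷ (+ 0 ∷ + 1 ∷ + 0 ∷ + 2 ∷ + 0 ∷ [])
             ∷ (+ 0 ∷ + 0 ∷ + 2 ∷ + 0 ∷ + 1 ∷ [])
             ∷ (+ 0 ∷ + 0 ∷ + 0 ∷ + 3 ∷ + 0 ∷ [])
             ∷ []
actionOf II  = (+ 0 ∷ + 2 ∷ + 0 ∷ [])
             ∷ (+ 1 ∷ + 0 ∷ + 1 ∷ [])
             ∷ (+ 0 ∷ + 1 ∷ + 0 ∷ [])
             ∷ []
actionOf III = (+ 0 ∷ []) ∷ []
actionOf IV  = (+ 0 ∷ + 3 ∷ [])
             ∷ (+ 1 ∷ + 0 ∷ [])
             ∷ []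
actionOf V   = (+ 0 ∷ + 3 ∷ [])
             ∷ (+ 1 ∷ + 0 ∷ [])
             ∷ []

-- The given orderings enter the seeds through a permutation of Γ₁(x), as the
-- vertex labelled suc i is the one in position permutation i, and through the
-- sign by which the given pair of vertices of Γ₄(x) differs from labels 16, 17.
permutation : Fin 6 → Fin 3 → Fin 3
permutation π = lookup (lookup
  ( (0F ∷ 1F ∷ 2F ∷ []) ∷ (0F ∷ 2F ∷ 1F ∷ []) ∷ (1F ∷ 0F ∷ 2F ∷ [])
  ∷ (1F ∷ 2F ∷ 0F ∷ []) ∷ (2F ∷ 0F ∷ 1F ∷ []) ∷ (2F ∷ 1F ∷ 0F ∷ []) ∷ []) π)

sign : Fin 2 → ℤ
sign 0F = + 1
sign 1F = -[1+ 0 ]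

pattern -1ℤ = -[1+ 0 ]
pattern -2ℤ = -[1+ 1 ]
pattern -3ℤ = -[1+ 2 ]

padLeft : ∀ {m} k → Vec ℤ m → Vec ℤ (k ℕ.+ m)
padLeft k v = Vec.replicate k 0ℤ Vec.++ v

-- A function a, b, c on the parents, its pullback to their children, and on each link the sum over
-- the two ends of its side of the hexagon. For a + b + c = 0 the first two are ν and Aν, and the
-- third is the level 3 part of A²ν.
blockII : ℤ → ℤ → ℤ → Fin 3 → Vec ℤ 18
blockII a b c 0F = + 0 ∷ a ∷ b ∷ c ∷ Vec.replicate 14 0ℤ
blockII a b c 1F = padLeft 4 (a ∷ a ∷ b ∷ b ∷ c ∷ c ∷ Vec.replicate 8 0ℤ)
blockII a b c 2F = padLeft 10
  (a ℤ.+ b ∷ b ℤ.+ c ∷ c ℤ.+ a ∷ a ℤ.+ b ∷ b ℤ.+ c ∷ c ℤ.+ a ∷ + 0 ∷ + 0 ∷ [])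

permuted : Fin 6 → Vec ℤ 3 → Fin 3 → ℤ
permuted π a i = lookup a (permutation π i)

block : Fin 6 → Fin 2 → (s : Fin 7) → Fin (dim (kind s)) → Vec ℤ 18
block π ε 0F 0F = + 1 ∷ Vec.replicate 17 0ℤ
block π ε 0F 1F = padLeft 1 (Vec.replicate 3 (+ 1) Vec.++ Vec.replicate 14 0ℤ)
block π ε 0F 2F = padLeft 4 (Vec.replicate 6 (+ 1) Vec.++ Vec.replicate 8 0ℤ)
block π ε 0F 3F = padLeft 10 (Vec.replicate 6 (+ 1) Vec.++ Vec.replicate 2 0ℤ)
block π ε 0F 4F = padLeft 16 (Vec.replicate 2 (+ 1))
block π ε 1F j  = blockII (a 0F) (a 1F) (a 2F) j
  where a = permuted π (+ 1 ∷ -1ℤ ∷ + 0 ∷ [])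
block π ε 2F j  = blockII (a 0F) (a 1F) (a 2F) j
  where a = permuted π (+ 1 ∷ + 1 ∷ -2ℤ ∷ [])
block π ε 3F 0F = padLeft 4 (-1ℤ ∷ + 1 ∷ + 1 ∷ -1ℤ ∷ -1ℤ ∷ + 1 ∷ Vec.replicate 8 0ℤ)
block π ε 4F 0F = padLeft 4 (+ 1 ∷ -1ℤ ∷ + 0 ∷ + 0 ∷ -1ℤ ∷ + 1 ∷ Vec.replicate 8 0ℤ)
block π ε 4F 1F = padLeft 10 (+ 1 ∷ -1ℤ ∷ -2ℤ ∷ -1ℤ ∷ + 1 ∷ + 2 ∷ + 0 ∷ + 0 ∷ [])
block π ε 5F 0F = padLeft 4 (+ 1 ∷ -1ℤ ∷ + 2 ∷ -2ℤ ∷ + 1 ∷ -1ℤ ∷ Vec.replicate 8 0ℤ)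
block π ε 5F 1F = padLeft 10 (+ 3 ∷ + 3 ∷ + 0 ∷ -3ℤ ∷ -3ℤ ∷ + 0 ∷ + 0 ∷ + 0 ∷ [])
block π ε 6F 0F = padLeft 10 (Vec.map (sign ε ℤ.*_)
  (+ 1 ∷ -1ℤ ∷ + 1 ∷ -1ℤ ∷ + 1 ∷ -1ℤ ∷ + 0 ∷ + 0 ∷ []))
block π ε 6F 1F = padLeft 16 (Vec.map (sign ε ℤ.*_) (+ 3 ∷ -3ℤ ∷ []))

-- 36 / ‖block s j‖²
weight : (s : Fin 7) → Fin (dim (kind s)) → ℤ
weight 0F = lookup (+ 36 ∷ + 12 ∷ + 6 ∷ + 6 ∷ + 18 ∷ [])
weight 1F = lookup (+ 18 ∷ + 9 ∷ + 9 ∷ [])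
weight 2F = lookup (+ 6 ∷ + 3 ∷ + 3 ∷ [])
weight 3F = lookup (+ 6 ∷ [])
weight 4F = lookup (+ 9 ∷ + 3 ∷ [])
weight 5F = lookup (+ 3 ∷ + 1 ∷ [])
weight 6F = lookup (+ 6 ∷ + 2 ∷ [])

dot : Vec ℤ 18 → Vec ℤ 18 → ℤ
dot u v = sumℤ λ i → lookup u i ℤ.* lookup v i

abstract
  -- The number 36 is the least common multiple of the squared norms of all basis vectors, so the
  -- weights stay integral.
  block-gram : ∀ π ε s j k → weight s j ℤ.* dot (block π ε s j) (block π ε s k)
                           ≡ (if does (j Fin.≟ k) then + 36 else + 0)
  block-gram = from-yes (Fin.all? λ π → Fin.all? λ ε → Fin.all? λ s → Fin.all? λ j → Fin.all? λ k →
    weight s j ℤ.* dot (block π ε s j) (block π ε s k) ℤ.≟ (if does (j Fin.≟ k) then + 36 else + 0))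

  block-orthogonal : ∀ π ε s t → s ≢ t → ∀ j k → dot (block π ε s j) (block π ε t k) ≡ + 0
  block-orthogonal = from-yes (Fin.all? λ π → Fin.all? λ ε → Fin.all? λ s → Fin.all? λ t →
    ¬? (s Fin.≟ t) →-dec Fin.all? λ j → Fin.all? λ k → dot (block π ε s j) (block π ε t k) ℤ.≟ + 0)

  block-level : ∀ π ε s j y → level y ≢ endpointOf (kind s) ℕ.+ toℕ j → lookup (block π ε s j) y ≡ + 0
  block-level = from-yes (Fin.all? λ π → Fin.all? λ ε → Fin.all? λ s → Fin.all? λ j → Fin.all? λ y →
    ¬? (level y ℕ.≟ endpointOf (kind s) ℕ.+ toℕ j) →-dec (lookup (block π ε s j) y ℤ.≟ + 0))

  -- The completeness relation of an orthogonal basis. It shows that the vectors span V and gives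
  -- the components of any vector explicitly, without a count of dimensions.
  block-complete : ∀ π ε y z →
    (sumℤ λ s → sumℤ λ j → weight s j ℤ.* (lookup (block π ε s j) y ℤ.* lookup (block π ε s j) z))
    ≡ (if does (y Fin.≟ z) then + 36 else + 0)
  block-complete = from-yes (Fin.all? λ π → Fin.all? λ ε → Fin.all? λ y → Fin.all? λ z →
    (sumℤ λ s → sumℤ λ j → weight s j ℤ.* (lookup (block π ε s j) y ℤ.* lookup (block π ε s j) z))
    ℤ.≟ (if does (y Fin.≟ z) then + 36 else + 0))

  block-action : ∀ π ε s j y → (sumℤ λ k → lookup (block π ε s j) (neighbor y k))
    ≡ (sumℤ λ i → lookup (lookup (actionOf (kind s)) i) j ℤ.* lookup (block π ε s i) y)
  block-action = from-yes (Fin.all? λ π → Fin.all? λ ε → Fin.all? λ s → Fin.all? λ j → Fin.all? λ y →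
    (sumℤ λ k → lookup (block π ε s j) (neighbor y k))
    ℤ.≟ (sumℤ λ i → lookup (lookup (actionOf (kind s)) i) j ℤ.* lookup (block π ε s i) y))

-- Heyting commutative rings

module HeytingLemmas (H : HeytingCommutativeRing 0ℓ 0ℓ 0ℓ) where
  open HeytingCommutativeRing H hiding (zero)
  open HeytingProperties H public using (#-congʳ; 1#0; x-0≈x; invertibleˡ⇒#; x#0y#0→xy#0)
  open RingProperties (CommutativeRing.ring commutativeRing) using (-0#≈0#)
  open SemiringSum (CommutativeRing.semiring commutativeRing) using (sum)
  open SetoidReasoning setoid


  abstract
    inverse : ∀ {x} → x # 0# → ∃[ y ] y * x ≈ 1#
    inverse {x} x#0 with #⇒invertible x#0
    ... | y , yx≈1 , _ = y , trans (*-congˡ (sym (x-0≈x x))) yx≈1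

    unit⇒#0 : ∀ {x y} → y * x ≈ 1# → x # 0#
    unit⇒#0 {x} {y} yx≈1 = invertibleˡ⇒# (y , trans (*-congˡ (x-0≈x x)) yx≈1)

    #⇒-#0 : ∀ {x y} → x # y → x - y # 0#
    #⇒-#0 x#y with #⇒invertible x#y
    ... | z , zxy≈1 , _ = unit⇒#0 zxy≈1

    -#0⇒# : ∀ {x y} → x - y # 0# → x # y
    -#0⇒# x-y#0 = invertibleˡ⇒# (inverse x-y#0)

    -- If `z` inverts `x * y`, then `z * x` inverts `y`.
    *#0⇒#0ʳ : ∀ {x y} → x * y # 0# → y # 0#
    *#0⇒#0ʳ {x} {y} xy#0 with inverse xy#0
    ... | z , zxy≈1 = unit⇒#0 (trans (*-assoc z x y) zxy≈1)

    *#0⇒#0ˡ : ∀ {x y} → x * y # 0# → x # 0#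
    *#0⇒#0ˡ xy#0 = *#0⇒#0ʳ (#-congʳ (*-comm _ _) xy#0)

    -- By cotransitivity `y` is apart from 0 or from `x + y`; in the latter case subtracting `y`
    -- leaves `x` apart from 0.
    +#0⇒#0 : ∀ {x y} → x + y # 0# → x # 0# ⊎ y # 0#
    +#0⇒#0 {x} {y} x+y#0 = Sum.map (λ x+y#y → #-congʳ x+y-y≈x (#⇒-#0 x+y#y)) id (#-cotrans x+y#0 y)
      where
      x+y-y≈x : (x + y) - y ≈ x
      x+y-y≈x = trans (+-assoc x y (- y)) (trans (+-congˡ (-‿inverseʳ y)) (+-identityʳ x))

    sum#0⇒#0 : ∀ {n} (f : Fin n → Carrier) → sum f # 0# → ∃[ i ] f i # 0#
    sum#0⇒#0 {zero}  f 0#0 = contradiction 0#0 (#-irrefl refl)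
    sum#0⇒#0 {suc n} f s#0 with +#0⇒#0 s#0
    ... | inj₁ f₀#0 = zero , f₀#0
    ... | inj₂ s′#0 with sum#0⇒#0 (f ∘ suc) s′#0
    ...   | i , fᵢ#0 = suc i , fᵢ#0

    cancel : ∀ {x y} → x # 0# → x * y ≈ 0# → y ≈ 0#
    cancel {x} {y} x#0 xy≈0 with inverse x#0
    ... | z , zx≈1 = begin
      y  ≈⟨ *-identityˡ y ⟨
      1# * y  ≈⟨ *-congʳ zx≈1 ⟨
      z * x * y  ≈⟨ *-assoc z x y ⟩
      z * (x * y) ≈⟨ *-congˡ xy≈0 ⟩
      z * 0#  ≈⟨ zeroʳ z ⟩
      0#  ∎

-- Integers in a commutative ring

module IntegerMultiples (R : CommutativeRing 0ℓ 0ℓ) where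
  open CommutativeRing R hiding (zero)
  open RingProperties ring using (-0#≈0#; -‿distribˡ-*; -‿distribʳ-*; -‿involutive; -‿+-comm)
  open CommutativeSemigroupProperties +-commutativeSemigroup using (interchange)
  open SemiringMult semiring using (×-homo-+; ×1-homo-*) renaming (_×_ to _·_)
  open SetoidReasoning setoid

  -- The same formula as for the reals, over an arbitrary commutative ring: it serves as the
  -- coefficient map of a ring solver both over the reals and over ℂ.
  fromℤ : ℤ → Carrier
  fromℤ (+ k)    = k · 1#
  fromℤ -[1+ k ] = - (suc k · 1#)

  fromℤ-⊖ : ∀ m n → fromℤ (m ℤ.⊖ n) ≈ m · 1# - n · 1#
  fromℤ-⊖ m       zero    = sym (trans (+-congˡ -0#≈0#) (+-identityʳ _))
  fromℤ-⊖ zero    (suc n) = sym (+-identityˡ _)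
  fromℤ-⊖ (suc m) (suc n) = begin
    fromℤ (suc m ℤ.⊖ suc n)  ≡⟨ ≡.cong fromℤ (ℤ.[1+m]⊖[1+n]≡m⊖n m n) ⟩
    fromℤ (m ℤ.⊖ n)  ≈⟨ fromℤ-⊖ m n ⟩
    m · 1# - n · 1#  ≈⟨ shift (m · 1#) (n · 1#) 1# ⟩
    (1# + m · 1#) - (1# + n · 1#)  ∎
    where
    shift : ∀ a b c → a - b ≈ (c + a) - (c + b)
    shift a b c = begin
      a - b  ≈⟨ +-identityˡ (a - b) ⟨
      0# + (a - b)  ≈⟨ +-congʳ (-‿inverseʳ c) ⟨
      (c - c) + (a - b)  ≈⟨ interchange c (- c) a (- b) ⟩
      (c + a) + (- c - b)  ≈⟨ +-congˡ (-‿+-comm c b) ⟩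
      (c + a) - (c + b)  ∎

  fromℤ-+ : ∀ i j → fromℤ (i ℤ.+ j) ≈ fromℤ i + fromℤ j
  fromℤ-+ (+ m)    (+ n)    = ×-homo-+ 1# m n
  fromℤ-+ (+ m)    -[1+ n ] = fromℤ-⊖ m (suc n)
  fromℤ-+ -[1+ m ] (+ n)    = trans (fromℤ-⊖ n (suc m)) (+-comm _ _)
  fromℤ-+ -[1+ m ] -[1+ n ] = begin
    - (suc (suc (m ℕ.+ n)) · 1#)  ≡⟨ ≡.cong (λ k → - (k · 1#)) (ℕ.+-suc (suc m) n) ⟨
    - ((suc m ℕ.+ suc n) · 1#)  ≈⟨ -‿cong (×-homo-+ 1# (suc m) (suc n)) ⟩
    - (suc m · 1# + suc n · 1#)  ≈⟨ -‿+-comm (suc m · 1#) (suc n · 1#) ⟨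
    - (suc m · 1#) + - (suc n · 1#)  ∎

  fromℤ-neg : ∀ i → fromℤ (ℤ.- i) ≈ - fromℤ i
  fromℤ-neg (+ zero)  = sym -0#≈0#
  fromℤ-neg (+ suc k) = refl
  fromℤ-neg -[1+ k ]  = sym (-‿involutive _)

  fromℤ-pos* : ∀ m j → fromℤ (+ m ℤ.* j) ≈ fromℤ (+ m) * fromℤ j
  fromℤ-pos* m (+ n)    = trans (reflexive (≡.cong fromℤ (≡.sym (ℤ.pos-* m n)))) (×1-homo-* m n)
  fromℤ-pos* m -[1+ n ] = begin
    fromℤ (+ m ℤ.* -[1+ n ])  ≡⟨ ≡.cong fromℤ (ℤ.neg-distribʳ-* (+ m) (+ suc n)) ⟨
    fromℤ (ℤ.- (+ m ℤ.* + suc n))  ≈⟨ fromℤ-neg (+ m ℤ.* + suc n) ⟩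
    - fromℤ (+ m ℤ.* + suc n)  ≈⟨ -‿cong (fromℤ-pos* m (+ suc n)) ⟩
    - (m · 1# * (suc n · 1#))  ≈⟨ -‿distribʳ-* _ _ ⟩
    m · 1# * - (suc n · 1#)  ∎

  fromℤ-* : ∀ i j → fromℤ (i ℤ.* j) ≈ fromℤ i * fromℤ j
  fromℤ-* (+ m)    j = fromℤ-pos* m j
  fromℤ-* -[1+ m ] j = begin
    fromℤ (-[1+ m ] ℤ.* j)  ≡⟨ ≡.cong fromℤ (ℤ.neg-distribˡ-* (+ suc m) j) ⟨
    fromℤ (ℤ.- (+ suc m ℤ.* j))  ≈⟨ fromℤ-neg (+ suc m ℤ.* j) ⟩
    - fromℤ (+ suc m ℤ.* j)  ≈⟨ -‿cong (fromℤ-pos* (suc m) j) ⟩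
    - (suc m · 1# * fromℤ j)  ≈⟨ -‿distribˡ-* _ _ ⟩
    - (suc m · 1#) * fromℤ j  ∎

  private
    ℤ→R : ℤ.+-*-rawRing -Raw-AlmostCommutative⟶ fromCommutativeRing R
    ℤ→R = record
      { ⟦_⟧ = fromℤ ; +-homo = fromℤ-+ ; *-homo = fromℤ-* ; -‿homo = fromℤ-neg
      ; 0-homo = refl ; 1-homo = +-identityʳ 1# }

    _coefficient≟_ : (i j : ℤ) → Maybe (fromℤ i ≈ fromℤ j)
    i coefficient≟ j = Maybe.map (λ eq → reflexive (≡.cong fromℤ eq)) (dec⇒maybe (i ℤ.≟ j))

  open RingSolver ℤ.+-*-rawRing (fromCommutativeRing R) ℤ→R _coefficient≟_ public
    using (solve; con; _:=_; _:+_; _:*_; :-_; _:-_)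

-- The complex numbers as a Heyting commutative ring

module ComplexField (ℝ : Reals) where
  private module R = Reals ℝ
  open Complex ℝ
  open HeytingField R.heytingField using (*-comm; *-cong; +-cong; -‿cong)
  private
    module RH = HeytingField R.heytingField hiding (_≈_)
    module RL = HeytingLemmas RH.heytingCommutativeRing
    module RI = IntegerMultiples R.commutativeRing
    module < = IsStrictPartialOrder R.isStrictPartialOrder
  open RI using (solve; con; _:=_; _:+_; _:*_; :-_; _:-_)

  -ℂ_ : ℂ → ℂ
  -ℂ u = (R.- re u) +i (R.- im u)

  commutativeRing : CommutativeRing 0ℓ 0ℓ
  commutativeRing = record
    { Carrier = ℂ ; _≈_ = _≈_ ; _+_ = _+_ ; _*_ = _*_ ; -_ = -ℂ_ ; 0# = 0ℂ ; 1# = 1ℂ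
    ; isCommutativeRing = record
      { isRing = record
        { +-isAbelianGroup = record
          { isGroup = record
            { isMonoid = record
              { isSemigroup = record
                { isMagma = record
                  { isEquivalence = Setoid.isEquivalence setoid
                  ; ∙-cong = λ (p , q) (p′ , q′) → +-cong p p′ , +-cong q q′
                  }
                ; assoc = λ u v w → RH.+-assoc _ _ _ , RH.+-assoc _ _ _
                }
              ; identity = (λ u → RH.+-identityˡ _ , RH.+-identityˡ _)
                         , (λ u → RH.+-identityʳ _ , RH.+-identityʳ _)
              }
            ; inverse = (λ u → RH.-‿inverseˡ _ , RH.-‿inverseˡ _)
                      , (λ u → RH.-‿inverseʳ _ , RH.-‿inverseʳ _)
            ; ⁻¹-cong = λ (p , q) → -‿cong p , -‿cong q
            }
          ; comm = λ u v → RH.+-comm _ _ , RH.+-comm _ _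
          }
        ; *-cong = λ (p , q) (p′ , q′) →
            +-cong (*-cong p p′) (-‿cong (*-cong q q′)) , +-cong (*-cong p q′) (*-cong q p′)
        ; *-assoc = λ u v w → assoc-re (re u) (im u) (re v) (im v) (re w) (im w)
                            , assoc-im (re u) (im u) (re v) (im v) (re w) (im w)
        ; *-identity = identityˡ , λ u → Setoid.trans setoid {u * 1ℂ} (comm u 1ℂ) (identityˡ u)
        ; distrib = distribˡ
                  , λ u v w → Setoid.trans setoid {(v + w) * u} (comm (v + w) u)
                      (Setoid.trans setoid {u * (v + w)} (distribˡ u v w)
                        (+-cong (proj₁ (comm u v)) (proj₁ (comm u w))
                        , +-cong (proj₂ (comm u v)) (proj₂ (comm u w))))
        }
      ; *-comm = comm
      }
    }
    where
    assoc-re : ∀ a b c d e f → (a R.* c R.- b R.* d) R.* e R.- (a R.* d R.+ b R.* c) R.* f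
                         R.≈ a R.* (c R.* e R.- d R.* f) R.- b R.* (c R.* f R.+ d R.* e)
    assoc-re = solve 6 (λ a b c d e f → (a :* c :- b :* d) :* e :- (a :* d :+ b :* c) :* f
                                     := a :* (c :* e :- d :* f) :- b :* (c :* f :+ d :* e)) RH.refl
    assoc-im : ∀ a b c d e f → (a R.* c R.- b R.* d) R.* f R.+ (a R.* d R.+ b R.* c) R.* e
                         R.≈ a R.* (c R.* f R.+ d R.* e) R.+ b R.* (c R.* e R.- d R.* f)
    assoc-im = solve 6 (λ a b c d e f → (a :* c :- b :* d) :* f :+ (a :* d :+ b :* c) :* e
                                     := a :* (c :* f :+ d :* e) :+ b :* (c :* e :- d :* f)) RH.refl
    identityˡ : ∀ u → 1ℂ * u ≈ u
    identityˡ u = RH.trans (+-cong (RH.*-identityˡ (re u)) (RH.trans (-‿cong (RH.zeroˡ (im u))) -0#≈0#))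
                           (RH.+-identityʳ (re u))
                , RH.trans (+-cong (RH.*-identityˡ (im u)) (RH.zeroˡ (re u))) (RH.+-identityʳ (im u))
      where open RingProperties (CommutativeRing.ring R.commutativeRing) using (-0#≈0#)
    comm : ∀ u v → u * v ≈ v * u
    comm u v = +-cong (*-comm _ _) (-‿cong (*-comm _ _))
             , RH.trans (RH.+-comm _ _) (+-cong (*-comm _ _) (*-comm _ _))
    distribˡ : ∀ u v w → u * (v + w) ≈ u * v + u * w
    distribˡ u v w = solve 6 (λ a b c d e f → a :* (c :+ e) :- b :* (d :+ f)
                                           := (a :* c :- b :* d) :+ (a :* e :- b :* f)) RH.refl
                       (re u) (im u) (re v) (im v) (re w) (im w)
                   , solve 6 (λ a b c d e f → a :* (d :+ f) :+ b :* (c :+ e)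
                                           := (a :* d :+ b :* c) :+ (a :* f :+ b :* e)) RH.refl
                       (re u) (im u) (re v) (im v) (re w) (im w)

  square-positive : ∀ {a} → a R.# R.0# → R.0# R.< a R.* a
  square-positive {a} a#0 with Equivalence.to (R.#⇔<⊎> a R.0#) a#0
  ... | inj₂ 0<a = R.*-pos 0<a 0<a
  ... | inj₁ a<0 = <.<-respʳ-≈ (solve 1 (λ a → :- a :* :- a := a :* a) RH.refl a) (R.*-pos 0<-a 0<-a)
    where
    0<-a : R.0# R.< R.- a
    0<-a = <.<-respʳ-≈ (RH.+-identityʳ _) (<.<-respˡ-≈ (RH.-‿inverseˡ a) (R.+-mono-< (R.- a) a<0))

  +-positive : ∀ {a b} → R.0# R.< a → R.0# R.< b → R.0# R.< a R.+ b
  +-positive {a} 0<a 0<b = <.trans (<.<-respʳ-≈ (RH.sym (RH.+-identityʳ a)) 0<a) (R.+-mono-< a 0<b)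

  positive⇒#0 : ∀ {a} → R.0# R.< a → a R.# R.0#
  positive⇒#0 {a} 0<a = Equivalence.from (R.#⇔<⊎> a R.0#) (inj₂ 0<a)

  -- By cotransitivity a² + b² is apart from 0 or from a²; in the latter case b
  -- is apart from 0, and both squares are positive.
  sum-of-squares : ∀ {a b} → a R.# R.0# → a R.* a R.+ b R.* b R.# R.0#
  sum-of-squares {a} {b} a#0
    with RH.#-cotrans (positive⇒#0 (square-positive a#0)) (a R.* a R.+ b R.* b)
  ... | inj₂ sum#0 = sum#0
  ... | inj₁ a²#sum = positive⇒#0 (+-positive (square-positive a#0) (square-positive b#0))
    where
    b#0 : b R.# R.0#
    b#0 = RL.*#0⇒#0ʳ (RL.#-congʳ
      (solve 2 (λ a b → a :- (a :+ b :* b) := :- b :* b) RH.refl (a R.* a) b) (RL.#⇒-#0 a²#sum))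

  private module C = CommutativeRing commutativeRing

  -- The inverse is the conjugate divided by the squared modulus, which is apart from 0 by
  -- `sum-of-squares`.
  #⇒unit : ∀ {w} → (re w R.# R.0#) ⊎ (im w R.# R.0#) → ∃[ z ] (z * w ≈ 1ℂ)
  #⇒unit {w} w#0 =
    let m , mn≈1 = RL.inverse (norm#0 w#0) in
    (re w R.* m) +i (R.- (im w R.* m)) ,
    ( RH.trans (solve 3 (λ a b m → a :* m :* a :- (:- (b :* m)) :* b := m :* (a :* a :+ b :* b)) RH.refl
                        (re w) (im w) m) mn≈1
    , solve 3 (λ a b m → a :* m :* b :+ (:- (b :* m)) :* a := con (+ 0)) RH.refl (re w) (im w) m)
    where
    norm#0 : (re w R.# R.0#) ⊎ (im w R.# R.0#) → re w R.* re w R.+ im w R.* im w R.# R.0#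
    norm#0 (inj₁ a#0) = sum-of-squares a#0
    norm#0 (inj₂ b#0) = RL.#-congʳ (RH.+-comm _ _) (sum-of-squares b#0)

  -- The real part of the product is 1, so one of its two terms is apart from 0. One of these
  -- contains `re w`, the other `im w`.
  unit⇒# : ∀ {z w} → z * w ≈ 1ℂ → (re w R.# R.0#) ⊎ (im w R.# R.0#)
  unit⇒# (re≈1 , _) = Sum.map RL.*#0⇒#0ʳ
    (λ -bd#0 → RL.*#0⇒#0ʳ (RL.*#0⇒#0ʳ (RL.#-congʳ (solve 1 (λ a → :- a := con -[1+ 0 ] :* a) RH.refl _) -bd#0)))
    (RL.+#0⇒#0 (RL.#-congʳ (RH.sym re≈1) RL.1#0))

  heytingCommutativeRing : HeytingCommutativeRing 0ℓ 0ℓ 0ℓ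
  heytingCommutativeRing = record
    { _#_ = _#_
    ; isHeytingCommutativeRing = record
      { isCommutativeRing = C.isCommutativeRing
      ; isApartnessRelation = record
        { irrefl  = λ (p , q) → [ RH.#-irrefl p , RH.#-irrefl q ]′
        ; sym     = Sum.map RH.#-sym RH.#-sym
        ; cotrans = λ { (inj₁ p) w → Sum.map inj₁ inj₁ (RH.#-cotrans p (re w))
                      ; (inj₂ q) w → Sum.map inj₂ inj₂ (RH.#-cotrans q (im w)) }
        }
      ; #⇒invertible = λ {u} {v} u#v →
          let z , zw≈1 = #⇒unit {u + -ℂ v} (Sum.map RL.#⇒-#0 RL.#⇒-#0 u#v)
          in z , zw≈1 , C.trans (C.*-comm (u + -ℂ v) z) zw≈1
      ; invertible⇒# = λ {u} {v} (z , zw≈1 , _) →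
          Sum.map RL.-#0⇒# RL.-#0⇒# (unit⇒# {z} {u + -ℂ v} zw≈1)
      }
    }

  real-cong : ∀ {a b} → a R.≈ b → real a ≈ real b
  real-cong a≈b = a≈b , RH.refl

  real-+ : ∀ a b → real (a R.+ b) ≈ real a + real b
  real-+ a b = RH.refl , RH.sym (RH.+-identityʳ R.0#)

  real-* : ∀ a b → real (a R.* b) ≈ real a * real b
  real-* a b = solve 2 (λ a b → a :* b := a :* b :- con (+ 0) :* con (+ 0)) RH.refl a b
             , solve 2 (λ a b → con (+ 0) := a :* con (+ 0) :+ con (+ 0) :* b) RH.refl a b

  fromℤ-real : ∀ i → R.fromℤ i ≡ RI.fromℤ i
  fromℤ-real (+ k)    = ≡.refl
  fromℤ-real -[1+ k ] = ≡.refl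

  fromℤ-+ : ∀ i j → fromℤ (i ℤ.+ j) ≈ fromℤ i + fromℤ j
  fromℤ-+ i j rewrite fromℤ-real i | fromℤ-real j | fromℤ-real (i ℤ.+ j) =
    C.trans (real-cong (RI.fromℤ-+ i j)) (real-+ _ _)

  fromℤ-* : ∀ i j → fromℤ (i ℤ.* j) ≈ fromℤ i * fromℤ j
  fromℤ-* i j rewrite fromℤ-real i | fromℤ-real j | fromℤ-real (i ℤ.* j) =
    C.trans (real-cong (RI.fromℤ-* i j)) (real-* _ _)

  fromℤ-neg : ∀ i → fromℤ (ℤ.- i) ≈ -ℂ fromℤ i
  fromℤ-neg i rewrite fromℤ-real i | fromℤ-real (ℤ.- i) =
    RI.fromℤ-neg i , solve 0 (con (+ 0) := :- con (+ 0)) RH.refl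

  0<1 : R.0# R.< R.1#
  0<1 = <.<-respʳ-≈ (RH.*-identityˡ R.1#) (square-positive RL.1#0)

  positive : ∀ k → R.0# R.< suc k R.·ℕ R.1#
  positive zero    = <.<-respʳ-≈ (RH.sym (RH.+-identityʳ R.1#)) 0<1
  positive (suc k) = +-positive 0<1 (positive k)

  fromℤ#0 : ∀ {i} → i ≢ + 0 → fromℤ i # 0ℂ
  fromℤ#0 {+ zero}   i≢0 = contradiction ≡.refl i≢0
  fromℤ#0 {+ suc k}  _   = inj₁ (positive⇒#0 (positive k))
  fromℤ#0 { -[1+ k ]} _  = inj₁ (RL.*#0⇒#0ʳ (RL.#-congʳ
    (solve 1 (λ a → a := con -[1+ 0 ] :* :- a) RH.refl _) (positive⇒#0 (positive k))))

  fromℤ-1 : fromℤ (+ 1) ≈ 1ℂ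
  fromℤ-1 = real-cong (RH.+-identityʳ R.1#)

  conj-cong : ∀ {u v} → u ≈ v → conj u ≈ conj v
  conj-cong (p , q) = p , -‿cong q

  conj-+ : ∀ u v → conj (u + v) ≈ conj u + conj v
  conj-+ u v = RH.refl , solve 2 (λ a b → :- (a :+ b) := :- a :+ :- b) RH.refl (im u) (im v)

  conj-* : ∀ u v → conj (u * v) ≈ conj u * conj v
  conj-* u v = solve 4 (λ a b c d → a :* c :- b :* d := a :* c :- (:- b) :* (:- d)) RH.refl
                 (re u) (im u) (re v) (im v)
             , solve 4 (λ a b c d → :- (a :* d :+ b :* c) := a :* (:- d) :+ (:- b) :* c) RH.refl
                 (re u) (im u) (re v) (im v)

  conj-fromℤ : ∀ i → conj (fromℤ i) ≈ fromℤ i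
  conj-fromℤ i = RH.refl , solve 0 (:- con (+ 0) := con (+ 0)) RH.refl

-- The pair (a , b) stands for a + b√3. Equality of pairs is decidable, so identities between
-- eigenvectors become finite checks.
ℤ[√3] : Set
ℤ[√3] = ℤ × ℤ

_+√_ _*√_ : ℤ[√3] → ℤ[√3] → ℤ[√3]
(a , b) +√ (c , d) = a ℤ.+ c , b ℤ.+ d
(a , b) *√ (c , d) = a ℤ.* c ℤ.+ + 3 ℤ.* (b ℤ.* d) , a ℤ.* d ℤ.+ b ℤ.* c

module Sqrt3 (ℝ : Reals) (√3 : Reals.Carrier ℝ) (√3² : Reals._≈_ ℝ (Reals._*_ ℝ √3 √3) (Reals.fromℤ ℝ (+ 3))) where
  open Complex ℝ
  open ComplexField ℝ
  open CommutativeRing commutativeRing using (*-congˡ; *-congʳ; +-cong; +-congˡ; +-congʳ; trans; sym; refl)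
  open HeytingLemmas heytingCommutativeRing using (*#0⇒#0ˡ; #-congʳ)
  open IntegerMultiples commutativeRing using (solve; con; _:=_; _:+_; _:*_; :-_; _:-_)
  open SetoidReasoning setoid

  s : ℂ
  s = real √3

  s² : s * s ≈ fromℤ (+ 3)
  s² = trans (sym (real-* √3 √3)) (real-cong √3²)

  eval : ℤ[√3] → ℂ
  eval (a , b) = fromℤ a + fromℤ b * s

  eval-+ : ∀ p q → eval (p +√ q) ≈ eval p + eval q
  eval-+ (a , b) (c , d) = trans (+-cong (fromℤ-+ a c) (*-congʳ {s} (fromℤ-+ b d)))
    (solve 5 (λ a b c d s → (a :+ c) :+ (b :+ d) :* s := (a :+ b :* s) :+ (c :+ d :* s)) refl
           (fromℤ a) (fromℤ b) (fromℤ c) (fromℤ d) s)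

  eval-* : ∀ p q → eval (p *√ q) ≈ eval p * eval q
  eval-* (a , b) (c , d) = begin
    fromℤ (a ℤ.* c ℤ.+ + 3 ℤ.* (b ℤ.* d)) + fromℤ (a ℤ.* d ℤ.+ b ℤ.* c) * s
      ≈⟨ +-cong (trans (fromℤ-+ (a ℤ.* c) _) (+-cong (fromℤ-* a c)
                  (trans (fromℤ-* (+ 3) (b ℤ.* d)) (*-congˡ {fromℤ (+ 3)} (fromℤ-* b d)))))
                (*-congʳ {s} (trans (fromℤ-+ (a ℤ.* d) _) (+-cong (fromℤ-* a d) (fromℤ-* b c)))) ⟩
    (a′ * c′ + fromℤ (+ 3) * (b′ * d′)) + (a′ * d′ + b′ * c′) * s
      ≈⟨ +-congʳ {(a′ * d′ + b′ * c′) * s} (+-congˡ {a′ * c′} (*-congʳ {b′ * d′} s²)) ⟨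
    (a′ * c′ + s * s * (b′ * d′)) + (a′ * d′ + b′ * c′) * s
      ≈⟨ solve 5 (λ a b c d s → (a :* c :+ s :* s :* (b :* d)) :+ (a :* d :+ b :* c) :* s
                             := (a :+ b :* s) :* (c :+ d :* s)) refl a′ b′ c′ d′ s ⟩
    (a′ + b′ * s) * (c′ + d′ * s) ∎
    where
    a′ b′ c′ d′ : ℂ
    a′ = fromℤ a
    b′ = fromℤ b
    c′ = fromℤ c
    d′ = fromℤ d

  eval-fromℤ : ∀ a → eval (a , + 0) ≈ fromℤ a
  eval-fromℤ a = solve 2 (λ a s → a :+ con (+ 0) :* s := a) refl (fromℤ a) s

  -- A factor of a nonzero integer is apart from 0. It is applied with `q` the conjugate of `p`,
  -- when `n` is the norm.
  eval#0 : ∀ p q {n} → p *√ q ≡ (n , + 0) → n ≢ + 0 → eval p # 0ℂ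
  eval#0 p q {n} pq≡n n≢0 = *#0⇒#0ˡ {eval p} {eval q} (#-congʳ {fromℤ n}
    (trans (sym (eval-fromℤ n)) (trans (CommutativeRing.reflexive commutativeRing (≡.cong eval (≡.sym pq≡n))) (eval-* p q)))
    (fromℤ#0 n≢0))

-- Linear algebra over the complex numbers

module Linear (ℝ : Reals) where
  open Complex ℝ public using (ℂ; _≈_; _#_; _+_; _*_; 0ℂ; 1ℂ; sum; conj; fromℤ; real)
  open LinearAlgebra ℝ public
  open ComplexField ℝ public using (commutativeRing; heytingCommutativeRing; fromℤ-+; fromℤ-*; fromℤ-neg; fromℤ#0; fromℤ-1; conj-cong; conj-+; conj-*; conj-fromℤ)
  open CommutativeRing commutativeRing public
    using (refl; sym; trans; reflexive; +-cong; +-congˡ; +-congʳ; *-cong; *-congˡ; *-congʳ; +-assoc; +-comm;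
           *-assoc; *-comm; *-identityˡ; *-identityʳ; zeroˡ; zeroʳ; +-identityˡ; +-identityʳ; distribˡ; distribʳ; setoid)
  open CommutativeSemigroupProperties (CommutativeRing.*-commutativeSemigroup commutativeRing) public
    using (x∙yz≈y∙xz; xy∙z≈xz∙y)
  open SemiringSum (CommutativeRing.semiring commutativeRing) public
    using (∑-distrib-+; ∑-comm; *-distribˡ-sum; *-distribʳ-sum)
  open HeytingLemmas heytingCommutativeRing public
  open HeytingCommutativeRing heytingCommutativeRing public using (#-irrefl; #-sym)
  open SetoidReasoning setoid

  sum-cong : ∀ {n} {f g : Fin n → ℂ} → (∀ i → f i ≈ g i) → sum f ≈ sum g
  sum-cong {zero}  p = refl
  sum-cong {suc n} p = +-cong (p zero) (sum-cong (p ∘ suc))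

  sum-zero : ∀ {n} {f : Fin n → ℂ} → (∀ i → f i ≈ 0ℂ) → sum f ≈ 0ℂ
  sum-zero {zero}  p = refl
  sum-zero {suc n} p = trans (+-cong (p zero) (sum-zero (p ∘ suc))) (+-identityˡ 0ℂ)

  sum-δ : ∀ {n} (i : Fin n) (f : Fin n → ℂ) → sum (λ j → 𝟏 (i , j) * f j) ≈ f i
  sum-δ zero    f = trans (+-cong (*-identityˡ (f zero)) (sum-zero (λ j → zeroˡ (f (suc j))))) (+-identityʳ (f zero))
  sum-δ (suc i) f = trans (+-cong (zeroˡ (f zero)) (sum-δ i (f ∘ suc))) (+-identityˡ (f (suc i)))

  𝟏-injective : ∀ {m n} {e : Fin m → Fin n} → (∀ {i j} → e i ≡ e j → i ≡ j) → ∀ i j → 𝟏 (e i , e j) ≡ 𝟏 (i , j)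
  𝟏-injective {e = e} inj i j with i Fin.≟ j
  ... | yes ≡.refl rewrite dec-true (e i Fin.≟ e i) ≡.refl = ≡.refl
  ... | no i≢j rewrite dec-false (e i Fin.≟ e j) (i≢j ∘ inj) = ≡.refl

  𝟏-refl : ∀ {n} (i : Fin n) → 𝟏 (i , i) ≡ 1ℂ
  𝟏-refl i rewrite dec-true (i Fin.≟ i) ≡.refl = ≡.refl

  𝟏-≢ : ∀ {n} {i j : Fin n} → i ≢ j → 𝟏 (i , j) ≡ 0ℂ
  𝟏-≢ {i = i} {j} i≢j rewrite dec-false (i Fin.≟ j) i≢j = ≡.refl

  𝟏-sym : ∀ {n} (i j : Fin n) → 𝟏 (i , j) ≡ 𝟏 (j , i)
  𝟏-sym i j with i Fin.≟ j
  ... | yes ≡.refl = ≡.sym (𝟏-refl i)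
  ... | no i≢j     = ≡.sym (𝟏-≢ (i≢j ∘ ≡.sym))

  -- Each term f(eₖ) is written as a sum against Kronecker deltas and the two sums are exchanged; an
  -- index satisfying `P` is then met exactly once.
  sum-Enumeration : ∀ {n m} {P : Fin n → Set} → U.Decidable P → (e : Enumeration P m) (f : Fin n → ℂ) →
                    (∀ j → ¬ P j → f j ≈ 0ℂ) → sum f ≈ sum (f ∘ elem e)
  sum-Enumeration {n} {m} {P} P? e f f≈0 = sym (begin
    sum (λ k → f (elem e k))  ≈⟨ sum-cong (λ k → sum-δ (elem e k) f) ⟨
    sum (λ k → sum λ j → 𝟏 (elem e k , j) * f j)  ≈⟨ ∑-comm (λ k j → 𝟏 (elem e k , j) * f j) ⟩
    sum (λ j → sum λ k → 𝟏 (elem e k , j) * f j)  ≈⟨ sum-cong (λ j → collapse j (P? j)) ⟩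
    sum f  ∎)
    where
    open Enumeration e using (injective; complete)
    collapse : ∀ j → Dec (P j) → sum (λ k → 𝟏 (elem e k , j) * f j) ≈ f j
    collapse j (no ¬Pj) =
      trans (sum-zero (λ k → trans (*-congˡ {𝟏 (elem e k , j)} (f≈0 j ¬Pj)) (zeroʳ (𝟏 (elem e k , j))))) (sym (f≈0 j ¬Pj))
    collapse j (yes Pj) with complete j Pj
    ... | k₀ , ≡.refl = trans
      (sum-cong (λ k → *-congʳ {f (elem e k₀)} (reflexive (≡.trans (𝟏-injective injective k k₀) (𝟏-sym k k₀)))))
      (sum-δ k₀ (λ _ → f (elem e k₀)))

  ≋-refl : {I : Set} {u : ℂ^ I} → u ≋ u
  ≋-refl i = refl

  ≋-sym : {I : Set} {u v : ℂ^ I} → u ≋ v → v ≋ u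
  ≋-sym p i = sym (p i)

  ≋-trans : {I : Set} {u v w : ℂ^ I} → u ≋ v → v ≋ w → u ≋ w
  ≋-trans p q i = trans (p i) (q i)

  ·-congʳ : ∀ {n} (B : Mat n) {u v} → u ≋ v → B · u ≋ B · v
  ·-congʳ B p i = sum-cong (λ j → *-congˡ {B (i , j)} (p j))

  ·-congˡ : ∀ {n} {B C : Mat n} v → B ≋ C → B · v ≋ C · v
  ·-congˡ v p i = sum-cong (λ j → *-congʳ {v j} (p (i , j)))

  lincomb-congˡ : ∀ {I : Set} {k} {c c′ : Fin k → ℂ} (v : Fin k → ℂ^ I) → c ≋ c′ → lincomb c v ≋ lincomb c′ v
  lincomb-congˡ v p i = sum-cong (λ j → *-congʳ {v j i} (p j))

  lincomb-congʳ : ∀ {I : Set} {k} (c : Fin k → ℂ) {v v′ : Fin k → ℂ^ I} → (∀ j → v j ≋ v′ j) →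
                  lincomb c v ≋ lincomb c v′
  lincomb-congʳ c p i = sum-cong (λ j → *-congˡ {c j} (p j i))

  lincomb-0 : ∀ {I : Set} {k} {c : Fin k → ℂ} (v : Fin k → ℂ^ I) → (∀ j → c j ≈ 0ℂ) → lincomb c v ≋ 𝟎
  lincomb-0 v p i = sum-zero (λ j → trans (*-congʳ {v j i} (p j)) (zeroˡ (v j i)))

  lincomb-⊕ : ∀ {I : Set} {k} (c c′ : Fin k → ℂ) (v : Fin k → ℂ^ I) →
              lincomb c v ⊕ lincomb c′ v ≋ lincomb (c ⊕ c′) v
  lincomb-⊕ c c′ v i = sym (trans (sum-cong (λ j → distribʳ (v j i) (c j) (c′ j)))
                                   (∑-distrib-+ (λ j → c j * v j i) (λ j → c′ j * v j i)))

  lincomb-⊛ : ∀ {I : Set} {k} a (c : Fin k → ℂ) (v : Fin k → ℂ^ I) → a ⊛ lincomb c v ≋ lincomb (a ⊛ c) v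
  lincomb-⊛ a c v i = trans (*-distribˡ-sum a (λ j → c j * v j i)) (sum-cong (λ j → sym (*-assoc a (c j) (v j i))))

  lincomb-unit : ∀ {I : Set} {k} (v : Fin k → ℂ^ I) j → lincomb (unit j) v ≋ v j
  lincomb-unit v j i = sum-δ j (λ l → v l i)

  lincomb-lincomb : ∀ {I : Set} {k} (M : Mat k) (c : Fin k → ℂ) (v : Fin k → ℂ^ I) →
                    lincomb c (λ j → lincomb (λ i → M (i , j)) v) ≋ lincomb (M · c) v
  lincomb-lincomb M c v y = begin
    sum (λ j → c j * sum (λ i → M (i , j) * v i y))  ≈⟨ sum-cong (λ j → *-distribˡ-sum (c j) (λ i → M (i , j) * v i y)) ⟩
    sum (λ j → sum λ i → c j * (M (i , j) * v i y))  ≈⟨ ∑-comm (λ j i → c j * (M (i , j) * v i y)) ⟩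
    sum (λ i → sum λ j → c j * (M (i , j) * v i y))  ≈⟨ sum-cong (λ i → sum-cong λ j → x∙yz≈y∙xz (c j) (M (i , j)) (v i y)) ⟩
    sum (λ i → sum λ j → M (i , j) * (c j * v i y))  ≈⟨ sum-cong (λ i → sum-cong λ j → *-assoc (M (i , j)) (c j) (v i y)) ⟨
    sum (λ i → sum λ j → M (i , j) * c j * v i y)  ≈⟨ sum-cong (λ i → *-distribʳ-sum (v i y) (λ j → M (i , j) * c j)) ⟨
    sum (λ i → sum (λ j → M (i , j) * c j) * v i y)  ∎

  ·-lincomb : ∀ {n k} (B : Mat n) (c : Fin k → ℂ) (v : Fin k → ℂ^ (Fin n)) →
              B · lincomb c v ≋ lincomb c (λ j → B · v j)
  ·-lincomb B c v i = begin
    sum (λ j → B (i , j) * sum (λ k → c k * v k j))  ≈⟨ sum-cong (λ j → *-distribˡ-sum (B (i , j)) (λ k → c k * v k j)) ⟩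
    sum (λ j → sum λ k → B (i , j) * (c k * v k j))  ≈⟨ ∑-comm (λ j k → B (i , j) * (c k * v k j)) ⟩
    sum (λ k → sum λ j → B (i , j) * (c k * v k j))  ≈⟨ sum-cong (λ k → sum-cong λ j → x∙yz≈y∙xz (B (i , j)) (c k) (v k j)) ⟩
    sum (λ k → sum λ j → c k * (B (i , j) * v k j))  ≈⟨ sum-cong (λ k → *-distribˡ-sum (c k) (λ j → B (i , j) * v k j)) ⟨
    sum (λ k → c k * sum (λ j → B (i , j) * v k j))  ∎

  ⊕-· : ∀ {n} (B C : Mat n) v → (B ⊕ C) · v ≋ B · v ⊕ C · v
  ⊕-· B C v i = trans (sum-cong (λ j → distribʳ (v j) (B (i , j)) (C (i , j))))
                      (∑-distrib-+ (λ j → B (i , j) * v j) (λ j → C (i , j) * v j))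

  ⊛-· : ∀ {n} a (B : Mat n) v → (a ⊛ B) · v ≋ a ⊛ (B · v)
  ⊛-· a B v i = trans (sum-cong (λ j → *-assoc a (B (i , j)) (v j))) (sym (*-distribˡ-sum a (λ j → B (i , j) * v j)))

  ·-⊛ : ∀ {n} (B : Mat n) a v → B · (a ⊛ v) ≋ a ⊛ (B · v)
  ·-⊛ B a v i = trans (sum-cong (λ j → x∙yz≈y∙xz (B (i , j)) a (v j))) (sym (*-distribˡ-sum a (λ j → B (i , j) * v j)))

  𝟏-· : ∀ {n} (v : ℂ^ (Fin n)) → 𝟏 · v ≋ v
  𝟏-· v i = sum-δ i v

  ⊗-· : ∀ {n} (B C : Mat n) v → (B ⊗ C) · v ≋ B · C · v
  ⊗-· B C v i = begin
    sum (λ k → sum (λ j → B (i , j) * C (j , k)) * v k)  ≈⟨ sum-cong (λ k → *-distribʳ-sum (v k) (λ j → B (i , j) * C (j , k))) ⟩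
    sum (λ k → sum λ j → B (i , j) * C (j , k) * v k)  ≈⟨ ∑-comm (λ k j → B (i , j) * C (j , k) * v k) ⟩
    sum (λ j → sum λ k → B (i , j) * C (j , k) * v k)  ≈⟨ sum-cong (λ j → sum-cong λ k → *-assoc (B (i , j)) (C (j , k)) (v k)) ⟩
    sum (λ j → sum λ k → B (i , j) * (C (j , k) * v k))  ≈⟨ sum-cong (λ j → *-distribˡ-sum (B (i , j)) (λ k → C (j , k) * v k)) ⟨
    sum (λ j → B (i , j) * sum (λ k → C (j , k) * v k))  ∎

  ·-unit : ∀ {n} (B : Mat n) i j → (B · unit j) i ≈ B (i , j)
  ·-unit B i j = trans (sum-cong (λ k → *-comm (B (i , k)) (𝟏 (j , k)))) (sum-δ j (λ k → B (i , k)))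

  module _ {n k} {v : Fin k → ℂ^ (Fin n)} where
    Represents-· : ∀ {B C} → Represents B C v → ∀ c → B · lincomb c v ≋ lincomb (C · c) v
    Represents-· {B} {C} r c = ≋-trans (·-lincomb B c v) (≋-trans (lincomb-congʳ c r) (lincomb-lincomb C c v))

    Represents-⊕ : ∀ {B B′ C C′} → Represents B C v → Represents B′ C′ v → Represents (B ⊕ B′) (C ⊕ C′) v
    Represents-⊕ {B} {B′} r r′ j = ≋-trans (⊕-· B B′ (v j))
      (≋-trans (λ i → +-cong (r j i) (r′ j i)) (lincomb-⊕ _ _ v))

    Represents-⊛ : ∀ a {B C} → Represents B C v → Represents (a ⊛ B) (a ⊛ C) v
    Represents-⊛ a {B} r j = ≋-trans (⊛-· a B (v j)) (≋-trans (λ i → *-congˡ {a} (r j i)) (lincomb-⊛ a _ v))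

    Represents-⊗ : ∀ {B B′ C C′} → Represents B C v → Represents B′ C′ v → Represents (B ⊗ B′) (C ⊗ C′) v
    Represents-⊗ {B} {B′} r r′ j =
      ≋-trans (⊗-· B B′ (v j)) (≋-trans (·-congʳ B (r′ j)) (Represents-· r _))

    Represents-𝟏 : Represents 𝟏 𝟏 v
    Represents-𝟏 j = ≋-trans (𝟏-· (v j)) (≋-sym (≋-trans
      (lincomb-congˡ v (λ i → reflexive (𝟏-sym i j))) (lincomb-unit v j)))

    Represents-cong : ∀ {B B′ C C′} → B ≋ B′ → C ≋ C′ → Represents B C v → Represents B′ C′ v
    Represents-cong p q r j = ≋-trans (·-congˡ (v j) (≋-sym p)) (≋-trans (r j) (lincomb-congˡ v (λ i → q (i , j))))

  Represents-basis : ∀ {n k B C} {v w : Fin k → ℂ^ (Fin n)} → (∀ j → v j ≋ w j) → Represents B C v → Represents B C w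
  Represents-basis {B = B} p r j =
    ≋-trans (·-congʳ B (≋-sym (p j))) (≋-trans (r j) (lincomb-congʳ _ p))

  -- The bilinear form, without conjugation. The listed basis vectors are real, so it computes their
  -- Hermitian products while staying linear in both arguments.
  _∙_ : ∀ {n} → ℂ^ (Fin n) → ℂ^ (Fin n) → ℂ
  u ∙ v = sum (λ i → u i * v i)

  ∙-congʳ : ∀ {n} (u : ℂ^ (Fin n)) {v w} → v ≋ w → u ∙ v ≈ u ∙ w
  ∙-congʳ u p = sum-cong (λ i → *-congˡ {u i} (p i))

  ∙-lincomb : ∀ {n k} (u : ℂ^ (Fin n)) (c : Fin k → ℂ) (v : Fin k → ℂ^ (Fin n)) →
              u ∙ lincomb c v ≈ sum (λ j → c j * (u ∙ v j))
  ∙-lincomb u c v = begin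
    sum (λ i → u i * sum (λ j → c j * v j i))  ≈⟨ sum-cong (λ i → *-distribˡ-sum (u i) (λ j → c j * v j i)) ⟩
    sum (λ i → sum λ j → u i * (c j * v j i))  ≈⟨ ∑-comm (λ i j → u i * (c j * v j i)) ⟩
    sum (λ j → sum λ i → u i * (c j * v j i))  ≈⟨ sum-cong (λ j → sum-cong λ i → x∙yz≈y∙xz (u i) (c j) (v j i)) ⟩
    sum (λ j → sum λ i → c j * (u i * v j i))  ≈⟨ sum-cong (λ j → *-distribˡ-sum (c j) (λ i → u i * v j i)) ⟨
    sum (λ j → c j * (u ∙ v j))  ∎

  ∙-⊛ : ∀ {n} (u : ℂ^ (Fin n)) a v → u ∙ (a ⊛ v) ≈ a * (u ∙ v)
  ∙-⊛ u a v = trans (sum-cong (λ i → x∙yz≈y∙xz (u i) a (v i))) (sym (*-distribˡ-sum a (λ i → u i * v i)))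

  ∙-𝟎 : ∀ {n} (u : ℂ^ (Fin n)) → u ∙ 𝟎 ≈ 0ℂ
  ∙-𝟎 u = sum-zero (λ i → zeroʳ (u i))

  Nonzero-⊛ : ∀ {I : Set} {a} {v : ℂ^ I} → a # 0ℂ → Nonzero v → Nonzero (a ⊛ v)
  Nonzero-⊛ {a = a} {v} a#0 (i , v#0) = i , x#0y#0→xy#0 {a} {v i} a#0 v#0

  Nonzero-cong : ∀ {I : Set} {u v : ℂ^ I} → u ≋ v → Nonzero u → Nonzero v
  Nonzero-cong {u = u} p (i , u#0) = i , #-congʳ {u i} (p i) u#0

  abstract
    -- The constructive substitute for choosing a nonzero coordinate of a nonzero vector.
    Nonzero-lincomb : ∀ {I : Set} {k} {c : Fin k → ℂ} {v : Fin k → ℂ^ I} → Nonzero (lincomb c v) →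
                      ∃[ j ] (c j # 0ℂ × Nonzero (v j))
    Nonzero-lincomb {c = c} {v} (i , s#0) =
      let j , cv#0 = sum#0⇒#0 (λ j → c j * v j i) s#0
      in j , *#0⇒#0ˡ {c j} {v j i} cv#0 , i , *#0⇒#0ʳ {c j} {v j i} cv#0

-- Diagonalisation

module Diagonal (ℝ : Reals) where
  open Linear ℝ
  open SetoidReasoning setoid

  *-cancelʳ : ∀ {a b x} → x # 0ℂ → a * x ≈ b * x → a ≈ b
  *-cancelʳ {a} {b} {x} x#0 ax≈bx = let y , yx≈1 = inverse {x} x#0 in begin
    a  ≈⟨ *-identityʳ a ⟨
    a * 1ℂ  ≈⟨ *-congˡ {a} yx≈1 ⟨
    a * (y * x)  ≈⟨ x∙yz≈y∙xz a y x ⟩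
    y * (a * x)  ≈⟨ *-congˡ {y} ax≈bx ⟩
    y * (b * x)  ≈⟨ x∙yz≈y∙xz b y x ⟨
    b * (y * x)  ≈⟨ *-congˡ {b} yx≈1 ⟩
    b * 1ℂ  ≈⟨ *-identityʳ b ⟩
    b  ∎

  apart-cancel : ∀ {a b x} → a # b → a * x ≈ b * x → x ≈ 0ℂ
  apart-cancel {a} {b} {x} a#b ax≈bx = cancel {a - b} {x} (#⇒-#0 {a} {b} a#b) (begin
    (a - b) * x  ≈⟨ distribʳ x a (- b) ⟩
    a * x + - b * x  ≈⟨ +-cong ax≈bx (sym (-‿distribˡ-* b x)) ⟩
    b * x + - (b * x)  ≈⟨ -‿inverseʳ (b * x) ⟩
    0ℂ  ∎)
    where
    open CommutativeRing commutativeRing using (_-_; -_; -‿inverseʳ)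
    open RingProperties (CommutativeRing.ring commutativeRing) using (-‿distribˡ-*)

  -- Right eigenvectors P j and left eigenvectors Q j, for the eigenvalue
  -- θ (class j), which are dual to one another up to the factor N.
  record Diagonalisation {n m : ℕ} (M : Mat n) (θ : Fin m → ℂ) (class : Fin n → Fin m) : Set where
    field
      P Q    : Fin n → ℂ^ (Fin n)
      N      : ℂ
      N#0    : N # 0ℂ
      right  : ∀ j → M · P j ≋ θ (class j) ⊛ P j
      left   : ∀ j v → Q j ∙ (M · v) ≈ θ (class j) * (Q j ∙ v)
      dual   : ∀ j k → Q j ∙ P k ≈ N * 𝟏 (j , k)
      expand : ∀ y z → sum (λ j → P j y * Q j z) ≈ N * 𝟏 (y , z)

    expansion : ∀ u → N ⊛ u ≋ lincomb (λ j → Q j ∙ u) P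
    expansion u y = begin
      N * u y  ≈⟨ *-congˡ {N} (sum-δ y u) ⟨
      N * sum (λ z → 𝟏 (y , z) * u z)  ≈⟨ *-distribˡ-sum N (λ z → 𝟏 (y , z) * u z) ⟩
      sum (λ z → N * (𝟏 (y , z) * u z))  ≈⟨ sum-cong (λ z → *-assoc N (𝟏 (y , z)) (u z)) ⟨
      sum (λ z → N * 𝟏 (y , z) * u z)  ≈⟨ sum-cong (λ z → *-congʳ {u z} (expand y z)) ⟨
      sum (λ z → sum (λ j → P j y * Q j z) * u z)  ≈⟨ sum-cong (λ z → *-distribʳ-sum (u z) (λ j → P j y * Q j z)) ⟩
      sum (λ z → sum λ j → P j y * Q j z * u z)  ≈⟨ ∑-comm (λ z j → P j y * Q j z * u z) ⟩
      sum (λ j → sum λ z → P j y * Q j z * u z)  ≈⟨ sum-cong (λ j → sum-cong λ z → *-assoc (P j y) (Q j z) (u z)) ⟩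
      sum (λ j → sum λ z → P j y * (Q j z * u z))  ≈⟨ sum-cong (λ j → *-distribˡ-sum (P j y) (λ z → Q j z * u z)) ⟨
      sum (λ j → P j y * (Q j ∙ u))  ≈⟨ sum-cong (λ j → *-comm (P j y) (Q j ∙ u)) ⟩
      sum (λ j → (Q j ∙ u) * P j y)  ∎

    -- Both sides evaluate the left eigenvector on M · u. Hence an eigenvector for `t` has no
    -- coordinate at an eigenvalue apart from `t`.
    eigencoordinates : ∀ {t u} → Eigenspace M t u → ∀ j → θ (class j) * (Q j ∙ u) ≈ t * (Q j ∙ u)
    eigencoordinates {t} {u} Mu≋tu j =
      trans (sym (left j u)) (trans (∙-congʳ (Q j) Mu≋tu) (∙-⊛ (Q j) t u))

    -- An eigenvector has some coordinate apart from 0, and cancelling it in `eigencoordinates`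
    -- identifies its eigenvalue. Conversely `P j` is nonzero because its product with `Q j` is N.
    hasEigenvalues : (∀ c → ∃[ j ] class j ≡ c) → HasEigenvalues M (List.tabulate θ)
    hasEigenvalues hit t = mk⇔ to from
      where
      to : IsEigenvalue M t → Any (t ≈_) (List.tabulate θ)
      to (u , Mu≋tu , u#0) =
        let j , Qu#0 , _ = Nonzero-lincomb {c = λ j → Q j ∙ u} {P}
                             (Nonzero-cong (expansion u) (Nonzero-⊛ N#0 u#0))
        in Any.tabulate⁺ (class j) (*-cancelʳ {t} {θ (class j)} Qu#0 (sym (eigencoordinates Mu≋tu j)))
      from : Any (t ≈_) (List.tabulate θ) → IsEigenvalue M t
      from any =
        let c , t≈θ = Any.tabulate⁻ any
            j , class≡c = hit c
            t≈θ′ = ≡.subst (λ c → t ≈ θ c) (≡.sym class≡c) t≈θ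
            QP#0 = #-congʳ (sym (trans (dual j j) (trans (*-congˡ {N} (reflexive (𝟏-refl j))) (*-identityʳ N)))) N#0
            i , QPᵢ#0 = sum#0⇒#0 (λ i → Q j i * P j i) QP#0
        in P j , (λ i → trans (right j i) (*-congʳ {P j i} (sym t≈θ′))) , i , *#0⇒#0ʳ {Q j i} {P j i} QPᵢ#0

    -- Pairing with the dual vectors gives independence. For spanning, the coordinates outside the
    -- class `c` vanish because the eigenvalues are apart.
    eigenspace : (∀ c c′ → c ≢ c′ → θ c # θ c′) → ∀ {c k} → Enumeration (λ j → class j ≡ c) k →
                 HasDim (Eigenspace M (θ c)) k
    eigenspace apart {c} {k} e = P ∘ elem e , record
      { member      = λ j → ≡.subst (λ c → M · P (elem e j) ≋ θ c ⊛ P (elem e j)) (Enumeration.sound e j) (right (elem e j))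
      ; independent = λ b b≋0 j → cancel {N} {b j} N#0 (begin
          N * b j  ≈⟨ sum-δ j (λ l → N * b l) ⟨
          sum (λ l → 𝟏 (j , l) * (N * b l))  ≈⟨ sum-cong (λ l → pair b j l) ⟨
          sum (λ l → b l * (Q (elem e j) ∙ P (elem e l)))  ≈⟨ ∙-lincomb (Q (elem e j)) b (P ∘ elem e) ⟨
          Q (elem e j) ∙ lincomb b (P ∘ elem e)  ≈⟨ ∙-congʳ (Q (elem e j)) b≋0 ⟩
          Q (elem e j) ∙ 𝟎  ≈⟨ ∙-𝟎 (Q (elem e j)) ⟩
          0ℂ  ∎)
      ; spanning    = λ {u} Mu≋θu →
          let y , yN≈1 = inverse {N} N#0 in
          (λ j → y * (Q (elem e j) ∙ u)) , λ i → begin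
          u i  ≈⟨ *-identityˡ (u i) ⟨
          1ℂ * u i  ≈⟨ *-congʳ {u i} yN≈1 ⟨
          y * N * u i  ≈⟨ *-assoc y N (u i) ⟩
          y * (N * u i)  ≈⟨ *-congˡ {y} (expansion u i) ⟩
          y * sum (λ j → (Q j ∙ u) * P j i)  ≈⟨ *-congˡ {y} (sum-Enumeration (λ j → class j Fin.≟ c) e (λ j → (Q j ∙ u) * P j i)
                                                                            (λ j j∉ → trans (*-congʳ {P j i} (vanish Mu≋θu j j∉)) (zeroˡ (P j i)))) ⟩
          y * sum (λ j → (Q (elem e j) ∙ u) * P (elem e j) i)  ≈⟨ lincomb-⊛ y (λ j → Q (elem e j) ∙ u) (P ∘ elem e) i ⟩
          sum (λ j → y * (Q (elem e j) ∙ u) * P (elem e j) i)  ∎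
      }
      where
      vanish : ∀ {u} → Eigenspace M (θ c) u → ∀ j → class j ≢ c → Q j ∙ u ≈ 0ℂ
      vanish Mu≋θu j j∉ = apart-cancel {θ (class j)} {θ c} (apart (class j) c j∉) (eigencoordinates Mu≋θu j)
      pair : ∀ (b : Fin k → ℂ) j l → b l * (Q (elem e j) ∙ P (elem e l)) ≈ 𝟏 (j , l) * (N * b l)
      pair b j l = begin
        b l * (Q (elem e j) ∙ P (elem e l))  ≈⟨ *-congˡ {b l} (dual (elem e j) (elem e l)) ⟩
        b l * (N * 𝟏 (elem e j , elem e l))  ≡⟨ ≡.cong (λ δ → b l * (N * δ)) (𝟏-injective (Enumeration.injective e) j l) ⟩
        b l * (N * 𝟏 (j , l))  ≈⟨ *-assoc (b l) N (𝟏 (j , l)) ⟨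
        b l * N * 𝟏 (j , l)  ≈⟨ *-comm (b l * N) (𝟏 (j , l)) ⟩
        𝟏 (j , l) * (b l * N)  ≈⟨ *-congˡ {𝟏 (j , l)} (*-comm (b l) N) ⟩
        𝟏 (j , l) * (N * b l)  ∎

-- Eigenvectors with entries in ℤ[√3]

_≟√_ : (p q : ℤ[√3]) → Dec (p ≡ q)
_≟√_ = Product.≡-dec ℤ._≟_ ℤ._≟_

+√-rawMonoid : RawMonoid 0ℓ 0ℓ
+√-rawMonoid = record { _≈_ = _≡_ ; _∙_ = _+√_ ; ε = (+ 0 , + 0) }

open RawMonoidDefinitions +√-rawMonoid public using () renaming (sum to sum√)

eigenvalue : Fin 5 → ℤ[√3]
eigenvalue = lookup ((+ 3 , + 0) ∷ (+ 0 , + 1) ∷ (+ 0 , + 0) ∷ (+ 0 , -1ℤ) ∷ (-3ℤ , + 0) ∷ [])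

difference : Fin 5 → Fin 5 → ℤ[√3]
difference c c′ = eigenvalue c +√ ((-1ℤ , + 0) *√ eigenvalue c′)

conjugate : ℤ[√3] → ℤ[√3]
conjugate (a , b) = a , ℤ.- b

abstract
  -- The norms of the differences are nonzero integers, which makes the five eigenvalues pairwise
  -- apart in ℂ.
  differences-invertible : ∀ c c′ → c ≢ c′ →
    proj₁ (difference c c′ *√ conjugate (difference c c′)) ≢ + 0 ×
    proj₂ (difference c c′ *√ conjugate (difference c c′)) ≡ + 0
  differences-invertible = from-yes (Fin.all? λ c → Fin.all? λ c′ → ¬? (c Fin.≟ c′) →-dec
    (¬? (proj₁ (difference c c′ *√ conjugate (difference c c′)) ℤ.≟ + 0) ×-dec
     (proj₂ (difference c c′ *√ conjugate (difference c c′)) ℤ.≟ + 0)))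

-- The rows of modes τ are eigenvectors of actionOf τ for the eigenvalues
-- listed by modeClass τ; those of comodes τ are left eigenvectors, and
-- comodes τ is inverse to the transpose of modes τ up to the factor scale τ.
modeClass : ∀ τ → Fin (dim τ) → Fin 5
modeClass I   = id
modeClass II  = lookup (1F ∷ 2F ∷ 3F ∷ [])
modeClass III = lookup (2F ∷ [])
modeClass IV  = lookup (1F ∷ 3F ∷ [])
modeClass V   = lookup (1F ∷ 3F ∷ [])

scale : Kind → ℤ
scale I   = + 36
scale II  = + 12
scale III = + 1
scale IV  = + 6
scale V   = + 6

modes comodes : ∀ τ → Vec (Vec ℤ[√3] (dim τ)) (dim τ)
modes I = ((+ 1 , + 0) ∷ (+ 1 , + 0) ∷ (+ 1 , + 0) ∷ (+ 1 , + 0) ∷ (+ 1 , + 0) ∷ [])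
        ∷ ((+ 0 , + 2) ∷ (+ 2 , + 0) ∷ (+ 0 , + 0) ∷ (-1ℤ , + 0) ∷ (+ 0 , -1ℤ) ∷ [])
        ∷ ((+ 2 , + 0) ∷ (+ 0 , + 0) ∷ (-1ℤ , + 0) ∷ (+ 0 , + 0) ∷ (+ 2 , + 0) ∷ [])
        ∷ ((+ 0 , -2ℤ) ∷ (+ 2 , + 0) ∷ (+ 0 , + 0) ∷ (-1ℤ , + 0) ∷ (+ 0 , + 1) ∷ [])
        ∷ ((+ 1 , + 0) ∷ (-1ℤ , + 0) ∷ (+ 1 , + 0) ∷ (-1ℤ , + 0) ∷ (+ 1 , + 0) ∷ [])
        ∷ []
modes II = ((+ 2 , + 0) ∷ (+ 0 , + 1) ∷ (+ 1 , + 0) ∷ [])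
         ∷ ((+ 1 , + 0) ∷ (+ 0 , + 0) ∷ (-1ℤ , + 0) ∷ [])
         ∷ ((+ 2 , + 0) ∷ (+ 0 , -1ℤ) ∷ (+ 1 , + 0) ∷ [])
         ∷ []
modes III = ((+ 1 , + 0) ∷ []) ∷ []
modes IV = ((+ 0 , + 1) ∷ (+ 1 , + 0) ∷ [])
         ∷ ((+ 0 , -1ℤ) ∷ (+ 1 , + 0) ∷ [])
         ∷ []
modes V  = modes IV
comodes I = ((+ 2 , + 0) ∷ (+ 6 , + 0) ∷ (+ 12 , + 0) ∷ (+ 12 , + 0) ∷ (+ 4 , + 0) ∷ [])
          ∷ ((+ 0 , + 2) ∷ (+ 6 , + 0) ∷ (+ 0 , + 0) ∷ (-[1+ 5 ] , + 0) ∷ (+ 0 , -2ℤ) ∷ [])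
          ∷ ((+ 4 , + 0) ∷ (+ 0 , + 0) ∷ (-[1+ 11 ] , + 0) ∷ (+ 0 , + 0) ∷ (+ 8 , + 0) ∷ [])
          ∷ ((+ 0 , -2ℤ) ∷ (+ 6 , + 0) ∷ (+ 0 , + 0) ∷ (-[1+ 5 ] , + 0) ∷ (+ 0 , + 2) ∷ [])
          ∷ ((+ 2 , + 0) ∷ (-[1+ 5 ] , + 0) ∷ (+ 12 , + 0) ∷ (-[1+ 11 ] , + 0) ∷ (+ 4 , + 0) ∷ [])
          ∷ []
comodes II = ((+ 2 , + 0) ∷ (+ 0 , + 2) ∷ (+ 2 , + 0) ∷ [])
           ∷ ((+ 4 , + 0) ∷ (+ 0 , + 0) ∷ (-[1+ 7 ] , + 0) ∷ [])
           ∷ ((+ 2 , + 0) ∷ (+ 0 , -2ℤ) ∷ (+ 2 , + 0) ∷ [])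
           ∷ []
comodes III = ((+ 1 , + 0) ∷ []) ∷ []
comodes IV = ((+ 0 , + 1) ∷ (+ 3 , + 0) ∷ [])
           ∷ ((+ 0 , -1ℤ) ∷ (+ 3 , + 0) ∷ [])
           ∷ []
comodes V  = comodes IV

entry√ : ∀ {n} → Vec (Vec ℤ[√3] n) n → Fin n → Fin n → ℤ[√3]
entry√ M i j = lookup (lookup M i) j

entry : ∀ {n} → Vec (Vec ℤ n) n → Fin n → Fin n → ℤ
entry M i j = lookup (lookup M i) j

all-kinds? : {P : Kind → Set} → (∀ τ → Dec (P τ)) → Dec (∀ τ → P τ)
all-kinds? {P} P? = map′ (λ p τ → ≡.subst P (kindAt-kindIndex τ) (p (kindIndex τ))) (λ p i → p (kindAt i))
                         (Fin.all? (P? ∘ kindAt))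

abstract
  modes-right : ∀ τ j i → sum√ (λ k → (entry (actionOf τ) i k , + 0) *√ entry√ (modes τ) j k)
                        ≡ eigenvalue (modeClass τ j) *√ entry√ (modes τ) j i
  modes-right = from-yes (all-kinds? λ τ → Fin.all? λ j → Fin.all? λ i →
    sum√ (λ k → (entry (actionOf τ) i k , + 0) *√ entry√ (modes τ) j k)
    ≟√ (eigenvalue (modeClass τ j) *√ entry√ (modes τ) j i))

  modes-left : ∀ τ j k → sum√ (λ i → entry√ (comodes τ) j i *√ (entry (actionOf τ) i k , + 0))
                       ≡ eigenvalue (modeClass τ j) *√ entry√ (comodes τ) j k
  modes-left = from-yes (all-kinds? λ τ → Fin.all? λ j → Fin.all? λ k →
    sum√ (λ i → entry√ (comodes τ) j i *√ (entry (actionOf τ) i k , + 0))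
    ≟√ (eigenvalue (modeClass τ j) *√ entry√ (comodes τ) j k))

  modes-dual : ∀ τ j k → sum√ (λ i → entry√ (comodes τ) j i *√ entry√ (modes τ) k i)
                       ≡ ((if does (j Fin.≟ k) then scale τ else + 0) , + 0)
  modes-dual = from-yes (all-kinds? λ τ → Fin.all? λ j → Fin.all? λ k →
    sum√ (λ i → entry√ (comodes τ) j i *√ entry√ (modes τ) k i)
    ≟√ ((if does (j Fin.≟ k) then scale τ else + 0) , + 0))

  modes-expand : ∀ τ y z → sum√ (λ j → entry√ (modes τ) j y *√ entry√ (comodes τ) j z)
                         ≡ ((if does (y Fin.≟ z) then scale τ else + 0) , + 0)
  modes-expand = from-yes (all-kinds? λ τ → Fin.all? λ y → Fin.all? λ z →
    sum√ (λ j → entry√ (modes τ) j y *√ entry√ (comodes τ) j z)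
    ≟√ ((if does (y Fin.≟ z) then scale τ else + 0) , + 0))

-- The eigenvectors of the Pappus graph are assembled from those of the blocks
-- and ordered by eigenvalue.
spectralIndex : Fin 18 → Σ (Fin 7) λ s → Fin (dim (kind s))
spectralIndex = lookup
  ( (0F , 0F)
  ∷ (0F , 1F) ∷ (1F , 0F) ∷ (2F , 0F) ∷ (4F , 0F) ∷ (5F , 0F) ∷ (6F , 0F)
  ∷ (0F , 2F) ∷ (1F , 1F) ∷ (2F , 1F) ∷ (3F , 0F)
  ∷ (0F , 3F) ∷ (1F , 2F) ∷ (2F , 2F) ∷ (4F , 1F) ∷ (5F , 1F) ∷ (6F , 1F)
  ∷ (0F , 4F) ∷ [])

spectralClass : Fin 18 → Fin 5
spectralClass l = modeClass (kind (proj₁ (spectralIndex l))) (proj₂ (spectralIndex l))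

abstract
  -- One choice of permutation and sign is enough, as the spectrum does not refer to the orderings.
  eigenvector : Fin 18 → Fin 18 → ℤ[√3]
  eigenvector l = combination (spectralIndex l)
    where
    combination : Σ (Fin 7) (λ s → Fin (dim (kind s))) → Fin 18 → ℤ[√3]
    combination (s , j) y = sum√ λ i → entry√ (modes (kind s)) j i *√ (lookup (block 0F 0F s i) y , + 0)

-- 72 divided by the squared norm of the eigenvector
eigenweight : Fin 18 → ℤ
eigenweight = lookup (+ 4 ∷ + 2 ∷ + 3 ∷ + 1 ∷ + 3 ∷ + 1 ∷ + 2 ∷ + 4 ∷ + 12 ∷ + 4 ∷ + 12
                     ∷ + 2 ∷ + 3 ∷ + 1 ∷ + 3 ∷ + 1 ∷ + 2 ∷ + 4 ∷ [])

-- The adjacency matrix is symmetric and these eigenvectors are orthogonal, so the dual left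
-- eigenvectors are rescaled right ones.
coeigenvector : Fin 18 → Fin 18 → ℤ[√3]
coeigenvector l y = (eigenweight l , + 0) *√ eigenvector l y

abstract
  eigenvector-right : ∀ l y → sum√ (λ k → eigenvector l (neighbor y k))
                            ≡ eigenvalue (spectralClass l) *√ eigenvector l y
  eigenvector-right = from-yes (Fin.all? λ l → Fin.all? λ y →
    sum√ (λ k → eigenvector l (neighbor y k)) ≟√ (eigenvalue (spectralClass l) *√ eigenvector l y))

  eigenvector-dual : ∀ j k → sum√ (λ i → coeigenvector j i *√ eigenvector k i)
                           ≡ ((if does (j Fin.≟ k) then + 72 else + 0) , + 0)
  eigenvector-dual = from-yes (Fin.all? λ j → Fin.all? λ k →
    sum√ (λ i → coeigenvector j i *√ eigenvector k i)
    ≟√ ((if does (j Fin.≟ k) then + 72 else + 0) , + 0))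

  eigenvector-expand : ∀ y z → sum√ (λ j → eigenvector j y *√ coeigenvector j z)
                             ≡ ((if does (y Fin.≟ z) then + 72 else + 0) , + 0)
  eigenvector-expand = from-yes (Fin.all? λ y → Fin.all? λ z →
    sum√ (λ j → eigenvector j y *√ coeigenvector j z)
    ≟√ ((if does (y Fin.≟ z) then + 72 else + 0) , + 0))

spectralMultiplicity : Fin 5 → ℕ
spectralMultiplicity = lookup (1 ∷ 6 ∷ 4 ∷ 6 ∷ 1 ∷ [])

spectralMembers : ∀ c → Vec (Fin 18) (spectralMultiplicity c)
spectralMembers 0F = # 0 ∷ []
spectralMembers 1F = # 1 ∷ # 2 ∷ # 3 ∷ # 4 ∷ # 5 ∷ # 6 ∷ []
spectralMembers 2F = # 7 ∷ # 8 ∷ # 9 ∷ # 10 ∷ []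
spectralMembers 3F = # 11 ∷ # 12 ∷ # 13 ∷ # 14 ∷ # 15 ∷ # 16 ∷ []
spectralMembers 4F = # 17 ∷ []

abstract
  spectralMembers-injective : ∀ c i j → lookup (spectralMembers c) i ≡ lookup (spectralMembers c) j → i ≡ j
  spectralMembers-injective = from-yes (Fin.all? λ c → Fin.all? λ i → Fin.all? λ j →
    (lookup (spectralMembers c) i Fin.≟ lookup (spectralMembers c) j) →-dec (i Fin.≟ j))

  spectralMembers-sound : ∀ c i → spectralClass (lookup (spectralMembers c) i) ≡ c
  spectralMembers-sound = from-yes (Fin.all? λ c → Fin.all? λ i → spectralClass (lookup (spectralMembers c) i) Fin.≟ c)

  spectralMembers-complete : ∀ c j → spectralClass j ≡ c → ∃[ i ] lookup (spectralMembers c) i ≡ j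
  spectralMembers-complete = from-yes (Fin.all? λ c → Fin.all? λ j →
    (spectralClass j Fin.≟ c) →-dec Fin.any? λ i → lookup (spectralMembers c) i Fin.≟ j)

  spectral-hit : ∀ c → ∃[ j ] spectralClass j ≡ c
  spectral-hit = from-yes (Fin.all? λ c → Fin.any? λ j → spectralClass j Fin.≟ c)

spectralEnumeration : ∀ c → Enumeration (λ j → spectralClass j ≡ c) (spectralMultiplicity c)
spectralEnumeration c = record
  { elem = lookup (spectralMembers c) ; injective = λ {i} {j} → spectralMembers-injective c i j
  ; sound = spectralMembers-sound c ; complete = spectralMembers-complete c }

module Eigen (ℝ : Reals) (√3 : Reals.Carrier ℝ) (√3-sqrt : Reals.IsSqrt ℝ √3 (+ 3)) where
  open Linear ℝ
  open Diagonal ℝ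
  open Sqrt3 ℝ √3 (proj₂ √3-sqrt)
  open SetoidReasoning setoid

  open CommutativeRing commutativeRing using (_-_; -_; -‿cong)
  open RingProperties (CommutativeRing.ring commutativeRing) using (-1*x≈-x)

  eval-0 : eval (+ 0 , + 0) ≈ 0ℂ
  eval-0 = eval-fromℤ (+ 0)

  eval-sum : ∀ {n} (f : Fin n → ℤ[√3]) → eval (sum√ f) ≈ sum (eval ∘ f)
  eval-sum {zero}  f = eval-0
  eval-sum {suc n} f = trans (eval-+ (f zero) (sum√ (f ∘ suc))) (+-congˡ {eval (f zero)} (eval-sum (f ∘ suc)))

  eval-dot : ∀ {n} (f g : Fin n → ℤ[√3]) → sum (λ i → eval (f i) * eval (g i)) ≈ eval (sum√ λ i → f i *√ g i)
  eval-dot f g = sym (trans (eval-sum (λ i → f i *√ g i)) (sum-cong (λ i → eval-* (f i) (g i))))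

  eval-δ : ∀ {n} N (i j : Fin n) → eval ((if does (i Fin.≟ j) then N else + 0) , + 0) ≈ fromℤ N * 𝟏 (i , j)
  eval-δ N i j = cases (does (i Fin.≟ j))
    where
    cases : ∀ b → eval ((if b then N else + 0) , + 0) ≈ fromℤ N * (if b then 1ℂ else 0ℂ)
    cases true  = trans (eval-fromℤ N) (sym (*-identityʳ (fromℤ N)))
    cases false = trans eval-0 (sym (zeroʳ (fromℤ N)))

  eigenvalueℂ : Fin 5 → ℂ
  eigenvalueℂ = lookup (fromℤ (+ 3) ∷ real √3 ∷ fromℤ (+ 0) ∷ real (Reals.-_ ℝ √3) ∷ fromℤ -[1+ 2 ] ∷ [])

  fromℤ-neg1 : ∀ z → fromℤ -1ℤ * z ≈ - z
  fromℤ-neg1 z = trans (*-congʳ {z} (trans (fromℤ-neg (+ 1)) (-‿cong fromℤ-1))) (-1*x≈-x z)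

  eval-eigenvalue : ∀ c → eigenvalueℂ c ≈ eval (eigenvalue c)
  eval-eigenvalue 0F = sym (eval-fromℤ (+ 3))
  eval-eigenvalue 1F = sym (trans (+-identityˡ _) (trans (*-congʳ {s} fromℤ-1) (*-identityˡ s)))
  eval-eigenvalue 2F = sym eval-0
  eval-eigenvalue 3F = sym (trans (+-identityˡ _) (trans (fromℤ-neg1 s) (HeytingField.refl (Reals.heytingField ℝ) , -0#≈0#)))
    where open RingProperties (CommutativeRing.ring (Reals.commutativeRing ℝ)) using (-0#≈0#)
  eval-eigenvalue 4F = sym (eval-fromℤ -[1+ 2 ])

  eigenvalueℂ-apart : ∀ c c′ → c ≢ c′ → eigenvalueℂ c # eigenvalueℂ c′
  eigenvalueℂ-apart c c′ c≢c′ = -#0⇒# {eigenvalueℂ c} {eigenvalueℂ c′} (#-congʳ {eval (difference c c′)}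
    (begin
      eval (eigenvalue c +√ ((-1ℤ , + 0) *√ eigenvalue c′))  ≈⟨ eval-+ (eigenvalue c) _ ⟩
      eval (eigenvalue c) + eval ((-1ℤ , + 0) *√ eigenvalue c′)  ≈⟨ +-cong (sym (eval-eigenvalue c)) (eval-* (-1ℤ , + 0) (eigenvalue c′)) ⟩
      eigenvalueℂ c + eval (-1ℤ , + 0) * eval (eigenvalue c′)  ≈⟨ +-congˡ {eigenvalueℂ c} (*-cong (eval-fromℤ -1ℤ) (sym (eval-eigenvalue c′))) ⟩
      eigenvalueℂ c + fromℤ -1ℤ * eigenvalueℂ c′  ≈⟨ +-congˡ {eigenvalueℂ c} (fromℤ-neg1 (eigenvalueℂ c′)) ⟩
      eigenvalueℂ c - eigenvalueℂ c′  ∎)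
    (eval#0 (difference c c′) (conjugate (difference c c′))
      (≡.cong (proj₁ (difference c c′ *√ conjugate (difference c c′)) ,_) (proj₂ (differences-invertible c c′ c≢c′))) (proj₁ (differences-invertible c c′ c≢c′))))

  scaled : ∀ c p → eval (eigenvalue c *√ p) ≈ eigenvalueℂ c * eval p
  scaled c p = trans (eval-* (eigenvalue c) p) (*-congʳ {eval p} (sym (eval-eigenvalue c)))

  left-entries : ∀ {n} (M : Mat n) (q : ℂ^ (Fin n)) t → (∀ k → sum (λ i → q i * M (i , k)) ≈ t * q k) →
                 ∀ v → q ∙ (M · v) ≈ t * (q ∙ v)
  left-entries M q t qM≈tq v = begin
    sum (λ i → q i * sum (λ k → M (i , k) * v k))  ≈⟨ sum-cong (λ i → *-distribˡ-sum (q i) (λ k → M (i , k) * v k)) ⟩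
    sum (λ i → sum λ k → q i * (M (i , k) * v k))  ≈⟨ ∑-comm (λ i k → q i * (M (i , k) * v k)) ⟩
    sum (λ k → sum λ i → q i * (M (i , k) * v k))  ≈⟨ sum-cong (λ k → sum-cong λ i → *-assoc (q i) (M (i , k)) (v k)) ⟨
    sum (λ k → sum λ i → q i * M (i , k) * v k)  ≈⟨ sum-cong (λ k → *-distribʳ-sum (v k) (λ i → q i * M (i , k))) ⟨
    sum (λ k → sum (λ i → q i * M (i , k)) * v k)  ≈⟨ sum-cong (λ k → *-congʳ {v k} (qM≈tq k)) ⟩
    sum (λ k → t * q k * v k)  ≈⟨ sum-cong (λ k → *-assoc t (q k) (v k)) ⟩
    sum (λ k → t * (q k * v k))  ≈⟨ *-distribˡ-sum t (λ k → q k * v k) ⟨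
    t * (q ∙ v)  ∎

  scale#0 : ∀ τ → fromℤ (scale τ) # 0ℂ
  scale#0 I   = fromℤ#0 {+ 36} λ ()
  scale#0 II  = fromℤ#0 {+ 12} λ ()
  scale#0 III = fromℤ#0 {+ 1} λ ()
  scale#0 IV  = fromℤ#0 {+ 6} λ ()
  scale#0 V   = fromℤ#0 {+ 6} λ ()

  action-diagonal : ∀ τ → Diagonalisation (fromRows (actionOf τ)) (eigenvalueℂ ∘ modeClass τ) id
  action-diagonal τ = record
    { P = λ j i → eval (p j i) ; Q = λ j i → eval (q j i) ; N = fromℤ (scale τ) ; N#0 = scale#0 τ
    ; right = λ j i → begin
        sum (λ k → fromℤ (B i k) * eval (p j k))  ≈⟨ sum-cong (λ k → *-congʳ {eval (p j k)} (eval-fromℤ (B i k))) ⟨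
        sum (λ k → eval (B i k , + 0) * eval (p j k))  ≈⟨ eval-dot (λ k → B i k , + 0) (p j) ⟩
        eval (sum√ λ k → (B i k , + 0) *√ p j k)  ≡⟨ ≡.cong eval (modes-right τ j i) ⟩
        eval (eigenvalue (modeClass τ j) *√ p j i)  ≈⟨ scaled (modeClass τ j) (p j i) ⟩
        eigenvalueℂ (modeClass τ j) * eval (p j i)  ∎
    ; left = λ j → left-entries (fromRows (actionOf τ)) (eval ∘ q j) (eigenvalueℂ (modeClass τ j)) λ k → begin
        sum (λ i → eval (q j i) * fromℤ (B i k))  ≈⟨ sum-cong (λ i → *-congˡ {eval (q j i)} (eval-fromℤ (B i k))) ⟨
        sum (λ i → eval (q j i) * eval (B i k , + 0))  ≈⟨ eval-dot (q j) (λ i → B i k , + 0) ⟩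
        eval (sum√ λ i → q j i *√ (B i k , + 0))  ≡⟨ ≡.cong eval (modes-left τ j k) ⟩
        eval (eigenvalue (modeClass τ j) *√ q j k)  ≈⟨ scaled (modeClass τ j) (q j k) ⟩
        eigenvalueℂ (modeClass τ j) * eval (q j k)  ∎
    ; dual = λ j k → trans (eval-dot (q j) (p k))
        (trans (reflexive (≡.cong eval (modes-dual τ j k))) (eval-δ (scale τ) j k))
    ; expand = λ y z → trans (eval-dot (λ j → p j y) (λ j → q j z))
        (trans (reflexive (≡.cong eval (modes-expand τ y z))) (eval-δ (scale τ) y z))
    }
    where
    B : Fin (dim τ) → Fin (dim τ) → ℤ
    B = entry (actionOf τ)
    p q : Fin (dim τ) → Fin (dim τ) → ℤ[√3]
    p = entry√ (modes τ)
    q = entry√ (comodes τ)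

  action-eigenvalues : ∀ τ → HasEigenvalues (fromRows (actionOf τ)) (List.tabulate (eigenvalueℂ ∘ modeClass τ))
  action-eigenvalues τ = Diagonalisation.hasEigenvalues (action-diagonal τ) (λ c → c , ≡.refl)

-- Vectors and the adjacency matrix in terms of labels

module LabelledVectors (ℝ : Reals) {Γ : Graph 18} (pappus : IsPappus Γ) {x : Fin 18}
                       (labelling : Labelling (Graph._∼_ Γ) (Graph.d Γ) x) where
  open Linear ℝ
  open Labelled (pappusMetric pappus) labelling public
  open Graph Γ using (_∼_; _∼?_)
  open SetoidReasoning setoid

  A : Mat 18
  A = adjacency Γ

  labels : Enumeration (λ _ → ⊤) 18
  labels = record { elem = label ; injective = label-injective ; sound = λ _ → tt
                  ; complete = λ v _ → index v , label-index v }

  sum-label : (f : Fin 18 → ℂ) → sum f ≈ sum (f ∘ label)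
  sum-label f = sum-Enumeration (λ _ → yes tt) labels f (λ j ¬⊤ → contradiction tt ¬⊤)

  neighborhood : ∀ i → Enumeration (label i ∼_) 3
  neighborhood i = record
    { elem = label ∘ neighbor i ; injective = λ {j} {k} eq → neighbor-injective i j k (label-injective eq)
    ; sound = edge i ; complete = λ v → edge-complete }

  A-label : ∀ v i → (A · v) (label i) ≈ sum (λ k → v (label (neighbor i k)))
  A-label v i = begin
    sum (λ z → A (label i , z) * v z)
      ≈⟨ sum-Enumeration (label i ∼?_) (neighborhood i) (λ z → A (label i , z) * v z)
           (λ z ≁ → trans (*-congʳ {v z} (reflexive (≡.cong (if_then 1ℂ else 0ℂ) (dec-false (label i ∼? z) ≁)))) (zeroˡ (v z))) ⟩
    sum (λ k → A (label i , label (neighbor i k)) * v (label (neighbor i k)))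
      ≈⟨ sum-cong (λ k → trans (*-congʳ {v (label (neighbor i k))}
           (reflexive (≡.cong (if_then 1ℂ else 0ℂ) (dec-true (label i ∼? label (neighbor i k)) (edge i k)))))
           (*-identityˡ (v (label (neighbor i k))))) ⟩
    sum (λ k → v (label (neighbor i k))) ∎

  A-symmetric : ∀ y z → A (y , z) ≡ A (z , y)
  A-symmetric y z = ≡.cong (if_then 1ℂ else 0ℂ) (does-⇔ (mk⇔ (Graph.sym Γ) (Graph.sym Γ)) (y ∼? z) (z ∼? y))

  by-label : {P : Fin 18 → Set} → (∀ i → P (label i)) → ∀ v → P v
  by-label {P} p v = ≡.subst P (label-index v) (p (index v))

-- The spectrum of the adjacency matrix

module Spectrum (ℝ : Reals) (√3 : Reals.Carrier ℝ) (√3-sqrt : Reals.IsSqrt ℝ √3 (+ 3))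
                {Γ : Graph 18} (pappus : IsPappus Γ) {x : Fin 18}
                (labelling : Labelling (Graph._∼_ Γ) (Graph.d Γ) x) where
  open Linear ℝ
  open Diagonal ℝ
  open Sqrt3 ℝ √3 (proj₂ √3-sqrt)
  open Eigen ℝ √3 √3-sqrt
  open LabelledVectors ℝ pappus labelling
  open SetoidReasoning setoid

  P Q : Fin 18 → ℂ^ (Fin 18)
  P j y = eval (eigenvector j (index y))
  Q j y = eval (coeigenvector j (index y))

  P-right : ∀ j → A · P j ≋ eigenvalueℂ (spectralClass j) ⊛ P j
  P-right j = by-label λ i → begin
    (A · P j) (label i)  ≈⟨ A-label (P j) i ⟩
    sum (λ k → eval (eigenvector j (index (label (neighbor i k)))))
      ≈⟨ sum-cong (λ k → reflexive (≡.cong (λ l → eval (eigenvector j l)) (index-label (neighbor i k)))) ⟩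
    sum (λ k → eval (eigenvector j (neighbor i k)))  ≈⟨ eval-sum (λ k → eigenvector j (neighbor i k)) ⟨
    eval (sum√ λ k → eigenvector j (neighbor i k))  ≡⟨ ≡.cong eval (eigenvector-right j i) ⟩
    eval (eigenvalue (spectralClass j) *√ eigenvector j i)  ≈⟨ scaled (spectralClass j) (eigenvector j i) ⟩
    eigenvalueℂ (spectralClass j) * eval (eigenvector j i)
      ≡⟨ ≡.cong (λ l → eigenvalueℂ (spectralClass j) * eval (eigenvector j l)) (index-label i) ⟨
    eigenvalueℂ (spectralClass j) * P j (label i)  ∎

  Q≋P : ∀ j → Q j ≋ eval (eigenweight j , + 0) ⊛ P j
  Q≋P j y = eval-* (eigenweight j , + 0) (eigenvector j (index y))

  Q-right : ∀ j → A · Q j ≋ eigenvalueℂ (spectralClass j) ⊛ Q j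
  Q-right j y = begin
    (A · Q j) y  ≈⟨ ·-congʳ A (Q≋P j) y ⟩
    (A · (w ⊛ P j)) y  ≈⟨ ·-⊛ A w (P j) y ⟩
    w * (A · P j) y  ≈⟨ *-congˡ {w} (P-right j y) ⟩
    w * (t * P j y)  ≈⟨ x∙yz≈y∙xz w t (P j y) ⟩
    t * (w * P j y)  ≈⟨ *-congˡ {t} (Q≋P j y) ⟨
    t * Q j y  ∎
    where
    w t : ℂ
    w = eval (eigenweight j , + 0)
    t = eigenvalueℂ (spectralClass j)

  unlabel : (f : Fin 18 → ℂ) → sum (f ∘ index) ≈ sum f
  unlabel f = trans (sum-label (f ∘ index)) (sum-cong (λ i → reflexive (≡.cong f (index-label i))))

  diagonal : Diagonalisation A eigenvalueℂ spectralClass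
  diagonal = record
    { P = P ; Q = Q ; N = fromℤ (+ 72) ; N#0 = fromℤ#0 {+ 72} λ ()
    ; right = P-right
    ; left = λ j → left-entries A (Q j) (eigenvalueℂ (spectralClass j)) λ k → trans
        (sum-cong (λ i → trans (*-comm (Q j i) (A (i , k))) (*-congʳ {Q j i} (reflexive (A-symmetric i k)))))
        (Q-right j k)
    ; dual = λ j k → trans (unlabel (λ i → eval (coeigenvector j i) * eval (eigenvector k i)))
        (trans (eval-dot (coeigenvector j) (eigenvector k))
          (trans (reflexive (≡.cong eval (eigenvector-dual j k))) (eval-δ (+ 72) j k)))
    ; expand = λ y z → trans (eval-dot (λ j → eigenvector j (index y)) (λ j → coeigenvector j (index z)))
        (trans (reflexive (≡.cong eval (eigenvector-expand (index y) (index z))))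
          (trans (eval-δ (+ 72) (index y) (index z))
            (*-congˡ {fromℤ (+ 72)} (reflexive (𝟏-injective index-injective y z)))))
    }

  eigenspaceDim : ∀ c → HasDim (Eigenspace A (eigenvalueℂ c)) (spectralMultiplicity c)
  eigenspaceDim c = Diagonalisation.eigenspace diagonal eigenvalueℂ-apart (spectralEnumeration c)

  hasSpectrum : HasSpectrum (adjacency Γ)
    ( (fromℤ (+ 3) , 1) List.∷ (real √3 , 6) List.∷ (fromℤ (+ 0) , 4)
    List.∷ (real (Reals.-_ ℝ √3) , 6) List.∷ (fromℤ -[1+ 2 ] , 1) List.∷ List.[] )
  hasSpectrum = Diagonalisation.hasEigenvalues diagonal spectral-hit
              , eigenspaceDim 0F ∷ eigenspaceDim 1F ∷ eigenspaceDim 2F ∷ eigenspaceDim 3F ∷ eigenspaceDim 4F ∷ []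

-- Words in the generators of the Terwilliger algebra and their action on the
-- five types of modules

infixr 7 _⊙_
infixr 6 _⊞_
infixr 8 _⊠_

data Word : Set where
  𝐀   : Word
  𝐄   : Fin 5 → Word
  _⊙_ : Word → Word → Word
  _⊞_ : Word → Word → Word
  _⊠_ : ℤ → Word → Word

fromEntries : ∀ {n} → (Fin n → Fin n → ℤ) → Vec (Vec ℤ n) n
fromEntries f = Vec.tabulate (Vec.tabulate ∘ f)

entry-fromEntries : ∀ {n} (f : Fin n → Fin n → ℤ) i j → entry (fromEntries f) i j ≡ f i j
entry-fromEntries f i j = ≡.trans (≡.cong (λ r → lookup r j) (lookup∘tabulate (Vec.tabulate ∘ f) i))
                                  (lookup∘tabulate (f i) j)

levelProjection : Fin 5 → ∀ τ → Fin (dim τ) → Fin (dim τ) → ℤ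
levelProjection h τ i j =
  if does (i Fin.≟ j) then (if does (endpointOf τ ℕ.+ toℕ j ℕ.≟ toℕ h) then + 1 else + 0) else + 0

-- Operands are passed to functions, so that evaluation shares their entries.
productℤ sumMatrixℤ : ∀ {n} → Vec (Vec ℤ n) n → Vec (Vec ℤ n) n → Vec (Vec ℤ n) n
productℤ M N   = fromEntries λ i j → sumℤ λ k → entry M i k ℤ.* entry N k j
sumMatrixℤ M N = fromEntries λ i j → entry M i j ℤ.+ entry N i j

multipleℤ : ∀ {n} → ℤ → Vec (Vec ℤ n) n → Vec (Vec ℤ n) n
multipleℤ c M = fromEntries λ i j → c ℤ.* entry M i j

action : Word → ∀ τ → Vec (Vec ℤ (dim τ)) (dim τ)
action 𝐀       τ = actionOf τ
action (𝐄 h)   τ = fromEntries (levelProjection h τ)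
action (w ⊙ u) τ = productℤ (action w τ) (action u τ)
action (w ⊞ u) τ = sumMatrixℤ (action w τ) (action u τ)
action (c ⊠ w) τ = multipleℤ c (action w τ)

path : List.List (Fin 5) → Word
-- A default that never arises: every list passed to `path` is nonempty.
path List.[]            = 𝐄 0F
path (h List.∷ List.[]) = 𝐄 h
path (h List.∷ hs)      = 𝐄 h ⊙ 𝐀 ⊙ path hs

-- Words are read from right to left: route g h leads from level g to level h.
route : Fin 5 → Fin 5 → Word
route g h = path (if does (g ≤? h) then List.reverse (interval g h) else interval h g)
  where
  interval : Fin 5 → Fin 5 → List.List (Fin 5)
  interval g h = List.filter (λ l → (g ≤? l) ×-dec (l ≤? h)) (List.allFin 5)

-- On the level isolationLevel τ, isolate τ acts on modules of type τ as a
-- nonzero scalar, and it kills the other types: E₂* A E₃* A E₂* has on level 2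
-- the eigenvalues 4, 1, 0, 3 for the types I, II, III, IV, and
-- E₄* A E₃* A E₂* A E₃* A E₄* has on level 4 the eigenvalues 12, 0 for the types I, V.
isolationLevel : Kind → Fin 5
isolationLevel I   = 0F
isolationLevel II  = 1F
isolationLevel III = 2F
isolationLevel IV  = 2F
isolationLevel V   = 4F

isolate : Kind → Word
isolate I   = 𝐄 0F
isolate II  = (+ 3) ⊠ 𝐄 1F ⊞ -1ℤ ⊠ path (1F List.∷ 0F List.∷ 1F List.∷ List.[])
isolate III = (y ⊞ -1ℤ ⊠ 𝐄 2F) ⊙ (y ⊞ -3ℤ ⊠ 𝐄 2F) ⊙ (y ⊞ -[1+ 3 ] ⊠ 𝐄 2F)
  where
  y : Word
  y = path (2F List.∷ 3F List.∷ 2F List.∷ List.[])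
isolate IV  = y ⊙ (y ⊞ -1ℤ ⊠ 𝐄 2F) ⊙ (y ⊞ -[1+ 3 ] ⊠ 𝐄 2F)
  where
  y : Word
  y = path (2F List.∷ 3F List.∷ 2F List.∷ List.[])
isolate V   = (+ 12) ⊠ 𝐄 4F ⊞ -1ℤ ⊠ path (4F List.∷ 3F List.∷ 2F List.∷ 3F List.∷ 4F List.∷ List.[])

levelOf : ∀ τ → Fin (dim τ) → Fin 5
levelOf I   i = i
levelOf II  i = suc (i Fin.↑ˡ 1)
levelOf III i = 2F
levelOf IV  i = 2 Fin.↑ʳ (i Fin.↑ˡ 1)
levelOf V   i = 3 Fin.↑ʳ i

-- Modules have at most one dimension on each level, and A carries each level to the neighbouring
-- ones with nonzero entries. Moving from the level of j to the isolation level, isolating the type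
-- there and moving on to the level of i gives a multiple of the matrix unit (i, j).
unitWord : ∀ τ → Fin (dim τ) → Fin (dim τ) → Word
unitWord τ i j = route (isolationLevel τ) (levelOf τ i) ⊙ isolate τ ⊙ route (levelOf τ j) (isolationLevel τ)

Unit : Set
Unit = Σ Kind λ τ → Fin (dim τ) × Fin (dim τ)

-- 43 = 25 + 9 + 1 + 4 + 4: the matrix units of the five types occupy consecutive blocks starting at
-- 0, 25, 34, 35 and 39.
encode : ∀ τ → Fin (dim τ) → Fin (dim τ) → Fin 43
encode I   i j = Fin.combine i j Fin.↑ˡ 18
encode II  i j = 25 Fin.↑ʳ (Fin.combine i j Fin.↑ˡ 9)
encode III i j = 34 Fin.↑ʳ (Fin.combine i j Fin.↑ˡ 8)
encode IV  i j = 35 Fin.↑ʳ (Fin.combine i j Fin.↑ˡ 4)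
encode V   i j = 39 Fin.↑ʳ Fin.combine i j

decode : Fin 43 → Unit
decode = [ (λ m → I , Fin.remQuot 5 m) , [ (λ m → II , Fin.remQuot 3 m) , [ (λ m → III , Fin.remQuot 1 m)
       , [ (λ m → IV , Fin.remQuot 2 m) , (λ m → V , Fin.remQuot 2 m) ]′ ∘ Fin.splitAt 4 ]′ ∘ Fin.splitAt 1 ]′
       ∘ Fin.splitAt 9 ]′ ∘ Fin.splitAt 25

_≟ᵤ_ : (u v : Unit) → Dec (u ≡ v)
_≟ᵤ_ = Product.≡-dec _≟ₖ_ (Product.≡-dec Fin._≟_ Fin._≟_)

abstract
  decode-encode : ∀ τ i j → decode (encode τ i j) ≡ (τ , i , j)
  decode-encode = from-yes (all-kinds? λ τ → Fin.all? λ i → Fin.all? λ j → decode (encode τ i j) ≟ᵤ (τ , i , j))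

  encode-decode : ∀ m → encode (proj₁ (decode m)) (proj₁ (proj₂ (decode m))) (proj₂ (proj₂ (decode m))) ≡ m
  encode-decode = from-yes (Fin.all? λ m →
    encode (proj₁ (decode m)) (proj₁ (proj₂ (decode m))) (proj₂ (proj₂ (decode m))) Fin.≟ m)

word : Fin 43 → Word
word m = unitWord (proj₁ (decode m)) (proj₁ (proj₂ (decode m))) (proj₂ (proj₂ (decode m)))

unitScale : Fin 43 → ℤ
unitScale m = entry (action (word m) (proj₁ (decode m))) (proj₁ (proj₂ (decode m))) (proj₂ (proj₂ (decode m)))

abstract
  unitScale≢0 : ∀ m → unitScale m ≢ + 0
  unitScale≢0 = from-yes (Fin.all? λ m → ¬? (unitScale m ℤ.≟ + 0))

unitMatrix : ∀ m τ → Vec (Vec ℤ (dim τ)) (dim τ)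
unitMatrix m τ = fromEntries λ i j → if does (encode τ i j Fin.≟ m) then unitScale m else + 0

abstract
  -- With `unitScale≢0` this says that the algebra generated by A and the projections contains, up
  -- to nonzero factors, all matrix units of the direct sum of the five matrix algebras.
  word-action : ∀ m τ → action (word m) τ ≡ unitMatrix m τ
  word-action = from-yes (Fin.all? λ m → all-kinds? λ τ →
    VecProperties.≡-dec (VecProperties.≡-dec ℤ._≟_) (action (word m) τ) (unitMatrix m τ))

-- The modules spanned by an orthogonal basis of block vectors

module Modules (ℝ : Reals) (Γ : Graph 18) (x : Fin 18) where
  open Linear ℝ
  open Diagonal ℝ using (*-cancelʳ)
  open Terwilliger ℝ Γ 4 x renaming (V to ℂˣ)
  open SetoidReasoning setoid

  *-cancelˡ : ∀ {a b x} → x # 0ℂ → x * a ≈ x * b → a ≈ b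
  *-cancelˡ {a} {b} {x} x#0 xa≈xb = *-cancelʳ {a} {b} {x} x#0 (trans (*-comm a x) (trans xa≈xb (*-comm x b)))

  fromℤ-if : ∀ b c → fromℤ (if b then c else + 0) ≈ (if b then 1ℂ else 0ℂ) * fromℤ c
  fromℤ-if true  c = sym (*-identityˡ (fromℤ c))
  fromℤ-if false c = sym (zeroˡ (fromℤ c))

  fromℤ-sum : ∀ {n} (f : Fin n → ℤ) → fromℤ (sumℤ f) ≈ sum (fromℤ ∘ f)
  fromℤ-sum {zero}  f = refl
  fromℤ-sum {suc n} f = trans (fromℤ-+ (f zero) (sumℤ (f ∘ suc))) (+-congˡ {fromℤ (f zero)} (fromℤ-sum (f ∘ suc)))

  ⟦_⟧ : Word → Mat 18
  ⟦ 𝐀 ⟧     = A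
  ⟦ 𝐄 h ⟧   = E* (toℕ h)
  ⟦ w ⊙ u ⟧ = ⟦ w ⟧ ⊗ ⟦ u ⟧
  ⟦ w ⊞ u ⟧ = ⟦ w ⟧ ⊕ ⟦ u ⟧
  ⟦ c ⊠ w ⟧ = fromℤ c ⊛ ⟦ w ⟧

  ⟦_⟧∈T : ∀ w → T ⟦ w ⟧
  ⟦ 𝐀 ⟧∈T     = A∈T
  ⟦ 𝐄 h ⟧∈T   = E*∈T (toℕ h) (ℕ.s≤s⁻¹ (Fin.toℕ<n h))
  ⟦ w ⊙ u ⟧∈T = ⊗-closed ⟦ w ⟧∈T ⟦ u ⟧∈T
  ⟦ w ⊞ u ⟧∈T = ⊕-closed ⟦ w ⟧∈T ⟦ u ⟧∈T
  ⟦ c ⊠ w ⟧∈T = ⊛-closed (fromℤ c) ⟦ w ⟧∈T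

  lincomb-· : ∀ {k} (c : Fin k → ℂ) (F : Fin k → Mat 18) v → lincomb c F · v ≋ lincomb c (λ m → F m · v)
  lincomb-· c F v i = begin
    sum (λ z → sum (λ m → c m * F m (i , z)) * v z)  ≈⟨ sum-cong (λ z → *-distribʳ-sum (v z) (λ m → c m * F m (i , z))) ⟩
    sum (λ z → sum λ m → c m * F m (i , z) * v z)  ≈⟨ ∑-comm (λ z m → c m * F m (i , z) * v z) ⟩
    sum (λ m → sum λ z → c m * F m (i , z) * v z)  ≈⟨ sum-cong (λ m → sum-cong λ z → *-assoc (c m) (F m (i , z)) (v z)) ⟩
    sum (λ m → sum λ z → c m * (F m (i , z) * v z))  ≈⟨ sum-cong (λ m → *-distribˡ-sum (c m) (λ z → F m (i , z) * v z)) ⟨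
    sum (λ m → c m * (F m · v) i)  ∎

  lincomb-nested : ∀ {I : Set} {k l} (c : Fin k → ℂ) (X : Fin k → Fin l → ℂ) (v : Fin l → ℂ^ I) →
                   lincomb c (λ m → lincomb (X m) v) ≋ lincomb (λ i → sum λ m → c m * X m i) v
  lincomb-nested c X v y = begin
    sum (λ m → c m * sum (λ i → X m i * v i y))  ≈⟨ sum-cong (λ m → *-distribˡ-sum (c m) (λ i → X m i * v i y)) ⟩
    sum (λ m → sum λ i → c m * (X m i * v i y))  ≈⟨ ∑-comm (λ m i → c m * (X m i * v i y)) ⟩
    sum (λ i → sum λ m → c m * (X m i * v i y))  ≈⟨ sum-cong (λ i → sum-cong λ m → *-assoc (c m) (X m i) (v i y)) ⟨
    sum (λ i → sum λ m → c m * X m i * v i y)  ≈⟨ sum-cong (λ i → *-distribʳ-sum (v i y) (λ m → c m * X m i)) ⟨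
    sum (λ i → sum (λ m → c m * X m i) * v i y)  ∎

  lincomb-represents : ∀ {k l} (c : Fin k → ℂ) (F : Fin k → Mat 18) (X : Fin k → Mat l) (v : Fin l → ℂˣ) →
                       (∀ m → Represents (F m) (X m) v) →
                       Represents (lincomb c F) (λ ij → sum λ m → c m * X m ij) v
  lincomb-represents c F X v r j = ≋-trans (lincomb-· c F (v j))
    (≋-trans (lincomb-congʳ c (λ m → r m j)) (lincomb-nested c (λ m i → X m (i , j)) v))

  subspace-lincomb : {U : Pred ℂˣ 0ℓ} → IsSubspace U → ∀ {k} (c : Fin k → ℂ) (v : Fin k → ℂˣ) →
                     (∀ j → U (v j)) → U (lincomb c v)
  subspace-lincomb U {zero}  c v Uv = IsSubspace.resp U (λ i → refl) (IsSubspace.zero∈ U)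
  subspace-lincomb U {suc k} c v Uv = IsSubspace.resp U (λ i → refl)
    (IsSubspace.⊕-closed U (IsSubspace.⊛-closed U (c zero) (Uv zero))
                           (subspace-lincomb U (c ∘ suc) (v ∘ suc) (Uv ∘ suc)))

  -- The only facts about the graph that the representation theory below uses. The field
  -- `resolution` is the completeness relation, by which the basis spans V.
  record Model : Set where
    field
      bas          : ∀ s → Fin (dim (kind s)) → ℂˣ
      A-represents : ∀ s → Represents A (fromRows (actionOf (kind s))) (bas s)
      on-level     : ∀ s j → E* (endpointOf (kind s) ℕ.+ toℕ j) · bas s j ≋ bas s j
      off-level    : ∀ h s j → endpointOf (kind s) ℕ.+ toℕ j ≢ h → E* h · bas s j ≋ 𝟎
      bas-real     : ∀ s j y → conj (bas s j y) ≈ bas s j y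
      orthogonal   : ∀ s t → s ≢ t → ∀ j k → bas s j ∙ bas t k ≈ 0ℂ
      gram         : ∀ s j k → fromℤ (weight s j) * (bas s j ∙ bas s k) ≈ fromℤ (+ 36) * 𝟏 (j , k)
      resolution   : ∀ y z → sum (λ s → sum λ j → fromℤ (weight s j) * (bas s j y * bas s j z))
                           ≈ fromℤ (+ 36) * 𝟏 (y , z)

  module FromModel (model : Model) where
    open Model model

    W : Fin 7 → Pred ℂˣ 0ℓ
    W s u = ∃[ c ] u ≋ lincomb c (bas s)

    36# : fromℤ (+ 36) # 0ℂ
    36# = fromℤ#0 {+ 36} λ ()

    -- Orthogonality recovers coordinates by pairing with basis vectors, so they are unique.
    coordinate : ∀ s c j → fromℤ (weight s j) * (bas s j ∙ lincomb c (bas s)) ≈ fromℤ (+ 36) * c j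
    coordinate s c j = begin
      w * (bas s j ∙ lincomb c (bas s))  ≈⟨ *-congˡ {w} (∙-lincomb (bas s j) c (bas s)) ⟩
      w * sum (λ l → c l * (bas s j ∙ bas s l))  ≈⟨ *-distribˡ-sum w (λ l → c l * (bas s j ∙ bas s l)) ⟩
      sum (λ l → w * (c l * (bas s j ∙ bas s l)))  ≈⟨ sum-cong (λ l → x∙yz≈y∙xz w (c l) (bas s j ∙ bas s l)) ⟩
      sum (λ l → c l * (w * (bas s j ∙ bas s l)))  ≈⟨ sum-cong (λ l → *-congˡ {c l} (gram s j l)) ⟩
      sum (λ l → c l * (N * 𝟏 (j , l)))  ≈⟨ sum-cong (λ l → *-assoc (c l) N (𝟏 (j , l))) ⟨
      sum (λ l → c l * N * 𝟏 (j , l))  ≈⟨ sum-cong (λ l → *-comm (c l * N) (𝟏 (j , l))) ⟩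
      sum (λ l → 𝟏 (j , l) * (c l * N))  ≈⟨ sum-δ j (λ l → c l * N) ⟩
      c j * N  ≈⟨ *-comm (c j) N ⟩
      N * c j  ∎
      where
      w N : ℂ
      w = fromℤ (weight s j)
      N = fromℤ (+ 36)

    unique-coordinates : ∀ s {c c′} → lincomb c (bas s) ≋ lincomb c′ (bas s) → ∀ j → c j ≈ c′ j
    unique-coordinates s {c} {c′} eq j = *-cancelˡ {c j} {c′ j} 36# (begin
      fromℤ (+ 36) * c j  ≈⟨ coordinate s c j ⟨
      fromℤ (weight s j) * (bas s j ∙ lincomb c (bas s))  ≈⟨ *-congˡ {fromℤ (weight s j)} (∙-congʳ (bas s j) eq) ⟩
      fromℤ (weight s j) * (bas s j ∙ lincomb c′ (bas s))  ≈⟨ coordinate s c′ j ⟩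
      fromℤ (+ 36) * c′ j  ∎)

    independent : ∀ s c → lincomb c (bas s) ≋ 𝟎 → ∀ j → c j ≈ 0ℂ
    independent s c c≋0 = unique-coordinates s {c} {λ _ → 0ℂ}
      (≋-trans c≋0 (≋-sym (lincomb-0 (bas s) (λ _ → refl))))

    bas-nonzero : ∀ s j → Nonzero (bas s j)
    bas-nonzero s j =
      let norm#0 = *#0⇒#0ʳ {fromℤ (weight s j)} {bas s j ∙ bas s j} (#-congʳ {fromℤ (+ 36)}
            (sym (trans (gram s j j) (trans (*-congˡ {fromℤ (+ 36)} (reflexive (𝟏-refl j))) (*-identityʳ (fromℤ (+ 36)))))) 36#)
          i , b²#0 = sum#0⇒#0 (λ i → bas s j i * bas s j i) norm#0
      in i , *#0⇒#0ʳ {bas s j i} {bas s j i} b²#0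

    bas∈W : ∀ s j → W s (bas s j)
    bas∈W s j = unit j , ≋-sym (lincomb-unit (bas s) j)

    W-subspace : ∀ s → IsSubspace (W s)
    W-subspace s = record
      { resp     = λ u≋v (c , u≋c) → c , ≋-trans (≋-sym u≋v) u≋c
      ; zero∈    = (λ _ → 0ℂ) , ≋-sym (lincomb-0 (bas s) (λ _ → refl))
      ; ⊕-closed = λ (c , u≋c) (c′ , v≋c′) →
          c ⊕ c′ , ≋-trans (λ i → +-cong (u≋c i) (v≋c′ i)) (lincomb-⊕ c c′ (bas s))
      ; ⊛-closed = λ a (c , v≋c) → a ⊛ c , ≋-trans (λ i → *-congˡ {a} (v≋c i)) (lincomb-⊛ a c (bas s))
      }

    W-basis : ∀ s → IsBasis (W s) (bas s)
    W-basis s = record { member = bas∈W s ; independent = independent s ; spanning = id }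

    E-represents : ∀ h s → Represents (E* (toℕ h)) (fromRows (fromEntries (levelProjection h (kind s)))) (bas s)
    E-represents h s j = cases (endpointOf (kind s) ℕ.+ toℕ j ℕ.≟ toℕ h)
      where
      M : Fin (dim (kind s)) → ℂ
      M i = fromℤ (entry (fromEntries (levelProjection h (kind s))) i j)
      M≈ : ∀ {b} → does (endpointOf (kind s) ℕ.+ toℕ j ℕ.≟ toℕ h) ≡ b → ∀ i →
           M i ≈ 𝟏 (i , j) * fromℤ (if b then + 1 else + 0)
      M≈ {b} eq i = trans
        (reflexive (≡.cong fromℤ (≡.trans (entry-fromEntries (levelProjection h (kind s)) i j)
          (≡.cong (λ b → if does (i Fin.≟ j) then (if b then + 1 else + 0) else + 0) eq))))
        (fromℤ-if (does (i Fin.≟ j)) (if b then + 1 else + 0))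
      cases : Dec (endpointOf (kind s) ℕ.+ toℕ j ≡ toℕ h) → E* (toℕ h) · bas s j ≋ lincomb M (bas s)
      cases (yes at-h) = ≋-trans
        (≡.subst (λ h → E* h · bas s j ≋ bas s j) at-h (on-level s j))
        (≋-sym (≋-trans (lincomb-congˡ (bas s) (λ i → trans (M≈ (dec-true (_ ℕ.≟ _) at-h) i)
            (trans (*-congˡ {𝟏 (i , j)} fromℤ-1) (trans (*-identityʳ (𝟏 (i , j))) (reflexive (𝟏-sym i j))))))
          (lincomb-unit (bas s) j)))
      cases (no ¬at-h) = ≋-trans (off-level (toℕ h) s j ¬at-h)
        (≋-sym (lincomb-0 (bas s) (λ i → trans (M≈ (dec-false (_ ℕ.≟ _) ¬at-h) i) (zeroʳ (𝟏 (i , j))))))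

    word-represents : ∀ w s → Represents ⟦ w ⟧ (fromRows (action w (kind s))) (bas s)
    word-represents 𝐀       s = A-represents s
    word-represents (𝐄 h)   s = E-represents h s
    word-represents (w ⊙ u) s = Represents-cong {v = bas s} {⟦ w ⊙ u ⟧} {⟦ w ⊙ u ⟧}
      {fromRows X ⊗ fromRows Y} {fromRows (productℤ X Y)} (λ _ → refl)
      (λ (i , j) → sym (trans (reflexive (≡.cong fromℤ (entry-fromEntries (λ i j → sumℤ λ k → entry X i k ℤ.* entry Y k j) i j)))
        (trans (fromℤ-sum (λ k → entry X i k ℤ.* entry Y k j)) (sum-cong (λ k → fromℤ-* (entry X i k) (entry Y k j))))))
      (Represents-⊗ {v = bas s} {⟦ w ⟧} {⟦ u ⟧} {fromRows X} {fromRows Y} (word-represents w s) (word-represents u s))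
      where
      X Y : Vec (Vec ℤ (dim (kind s))) (dim (kind s))
      X = action w (kind s)
      Y = action u (kind s)
    word-represents (w ⊞ u) s = Represents-cong {v = bas s} {⟦ w ⊞ u ⟧} {⟦ w ⊞ u ⟧}
      {fromRows X ⊕ fromRows Y} {fromRows (sumMatrixℤ X Y)} (λ _ → refl)
      (λ (i , j) → sym (trans (reflexive (≡.cong fromℤ (entry-fromEntries (λ i j → entry X i j ℤ.+ entry Y i j) i j)))
        (fromℤ-+ (entry X i j) (entry Y i j))))
      (Represents-⊕ {v = bas s} {⟦ w ⟧} {⟦ u ⟧} {fromRows X} {fromRows Y} (word-represents w s) (word-represents u s))
      where
      X Y : Vec (Vec ℤ (dim (kind s))) (dim (kind s))
      X = action w (kind s)
      Y = action u (kind s)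
    word-represents (c ⊠ w) s = Represents-cong {v = bas s} {⟦ c ⊠ w ⟧} {⟦ c ⊠ w ⟧}
      {fromℤ c ⊛ fromRows X} {fromRows (multipleℤ c X)} (λ _ → refl)
      (λ (i , j) → sym (trans (reflexive (≡.cong fromℤ (entry-fromEntries (λ i j → c ℤ.* entry X i j) i j)))
        (fromℤ-* c (entry X i j))))
      (Represents-⊛ {v = bas s} (fromℤ c) {⟦ w ⟧} {fromRows X} (word-represents w s))
      where
      X : Vec (Vec ℤ (dim (kind s))) (dim (kind s))
      X = action w (kind s)

    level-represents : ∀ {i} (h : Fin 5) → toℕ h ≡ i → ∀ s →
                       Represents (E* i) (fromRows (fromEntries (levelProjection h (kind s)))) (bas s)
    level-represents h ≡.refl = E-represents h

    -- One matrix for each type and not for each summand: summands of the same kind share it, hence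
    -- are isomorphic, and T embeds into a sum of five matrix algebras.
    Actions : Set
    Actions = ∀ τ → Mat (dim τ)

    RepresentsAll : Mat 18 → Actions → Set
    RepresentsAll B C = ∀ s → Represents B (C (kind s)) (bas s)

    algebra-represents : ∀ {B} → T B → Σ Actions (RepresentsAll B)
    algebra-represents A∈T = (λ τ → fromRows (actionOf τ)) , A-represents
    algebra-represents (E*∈T i i≤4) = (λ τ → fromRows (fromEntries (levelProjection (Fin.fromℕ< (s≤s i≤4)) τ)))
      , level-represents (Fin.fromℕ< (s≤s i≤4)) (Fin.toℕ-fromℕ< (s≤s i≤4))
    algebra-represents 𝟏∈T = (λ τ → 𝟏) , λ s → Represents-𝟏 {v = bas s}
    algebra-represents (⊕-closed {B} {C} p q) = plus (algebra-represents p) (algebra-represents q)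
      where
      plus : Σ Actions (RepresentsAll B) → Σ Actions (RepresentsAll C) → Σ Actions (RepresentsAll (B ⊕ C))
      plus (X , r) (Y , r′) = (λ τ → X τ ⊕ Y τ) ,
        λ s → Represents-⊕ {v = bas s} {B} {C} {X (kind s)} {Y (kind s)} (r s) (r′ s)
    algebra-represents (⊛-closed b {B} p) = times (algebra-represents p)
      where
      times : Σ Actions (RepresentsAll B) → Σ Actions (RepresentsAll (b ⊛ B))
      times (X , r) = (λ τ → b ⊛ X τ) , λ s → Represents-⊛ {v = bas s} b {B} {X (kind s)} (r s)
    algebra-represents (⊗-closed {B} {C} p q) = compose (algebra-represents p) (algebra-represents q)
      where
      compose : Σ Actions (RepresentsAll B) → Σ Actions (RepresentsAll C) → Σ Actions (RepresentsAll (B ⊗ C))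
      compose (X , r) (Y , r′) = (λ τ → X τ ⊗ Y τ) ,
        λ s → Represents-⊗ {v = bas s} {B} {C} {X (kind s)} {Y (kind s)} (r s) (r′ s)
    algebra-represents (resp {B} {C} B≋C p) = respect (algebra-represents p)
      where
      respect : Σ Actions (RepresentsAll B) → Σ Actions (RepresentsAll C)
      respect (X , r) = X , λ s → Represents-cong {v = bas s} {B} {C} {X (kind s)} {X (kind s)} B≋C (λ _ → refl) (r s)

    W-module : ∀ s → IsTModule (W s)
    W-module s = record
      { isSubspace = W-subspace s
      ; closed = λ {B} {v} TB (c , v≋c) →
          let C , r = algebra-represents TB
          in C (kind s) · c , ≋-trans (·-congʳ B v≋c) (Represents-· {v = bas s} {B} {C (kind s)} (r s) c)
      }

    -- Sealed, as the words and the integers computed from them are large.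
    abstract
      F : Fin 43 → Mat 18
      F m = ⟦ word m ⟧

      F∈T : ∀ m → T (F m)
      F∈T m = ⟦ word m ⟧∈T

      scaleOf : Fin 43 → ℂ
      scaleOf m = fromℤ (unitScale m)

      scaleOf# : ∀ m → scaleOf m # 0ℂ
      scaleOf# m = fromℤ#0 {unitScale m} (unitScale≢0 m)

      F-entry : ∀ m τ i j → fromRows (action (word m) τ) (i , j) ≈ 𝟏 (encode τ i j , m) * scaleOf m
      F-entry m τ i j = trans (reflexive (≡.cong fromℤ (≡.trans (≡.cong (λ M → entry M i j) (word-action m τ))
          (entry-fromEntries (λ i j → if does (encode τ i j Fin.≟ m) then unitScale m else + 0) i j))))
        (fromℤ-if (does (encode τ i j Fin.≟ m)) (unitScale m))

      F-represents : ∀ m s → Represents (F m) (λ (i , j) → 𝟏 (encode (kind s) i j , m) * scaleOf m) (bas s)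
      F-represents m s = Represents-cong {v = bas s} {⟦ word m ⟧} {⟦ word m ⟧} {fromRows (action (word m) (kind s))}
        {λ (i , j) → 𝟏 (encode (kind s) i j , m) * scaleOf m}
        (λ _ → refl) (λ (i , j) → F-entry m (kind s) i j) (word-represents (word m) s)

-- Irreducibility and the orthogonal decomposition

module Decomposition (ℝ : Reals) (Γ : Graph 18) (x : Fin 18) (model : Modules.Model ℝ Γ x) where
  open Linear ℝ
  open Terwilliger ℝ Γ 4 x renaming (V to ℂˣ)
  open Modules ℝ Γ x
  open Model model
  open FromModel model public
  open SetoidReasoning setoid

  encode-injective : ∀ {τ i j υ k l} → encode τ i j ≡ encode υ k l → _≡_ {A = Unit} (τ , i , j) (υ , k , l)
  encode-injective {τ} {i} {j} {υ} {k} {l} eq =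
    ≡.trans (≡.sym (decode-encode τ i j)) (≡.trans (≡.cong decode eq) (decode-encode υ k l))

  indices-injective : ∀ {τ} {p q : Fin (dim τ) × Fin (dim τ)} → _≡_ {A = Unit} (τ , p) (τ , q) → p ≡ q
  indices-injective ≡.refl = ≡.refl

  encode-δ : ∀ τ i j k l → 𝟏 (encode τ i j , encode τ k l) ≈ 𝟏 (i , k) * 𝟏 (l , j)
  encode-δ τ i j k l = cases (i Fin.≟ k) (l Fin.≟ j)
    where
    off : (i , j) ≢ (k , l) → 𝟏 (encode τ i j , encode τ k l) ≈ 0ℂ
    off ij≢kl = reflexive (𝟏-≢ (ij≢kl ∘ indices-injective ∘ encode-injective))
    cases : Dec (i ≡ k) → Dec (l ≡ j) → 𝟏 (encode τ i j , encode τ k l) ≈ 𝟏 (i , k) * 𝟏 (l , j)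
    cases (yes ≡.refl) (yes ≡.refl) = trans (reflexive (𝟏-refl (encode τ i j)))
      (sym (trans (*-cong (reflexive (𝟏-refl i)) (reflexive (𝟏-refl j))) (*-identityˡ 1ℂ)))
    cases (no i≢k) _ = trans (off (i≢k ∘ ≡.cong proj₁))
      (sym (trans (*-congʳ {𝟏 (l , j)} (reflexive (𝟏-≢ i≢k))) (zeroˡ (𝟏 (l , j)))))
    cases (yes _) (no l≢j) = trans (off (l≢j ∘ ≡.sym ∘ ≡.cong proj₂))
      (sym (trans (*-congˡ {𝟏 (i , k)} (reflexive (𝟏-≢ l≢j))) (zeroʳ (𝟏 (i , k)))))

  F-lincomb : ∀ m s c → F m · lincomb c (bas s)
            ≋ lincomb (λ i → sum λ j → 𝟏 (encode (kind s) i j , m) * scaleOf m * c j) (bas s)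
  F-lincomb m s c = Represents-· {v = bas s} {F m} {λ (i , j) → 𝟏 (encode (kind s) i j , m) * scaleOf m} (F-represents m s) c

  unit-action : ∀ s k l c → let m = encode (kind s) k l in
                F m · lincomb c (bas s) ≋ (scaleOf m * c l) ⊛ bas s k
  unit-action s k l c = ≋-trans (F-lincomb m s c) λ y → begin
    sum (λ i → sum (λ j → 𝟏 (encode τ i j , m) * S * c j) * bas s i y)  ≈⟨ sum-cong (λ i → *-congʳ {bas s i y} (inner i)) ⟩
    sum (λ i → 𝟏 (i , k) * (S * c l) * bas s i y)  ≈⟨ sum-cong (λ i → *-assoc (𝟏 (i , k)) (S * c l) (bas s i y)) ⟩
    sum (λ i → 𝟏 (i , k) * (S * c l * bas s i y))  ≈⟨ sum-cong (λ i → *-congʳ {S * c l * bas s i y} (reflexive (𝟏-sym i k))) ⟩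
    sum (λ i → 𝟏 (k , i) * (S * c l * bas s i y))  ≈⟨ sum-δ k (λ i → S * c l * bas s i y) ⟩
    S * c l * bas s k y  ∎
    where
    τ : Kind
    τ = kind s
    m : Fin 43
    m = encode τ k l
    S : ℂ
    S = scaleOf m
    inner : ∀ i → sum (λ j → 𝟏 (encode τ i j , m) * S * c j) ≈ 𝟏 (i , k) * (S * c l)
    inner i = begin
      sum (λ j → 𝟏 (encode τ i j , m) * S * c j)  ≈⟨ sum-cong (λ j → *-congʳ {c j} (*-congʳ {S} (encode-δ τ i j k l))) ⟩
      sum (λ j → 𝟏 (i , k) * 𝟏 (l , j) * S * c j)  ≈⟨ sum-cong (λ j → *-assoc (𝟏 (i , k) * 𝟏 (l , j)) S (c j)) ⟩
      sum (λ j → 𝟏 (i , k) * 𝟏 (l , j) * (S * c j))  ≈⟨ sum-cong (λ j → *-assoc (𝟏 (i , k)) (𝟏 (l , j)) (S * c j)) ⟩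
      sum (λ j → 𝟏 (i , k) * (𝟏 (l , j) * (S * c j)))  ≈⟨ *-distribˡ-sum (𝟏 (i , k)) (λ j → 𝟏 (l , j) * (S * c j)) ⟨
      𝟏 (i , k) * sum (λ j → 𝟏 (l , j) * (S * c j))  ≈⟨ *-congˡ {𝟏 (i , k)} (sum-δ l (λ j → S * c j)) ⟩
      𝟏 (i , k) * (S * c l)  ∎

  unit-kills : ∀ {τ} s k l c → kind s ≢ τ → F (encode τ k l) · lincomb c (bas s) ≋ 𝟎
  unit-kills {τ} s k l c s≢τ = ≋-trans (F-lincomb m s c) (lincomb-0 (bas s) (λ i → sum-zero λ j →
    trans (*-assoc (𝟏 (encode (kind s) i j , m)) (scaleOf m) (c j))
      (trans (*-congʳ {scaleOf m * c j} (reflexive (𝟏-≢ (s≢τ ∘ ≡.cong proj₁ ∘ encode-injective))))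
        (zeroˡ (scaleOf m * c j)))))
    where
    m : Fin 43
    m = encode τ k l

  ⊛-inverse : ∀ {y z} → y * z ≈ 1ℂ → ∀ (v : ℂˣ) → y ⊛ (z ⊛ v) ≋ v
  ⊛-inverse {y} {z} yz≈1 v i = trans (sym (*-assoc y z (v i))) (trans (*-congʳ {v i} yz≈1) (*-identityˡ (v i)))

  -- A nonzero vector of a submodule has a coordinate `c l` apart from 0. The matrix units (k, l)
  -- then carry it to nonzero multiples of all the basis vectors.
  irreducible : ∀ s → IsIrreducible (W s)
  irreducible s = record
    { isTModule = W-module s
    ; nonzero   = bas s zero , bas∈W s zero , bas-nonzero s zero
    ; minimal   = minimal
    }
    where
    minimal : ∀ (U : Pred ℂˣ 0ℓ) → IsTModule U → NonzeroSpace U → (∀ {v} → U v → W s v) → ∀ {v} → W s v → U v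
    minimal U U-module (u , Uu , u#0) U⊆W (b , v≋b) =
      IsSubspace.resp U-subspace (≋-sym v≋b) (subspace-lincomb U-subspace b (bas s) bas∈U)
      where
      U-subspace : IsSubspace U
      U-subspace = IsTModule.isSubspace U-module
      c : Fin (dim (kind s)) → ℂ
      c = proj₁ (U⊆W Uu)
      u≋c : u ≋ lincomb c (bas s)
      u≋c = proj₂ (U⊆W Uu)
      hit : ∃[ j ] (c j # 0ℂ × Nonzero (bas s j))
      hit = Nonzero-lincomb {c = c} {bas s} (Nonzero-cong u≋c u#0)
      l : Fin (dim (kind s))
      l = proj₁ hit
      z : Fin (dim (kind s)) → ℂ
      z k = scaleOf (encode (kind s) k l) * c l
      z-unit : ∀ k → ∃[ y ] y * z k ≈ 1ℂ
      z-unit k = inverse {z k} (x#0y#0→xy#0 {scaleOf (encode (kind s) k l)} {c l} (scaleOf# (encode (kind s) k l)) (proj₁ (proj₂ hit)))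
      F·u : ∀ k → F (encode (kind s) k l) · u ≋ z k ⊛ bas s k
      F·u k = ≋-trans {v = F (encode (kind s) k l) · lincomb c (bas s)}
        (·-congʳ (F (encode (kind s) k l)) u≋c) (unit-action s k l c)
      z⊛bas∈U : ∀ k → U (z k ⊛ bas s k)
      z⊛bas∈U k = IsSubspace.resp U-subspace (F·u k) (IsTModule.closed U-module (F∈T (encode (kind s) k l)) Uu)
      bas∈U : ∀ k → U (bas s k)
      bas∈U k = IsSubspace.resp U-subspace {y ⊛ (z k ⊛ bas s k)} {bas s k} yz⊛bas
        (IsSubspace.⊛-closed U-subspace y {z k ⊛ bas s k} (z⊛bas∈U k))
        where
        y : ℂ
        y = proj₁ (z-unit k)
        yz≈1 : y * z k ≈ 1ℂ
        yz≈1 = proj₂ (z-unit k)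
        yz⊛bas : y ⊛ (z k ⊛ bas s k) ≋ bas s k
        yz⊛bas = ⊛-inverse {y} {z k} yz≈1 (bas s k)

  ∙-comm : (u v : ℂˣ) → u ∙ v ≈ v ∙ u
  ∙-comm u v = sum-cong (λ i → *-comm (u i) (v i))

  conj-sum : ∀ {n} (f : Fin n → ℂ) → conj (sum f) ≈ sum (conj ∘ f)
  conj-sum {zero}  f = conj-fromℤ (+ 0)
  conj-sum {suc n} f = trans (conj-+ (f zero) (sum (f ∘ suc))) (+-congˡ {conj (f zero)} (conj-sum (f ∘ suc)))

  conj-lincomb : ∀ s c y → conj (lincomb c (bas s) y) ≈ lincomb (conj ∘ c) (bas s) y
  conj-lincomb s c y = trans (conj-sum (λ j → c j * bas s j y))
    (sum-cong (λ j → trans (conj-* (c j) (bas s j y)) (*-congˡ {conj (c j)} (bas-real s j y))))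

  bas∙W : ∀ {s t} → s ≢ t → ∀ j {v} → W t v → bas s j ∙ v ≈ 0ℂ
  bas∙W {s} {t} s≢t j {v} (c , v≋c) = begin
    bas s j ∙ v  ≈⟨ ∙-congʳ (bas s j) v≋c ⟩
    bas s j ∙ lincomb c (bas t)  ≈⟨ ∙-lincomb (bas s j) c (bas t) ⟩
    sum (λ k → c k * (bas s j ∙ bas t k))  ≈⟨ sum-zero (λ k → trans (*-congˡ {c k} (orthogonal s t s≢t j k)) (zeroʳ (c k))) ⟩
    0ℂ  ∎

  -- As the basis vectors are real, conjugating `v` only conjugates its coordinates, which reduces
  -- the claim to the bilinear form.
  W-orthogonal : ∀ s t → s ≢ t → ∀ {u v} → W s u → W t v → ⟨ u , v ⟩ ≈ 0ℂ
  W-orthogonal s t s≢t {u} {v} Wu (c , v≋c) = begin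
    u ∙ (conj ∘ v)  ≈⟨ ∙-congʳ u (λ y → trans (conj-cong (v≋c y)) (conj-lincomb t c y)) ⟩
    u ∙ lincomb (conj ∘ c) (bas t)  ≈⟨ ∙-lincomb u (conj ∘ c) (bas t) ⟩
    sum (λ k → conj (c k) * (u ∙ bas t k))  ≈⟨ sum-zero (λ k → trans (*-congˡ {conj (c k)}
                                                    (trans (∙-comm u (bas t k)) (bas∙W {t} {s} (s≢t ∘ ≡.sym) k Wu))) (zeroʳ (conj (c k)))) ⟩
    0ℂ  ∎

  ∙-∑ : ∀ {k} (u : ℂˣ) (w : Fin k → ℂˣ) → u ∙ ∑ w ≈ sum (λ s → u ∙ w s)
  ∙-∑ u w = trans (sum-cong (λ i → *-distribˡ-sum (u i) (λ s → w s i))) (∑-comm (λ i s → u i * w s i))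

  -- Pairing with a vector of the basis of `W t` annihilates all the other summands, so every
  -- coordinate of `w t` vanishes.
  W-direct : ∀ (w : Fin 7 → ℂˣ) → (∀ s → W s (w s)) → ∑ w ≋ 𝟎 → ∀ s → w s ≋ 𝟎
  W-direct w Ww w≋0 t = ≋-trans wt≋c (lincomb-0 (bas t) vanish)
    where
    c : Fin (dim (kind t)) → ℂ
    c = proj₁ (Ww t)
    wt≋c : w t ≋ lincomb c (bas t)
    wt≋c = proj₂ (Ww t)
    at-t : ∀ j s → bas t j ∙ w s ≈ 𝟏 (t , s) * (bas t j ∙ w s)
    at-t j s = cases (t Fin.≟ s)
      where
      cases : Dec (t ≡ s) → bas t j ∙ w s ≈ 𝟏 (t , s) * (bas t j ∙ w s)
      cases (yes ≡.refl) = sym (trans (*-congʳ {bas t j ∙ w t} (reflexive (𝟏-refl t))) (*-identityˡ (bas t j ∙ w t)))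
      cases (no t≢s) = trans (bas∙W {t} {s} t≢s j (Ww s))
        (sym (trans (*-congʳ {bas t j ∙ w s} (reflexive (𝟏-≢ t≢s))) (zeroˡ (bas t j ∙ w s))))
    bas∙w : ∀ j → bas t j ∙ w t ≈ 0ℂ
    bas∙w j = begin
      bas t j ∙ w t  ≈⟨ sum-δ t (λ s → bas t j ∙ w s) ⟨
      sum (λ s → 𝟏 (t , s) * (bas t j ∙ w s))  ≈⟨ sum-cong (at-t j) ⟨
      sum (λ s → bas t j ∙ w s)  ≈⟨ ∙-∑ (bas t j) w ⟨
      bas t j ∙ ∑ w  ≈⟨ ∙-congʳ (bas t j) w≋0 ⟩
      bas t j ∙ 𝟎  ≈⟨ ∙-𝟎 (bas t j) ⟩
      0ℂ  ∎
    vanish : ∀ j → c j ≈ 0ℂ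
    vanish j = cancel {fromℤ (+ 36)} {c j} 36# (begin
      fromℤ (+ 36) * c j  ≈⟨ coordinate t c j ⟨
      fromℤ (weight t j) * (bas t j ∙ lincomb c (bas t))  ≈⟨ *-congˡ {fromℤ (weight t j)} (∙-congʳ (bas t j) wt≋c) ⟨
      fromℤ (weight t j) * (bas t j ∙ w t)  ≈⟨ *-congˡ {fromℤ (weight t j)} (bas∙w j) ⟩
      fromℤ (weight t j) * 0ℂ  ≈⟨ zeroʳ (fromℤ (weight t j)) ⟩
      0ℂ  ∎)

  -- The completeness relation applied to `v`, after exchanging the sums; the factor `h` undoes the
  -- cleared denominator `N`.
  resolve : ∀ {m n} {k : Fin m → ℕ} (w : ∀ s → Fin (k s) → ℂ) (b : ∀ s → Fin (k s) → ℂ^ (Fin n)) {h N} → h * N ≈ 1ℂ →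
            (∀ y z → sum (λ s → sum λ j → w s j * (b s j y * b s j z)) ≈ N * 𝟏 (y , z)) →
            ∀ v → v ≋ ∑ (λ s → lincomb (λ j → h * (w s j * (b s j ∙ v))) (b s))
  resolve w b {h} {N} hN≈1 wbb v y = sym (begin
    sum (λ s → sum λ j → h * (w s j * (b s j ∙ v)) * b s j y)
      ≈⟨ sum-cong (λ s → sum-cong λ j → trans (*-assoc h (w s j * (b s j ∙ v)) (b s j y)) (*-congˡ {h} (spread s j))) ⟩
    sum (λ s → sum λ j → h * sum (λ z → G s j z * v z))
      ≈⟨ sum-cong (λ s → *-distribˡ-sum h (λ j → sum λ z → G s j z * v z)) ⟨
    sum (λ s → h * sum (λ j → sum λ z → G s j z * v z))
      ≈⟨ *-distribˡ-sum h (λ s → sum λ j → sum λ z → G s j z * v z) ⟨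
    h * sum (λ s → sum λ j → sum λ z → G s j z * v z)
      ≈⟨ *-congˡ {h} (sum-cong λ s → ∑-comm (λ j z → G s j z * v z)) ⟩
    h * sum (λ s → sum λ z → sum λ j → G s j z * v z)
      ≈⟨ *-congˡ {h} (∑-comm (λ s z → sum λ j → G s j z * v z)) ⟩
    h * sum (λ z → sum λ s → sum λ j → G s j z * v z)
      ≈⟨ *-congˡ {h} (sum-cong λ z → sum-cong λ s → *-distribʳ-sum (v z) (λ j → G s j z)) ⟨
    h * sum (λ z → sum λ s → sum (λ j → G s j z) * v z)
      ≈⟨ *-congˡ {h} (sum-cong λ z → *-distribʳ-sum (v z) (λ s → sum λ j → G s j z)) ⟨
    h * sum (λ z → sum (λ s → sum λ j → G s j z) * v z)
      ≈⟨ *-congˡ {h} (sum-cong λ z → *-congʳ {v z} (wbb y z)) ⟩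
    h * sum (λ z → N * 𝟏 (y , z) * v z)
      ≈⟨ *-congˡ {h} (sum-cong λ z → *-assoc N (𝟏 (y , z)) (v z)) ⟩
    h * sum (λ z → N * (𝟏 (y , z) * v z))
      ≈⟨ *-congˡ {h} (*-distribˡ-sum N (λ z → 𝟏 (y , z) * v z)) ⟨
    h * (N * sum (λ z → 𝟏 (y , z) * v z))
      ≈⟨ *-congˡ {h} (*-congˡ {N} (sum-δ y v)) ⟩
    h * (N * v y)
      ≈⟨ *-assoc h N (v y) ⟨
    h * N * v y
      ≈⟨ *-congʳ {v y} hN≈1 ⟩
    1ℂ * v y
      ≈⟨ *-identityˡ (v y) ⟩
    v y ∎)
    where
    G : ∀ s → Fin _ → Fin _ → ℂ
    G s j z = w s j * (b s j y * b s j z)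
    spread : ∀ s j → w s j * (b s j ∙ v) * b s j y ≈ sum (λ z → G s j z * v z)
    spread s j = begin
      u * (c ∙ v) * c y  ≈⟨ xy∙z≈xz∙y u (c ∙ v) (c y) ⟩
      u * c y * sum (λ z → c z * v z)  ≈⟨ *-distribˡ-sum (u * c y) (λ z → c z * v z) ⟩
      sum (λ z → u * c y * (c z * v z))  ≈⟨ sum-cong (λ z → *-assoc (u * c y) (c z) (v z)) ⟨
      sum (λ z → u * c y * c z * v z)  ≈⟨ sum-cong (λ z → *-congʳ {v z} (*-assoc u (c y) (c z))) ⟩
      sum (λ z → u * (c y * c z) * v z)  ∎
      where
      u : ℂ
      u = w s j
      c : ℂ^ (Fin _)
      c = b s j

  component : ℂˣ → (s : Fin 7) → Fin (dim (kind s)) → ℂ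
  component v s j = proj₁ (inverse {fromℤ (+ 36)} 36#) * (fromℤ (weight s j) * (bas s j ∙ v))

  decomposition : IsOrthogonalDecomposition W
  decomposition = record
    { irreducible = irreducible
    ; orthogonal  = W-orthogonal
    ; direct      = W-direct
    ; total       = λ v → (λ s → lincomb (component v s) (bas s)) , (λ s → component v s , λ i → refl)
        , resolve (λ s j → fromℤ (weight s j)) bas (proj₂ (inverse {fromℤ (+ 36)} 36#)) resolution v
    }

-- Isomorphism classes and a basis of T

module Classification (ℝ : Reals) (Γ : Graph 18) (x : Fin 18) (model : Modules.Model ℝ Γ x) where
  open Linear ℝ
  open Terwilliger ℝ Γ 4 x renaming (V to ℂˣ)
  open Modules ℝ Γ x
  open Model model
  open Decomposition ℝ Γ x model public
  open SetoidReasoning setoid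

  Span : ∀ {k} → (Fin k → ℂˣ) → Pred ℂˣ 0ℓ
  Span v u = ∃[ c ] u ≋ lincomb c v

  UniqueCoordinates : ∀ {k} → (Fin k → ℂˣ) → Set
  UniqueCoordinates v = ∀ {c c′} → lincomb c v ≋ lincomb c′ v → ∀ j → c j ≈ c′ j

  module _ {k} (v v′ : Fin k → ℂˣ) (unique : UniqueCoordinates v) where
    replace : ∃ (Span v) → ∃ (Span v′)
    replace (u , c , u≋c) = lincomb c v′ , c , ≋-refl

    replace-lincomb : ∀ (u : ∃ (Span v)) b → proj₁ u ≋ lincomb b v → proj₁ (replace u) ≋ lincomb b v′
    replace-lincomb (u , c , u≋c) b u≋b = lincomb-congˡ v′ (unique (≋-trans {v = u} (≋-sym u≋c) u≋b))

  -- Coordinates are kept and the basis is changed. Uniqueness of coordinates makes this a map on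
  -- vectors, and since each element of T has the same matrix in both bases, the map commutes with
  -- T.
  span-iso : ∀ {k} (v v′ : Fin k → ℂˣ) → UniqueCoordinates v → UniqueCoordinates v′ →
             (∀ {B} → T B → Σ (Mat k) λ C → Represents B C v × Represents B C v′) → Span v ≅ Span v′
  span-iso v v′ unique unique′ joint = record
    { inverse = record
      { to        = replace v v′ unique
      ; from      = replace v′ v unique′
      ; to-cong   = λ {u} {w} u≋w → replace-lincomb v v′ unique u (coordinates w) (≋-trans u≋w (proj₂ (proj₂ w)))
      ; from-cong = λ {u} {w} u≋w → replace-lincomb v′ v unique′ u (coordinates w) (≋-trans u≋w (proj₂ (proj₂ w)))
      ; inverse   = (λ {w} {u} u≋w → ≋-trans (replace-lincomb v v′ unique u (coordinates w) u≋w) (≋-sym (proj₂ (proj₂ w))))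
                  , (λ {w} {u} u≋w → ≋-trans (replace-lincomb v′ v unique′ u (coordinates w) u≋w) (≋-sym (proj₂ (proj₂ w))))
      }
    ; additive    = λ { (u , c , u≋c) (w , b , w≋b) z z≋u⊕w →
        ≋-trans (replace-lincomb v v′ unique z (c ⊕ b)
                  (≋-trans z≋u⊕w (≋-trans (λ i → +-cong (u≋c i) (w≋b i)) (lincomb-⊕ c b v))))
                (≋-sym (lincomb-⊕ c b v′)) }
    ; homogeneous = λ { r (u , c , u≋c) z z≋ru →
        ≋-trans (replace-lincomb v v′ unique z (r ⊛ c)
                  (≋-trans z≋ru (≋-trans (λ i → *-congˡ {r} (u≋c i)) (lincomb-⊛ r c v))))
                (≋-sym (lincomb-⊛ r c v′)) }
    ; T-linear    = λ {B} TB → λ { (u , c , u≋c) z z≋Bu →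
        let C , r , r′ = joint TB in
        ≋-trans (replace-lincomb v v′ unique z (C · c)
                  (≋-trans z≋Bu (≋-trans (·-congʳ B u≋c) (Represents-· {v = v} {B} {C} r c))))
                (≋-sym (Represents-· {v = v′} {B} {C} r′ c)) }
    }
    where
    coordinates : ∀ {k} {v : Fin k → ℂˣ} → ∃ (Span v) → Fin k → ℂ
    coordinates (_ , c , _) = c

  same-kind : ∀ s t → kind s ≡ kind t → W s ≅ W t
  same-kind s t eq = iso eq (bas s) (bas t) (unique-coordinates s) (unique-coordinates t)
    (λ TB → let C , r = algebra-represents TB in C , r s , r t)
    where
    -- Stated for arbitrary families over variable kinds, so that the equation between kinds can be
    -- matched; `W s` is the span of `bas s`.
    iso : ∀ {τ υ} → τ ≡ υ → (v : Fin (dim τ) → ℂˣ) (v′ : Fin (dim υ) → ℂˣ) →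
          UniqueCoordinates v → UniqueCoordinates v′ →
          (∀ {B} → T B → Σ Actions λ C → Represents B (C τ) v × Represents B (C υ) v′) → Span v ≅ Span v′
    iso {τ} ≡.refl v v′ unique unique′ joint =
      span-iso v v′ unique unique′ (λ TB → let C , r , r′ = joint TB in C τ , r , r′)

  -- A matrix unit of the kind of `s` scales the first basis vector of `W s` by a factor apart from
  -- 0 and kills `W t`. So an isomorphism would send that vector and 0 to the same image.
  different-kind : ∀ s t → kind s ≢ kind t → ¬ (W s ≅ W t)
  different-kind s t s≢t φ = contradiction b≋0 (nonzero≢0 (bas-nonzero s zero))
    where
    module φ = _≅_ φ
    m : Fin 43
    m = encode (kind s) zero zero
    S : ℂ
    S = scaleOf m * 𝟏 {dim (kind s)} (zero , zero)
    S#0 : S # 0ℂ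
    S#0 = x#0y#0→xy#0 {scaleOf m} {1ℂ} (scaleOf# m) 1#0
    b o Sb : ∃ (W s)
    b  = bas s zero , bas∈W s zero
    o  = 𝟎 , IsSubspace.zero∈ (W-subspace s)
    Sb = S ⊛ bas s zero , IsSubspace.⊛-closed (W-subspace s) S {bas s zero} (bas∈W s zero)
    Sb≋Fb : S ⊛ bas s zero ≋ F m · bas s zero
    Sb≋Fb = ≋-sym (≋-trans {v = F m · lincomb (unit zero) (bas s)}
      (·-congʳ (F m) (≋-sym (lincomb-unit (bas s) zero))) (unit-action s zero zero (unit zero)))
    fSb≋0 : proj₁ (φ.f.to Sb) ≋ 𝟎
    fSb≋0 = ≋-trans (φ.T-linear (F∈T m) b Sb Sb≋Fb)
      (≋-trans {v = F m · lincomb (proj₁ (proj₂ (φ.f.to b))) (bas t)} (·-congʳ (F m) (proj₂ (proj₂ (φ.f.to b))))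
        (unit-kills t zero zero (proj₁ (proj₂ (φ.f.to b))) (s≢t ∘ ≡.sym)))
    fb≋0 : proj₁ (φ.f.to b) ≋ 𝟎
    fb≋0 i = cancel {S} {proj₁ (φ.f.to b) i} S#0 (trans (sym (φ.homogeneous S b Sb ≋-refl i)) (fSb≋0 i))
    fo≋0 : proj₁ (φ.f.to o) ≋ 𝟎
    fo≋0 i = trans (φ.homogeneous 0ℂ b o (λ i → sym (zeroˡ (bas s zero i))) i) (zeroˡ (proj₁ (φ.f.to b) i))
    b≋0 : bas s zero ≋ 𝟎
    b≋0 = ≋-trans {v = proj₁ (φ.f.from (φ.f.to o))}
      (≋-sym (proj₂ φ.f.inverse {b} {φ.f.to o} (≋-trans {v = 𝟎} fo≋0 (≋-sym fb≋0))))
      (proj₂ φ.f.inverse {o} {φ.f.to o} ≋-refl)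
    nonzero≢0 : ∀ {v : ℂˣ} → Nonzero v → ¬ (v ≋ 𝟎)
    nonzero≢0 {v} (i , v#0) v≋0 = #-irrefl {v i} {0ℂ} (v≋0 i) v#0

  isomorphic⇔ : ∀ s t → (W s ≅ W t) ⇔ (kind s ≡ kind t)
  isomorphic⇔ s t = mk⇔ (λ φ → decide φ (kind s ≟ₖ kind t)) (same-kind s t)
    where
    decide : W s ≅ W t → Dec (kind s ≡ kind t) → kind s ≡ kind t
    decide φ (yes eq) = eq
    decide φ (no neq) = contradiction φ (different-kind s t neq)

  -- Every unit vector is a sum of elements of the summands, so the columns of B and C agree.
  faithful : ∀ {B C} → (∀ s j → B · bas s j ≋ C · bas s j) → B ≋ C
  faithful {B} {C} B≋C (i , z) = begin
    B (i , z)  ≈⟨ ·-unit B i z ⟨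
    (B · unit z) i  ≈⟨ ·-congʳ B (resolved z) i ⟩
    (B · ∑ (w z)) i  ≈⟨ ·-∑ B (w z) i ⟩
    sum (λ s → (B · w z s) i)  ≈⟨ sum-cong (λ s → same s) ⟩
    sum (λ s → (C · w z s) i)  ≈⟨ ·-∑ C (w z) i ⟨
    (C · ∑ (w z)) i  ≈⟨ ·-congʳ C (resolved z) i ⟨
    (C · unit z) i  ≈⟨ ·-unit C i z ⟩
    C (i , z)  ∎
    where
    w : Fin 18 → Fin 7 → ℂˣ
    w z s = lincomb (component (unit z) s) (bas s)
    resolved : ∀ z → unit z ≋ ∑ (w z)
    resolved z = proj₂ (proj₂ (IsOrthogonalDecomposition.total decomposition (unit z)))
    same : ∀ s → (B · w z s) i ≈ (C · w z s) i
    same s = trans (·-lincomb B (component (unit z) s) (bas s) i)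
      (trans (lincomb-congʳ (component (unit z) s) (B≋C s) i) (sym (·-lincomb C (component (unit z) s) (bas s) i)))
    ·-∑ : ∀ {n k} (M : Mat n) (w : Fin k → ℂ^ (Fin n)) → M · ∑ w ≋ ∑ (λ s → M · w s)
    ·-∑ M w i = trans (sum-cong (λ z → *-distribˡ-sum (M (i , z)) (λ s → w s z))) (∑-comm (λ z s → M (i , z) * w s z))

  unit-coefficient : ∀ {n} (c S : Fin n → ℂ) e → sum (λ m → c m * (𝟏 (e , m) * S m)) ≈ c e * S e
  unit-coefficient c S e = trans (sum-cong (λ m → x∙yz≈y∙xz (c m) (𝟏 (e , m)) (S m))) (sum-δ e (λ m → c m * S m))

  lincomb-F : ∀ c s → Represents (lincomb c F)
    (λ (i , j) → c (encode (kind s) i j) * scaleOf (encode (kind s) i j)) (bas s)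
  lincomb-F c s = Represents-cong {v = bas s} {lincomb c F} {lincomb c F}
    {λ ij → sum λ m → c m * X m ij} {λ (i , j) → c (encode (kind s) i j) * scaleOf (encode (kind s) i j)}
    (λ _ → refl) (λ (i , j) → unit-coefficient c scaleOf (encode (kind s) i j))
    (lincomb-represents c F X (bas s) (λ m → F-represents m s))
    where
    X : Fin 43 → Mat (dim (kind s))
    X m (i , j) = 𝟏 (encode (kind s) i j , m) * scaleOf m

  -- For each type, a single summand of that type detects the coefficients of its block of matrix
  -- units.
  F-independent : ∀ c → lincomb c F ≋ 𝟎 → ∀ m → c m ≈ 0ℂ
  F-independent c c≋0 m = ≡.subst (λ m → c m ≈ 0ℂ) (encode-decode m)
    (for-kind (proj₁ (decode m)) (proj₁ (proj₂ (decode m))) (proj₂ (proj₂ (decode m))))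
    where
    for-summand : ∀ s i j → c (encode (kind s) i j) ≈ 0ℂ
    for-summand s i j = cancel {scaleOf (encode (kind s) i j)} {c (encode (kind s) i j)} (scaleOf# (encode (kind s) i j))
      (trans (*-comm (scaleOf (encode (kind s) i j)) (c (encode (kind s) i j)))
        (independent s (λ i → c (encode (kind s) i j) * scaleOf (encode (kind s) i j))
          (≋-trans (≋-sym (lincomb-F c s j)) (≋-trans (·-congˡ (bas s j) c≋0) (λ y → sum-zero (λ z → zeroˡ (bas s j z))))) i))
    for-kind : ∀ τ i j → c (encode τ i j) ≈ 0ℂ
    for-kind I   = for-summand 0F
    for-kind II  = for-summand 1F
    for-kind III = for-summand 3F
    for-kind IV  = for-summand 4F
    for-kind V   = for-summand 6F

  -- The coefficients are the entries of the matrices representing B, divided by the factors of the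
  -- matrix units. Both sides then act alike on every basis vector, and `faithful` applies.
  F-spanning : ∀ {B} → T B → ∃[ c ] B ≋ lincomb c F
  F-spanning {B} TB = c , faithful λ s j → ≋-trans (proj₂ (algebra-represents TB) s j)
    (≋-sym (≋-trans (lincomb-F c s j) (lincomb-congˡ (bas s) (λ i → coefficient (kind s) i j))))
    where
    C : Actions
    C = proj₁ (algebra-represents TB)
    at : Unit → ℂ
    at (τ , i , j) = C τ (i , j)
    scale⁻¹ : ∀ m → ∃[ y ] y * scaleOf m ≈ 1ℂ
    scale⁻¹ m = inverse {scaleOf m} (scaleOf# m)
    c : Fin 43 → ℂ
    c m = at (decode m) * proj₁ (scale⁻¹ m)
    coefficient : ∀ τ i j → c (encode τ i j) * scaleOf (encode τ i j) ≈ C τ (i , j)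
    coefficient τ i j = begin
      at (decode m) * proj₁ (scale⁻¹ m) * scaleOf m  ≈⟨ *-assoc (at (decode m)) (proj₁ (scale⁻¹ m)) (scaleOf m) ⟩
      at (decode m) * (proj₁ (scale⁻¹ m) * scaleOf m)  ≈⟨ *-congˡ {at (decode m)} (proj₂ (scale⁻¹ m)) ⟩
      at (decode m) * 1ℂ  ≈⟨ *-identityʳ (at (decode m)) ⟩
      at (decode m)  ≡⟨ ≡.cong at (decode-encode τ i j) ⟩
      C τ (i , j)  ∎
      where
      m : Fin 43
      m = encode τ i j

  dimT : HasDim T 43
  dimT = F , record { member = F∈T ; independent = F-independent ; spanning = F-spanning }

-- Multiplicities, endpoints, diameters, shapes and pure bases

abstract
  endpoint+≤4 : ∀ τ (j : Fin (dim τ)) → endpointOf τ ℕ.+ toℕ j ≤ 4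
  endpoint+≤4 = from-yes (all-kinds? λ τ → Fin.all? {dim τ} λ j → endpointOf τ ℕ.+ toℕ j ℕ.≤? 4)

summandsOf : ∀ τ → Vec (Fin 7) (multiplicityOf τ)
summandsOf I   = 0F ∷ []
summandsOf II  = 1F ∷ 2F ∷ []
summandsOf III = 3F ∷ []
summandsOf IV  = 4F ∷ 5F ∷ []
summandsOf V   = 6F ∷ []

abstract
  summandsOf-injective : ∀ τ i j → lookup (summandsOf τ) i ≡ lookup (summandsOf τ) j → i ≡ j
  summandsOf-injective = from-yes (all-kinds? λ τ → Fin.all? λ i → Fin.all? λ j →
    (lookup (summandsOf τ) i Fin.≟ lookup (summandsOf τ) j) →-dec (i Fin.≟ j))

  summandsOf-sound : ∀ τ i → kind (lookup (summandsOf τ) i) ≡ τ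
  summandsOf-sound = from-yes (all-kinds? λ τ → Fin.all? λ i → kind (lookup (summandsOf τ) i) ≟ₖ τ)

  summandsOf-complete : ∀ τ s → kind s ≡ τ → ∃[ i ] lookup (summandsOf τ) i ≡ s
  summandsOf-complete = from-yes (all-kinds? λ τ → Fin.all? λ s →
    (kind s ≟ₖ τ) →-dec Fin.any? λ i → lookup (summandsOf τ) i Fin.≟ s)

module TypeProperties (ℝ : Reals) (Γ : Graph 18) (x : Fin 18) (model : Modules.Model ℝ Γ x) where
  open Linear ℝ
  open Terwilliger ℝ Γ 4 x renaming (V to ℂˣ)
  open Modules ℝ Γ x
  open Model model
  open Classification ℝ Γ x model public
  open SetoidReasoning setoid

  hasMultiplicity : ∀ s → HasMultiplicity W (W s) (multiplicityOf (kind s))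
  hasMultiplicity s = record
    { elem      = lookup (summandsOf (kind s))
    ; injective = λ {i} {j} → summandsOf-injective (kind s) i j
    ; sound     = λ i → same-kind (lookup (summandsOf (kind s)) i) s (summandsOf-sound (kind s) i)
    ; complete  = λ t φ → summandsOf-complete (kind s) t (Equivalence.to (isomorphic⇔ t s) φ)
    }

  levelAt : ∀ s → Fin (dim (kind s)) → ℕ
  levelAt s j = endpointOf (kind s) ℕ.+ toℕ j

  levelAt-injective : ∀ s {j k} → levelAt s j ≡ levelAt s k → j ≡ k
  levelAt-injective s {j} {k} eq = Fin.toℕ-injective (ℕ.+-cancelˡ-≡ (endpointOf (kind s)) (toℕ j) (toℕ k) eq)

  -- The basis vectors of one summand lie on distinct levels, so a projection retains a single
  -- coordinate.
  E*-lincomb : ∀ s k c → E* (levelAt s k) · lincomb c (bas s) ≋ c k ⊛ bas s k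
  E*-lincomb s k c y = begin
    (E* (levelAt s k) · lincomb c (bas s)) y  ≈⟨ ·-lincomb (E* (levelAt s k)) c (bas s) y ⟩
    sum (λ j → c j * (E* (levelAt s k) · bas s j) y)  ≈⟨ sum-cong (λ j → trans (*-congˡ {c j} (at j (k Fin.≟ j))) (x∙yz≈y∙xz (c j) (𝟏 (k , j)) (bas s j y))) ⟩
    sum (λ j → 𝟏 (k , j) * (c j * bas s j y))  ≈⟨ sum-δ k (λ j → c j * bas s j y) ⟩
    c k * bas s k y  ∎
    where
    at : ∀ j → Dec (k ≡ j) → (E* (levelAt s k) · bas s j) y ≈ 𝟏 (k , j) * bas s j y
    at j (yes ≡.refl) = trans (on-level s k y)
      (sym (trans (*-congʳ {bas s k y} (reflexive (𝟏-refl k))) (*-identityˡ (bas s k y))))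
    at j (no k≢j) = trans (off-level (levelAt s k) s j (λ eq → k≢j (levelAt-injective s (≡.sym eq))) y)
      (sym (trans (*-congʳ {bas s j y} (reflexive (𝟏-≢ k≢j))) (zeroˡ (bas s j y))))

  image-basis : ∀ s k {v} → v ≋ bas s k → IsBasis (Image (E* (levelAt s k)) (W s)) (v F.∷ F.[])
  image-basis s k {v} v≋bas = record
    { member      = λ { 0F → bas s k , bas∈W s k , ≋-trans v≋bas (≋-sym (on-level s k)) }
    ; independent = λ { c c≋0 0F →
        let i , v#0 = Nonzero-cong (≋-sym v≋bas) (bas-nonzero s k)
        in cancel {v i} {c 0F} v#0 (trans (*-comm (v i) (c 0F)) (trans (sym (+-identityʳ (c 0F * v i))) (c≋0 i))) }
    ; spanning    = λ { {u} (w , (c , w≋c) , u≋Ew) → (λ _ → c k) , λ y → begin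
        u y  ≈⟨ u≋Ew y ⟩
        (E* (levelAt s k) · w) y  ≈⟨ ·-congʳ (E* (levelAt s k)) w≋c y ⟩
        (E* (levelAt s k) · lincomb c (bas s)) y  ≈⟨ E*-lincomb s k c y ⟩
        c k * bas s k y  ≈⟨ *-congˡ {c k} (v≋bas y) ⟨
        c k * v y  ≈⟨ +-identityʳ (c k * v y) ⟨
        c k * v y + 0ℂ  ∎ }
    }

  image-dim : ∀ s k → HasDim (Image (E* (levelAt s k)) (W s)) 1
  image-dim s k = bas s k F.∷ F.[] , image-basis s k ≋-refl

  supported : ∀ s j → Supported (W s) (levelAt s j)
  supported s j = endpoint+≤4 (kind s) j , bas s j , (bas s j , bas∈W s j , ≋-sym (on-level s j)) , bas-nonzero s j

  -- A nonzero projection to level `h` contains the nonzero projection of some basis vector, which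
  -- must therefore lie on level `h`.
  supported-complete : ∀ s h → Supported (W s) h → ∃[ j ] levelAt s j ≡ h
  supported-complete s h (_ , u , (w , (c , w≋c) , u≋Ew) , u#0) = j , decide (levelAt s j ℕ.≟ h)
    where
    u≋ : u ≋ lincomb c (λ j → E* h · bas s j)
    u≋ = ≋-trans u≋Ew (≋-trans (·-congʳ (E* h) w≋c) (·-lincomb (E* h) c (bas s)))
    hit : ∃[ j ] (c j # 0ℂ × Nonzero (E* h · bas s j))
    hit = Nonzero-lincomb {c = c} {λ j → E* h · bas s j} (Nonzero-cong u≋ u#0)
    j : Fin (dim (kind s))
    j = proj₁ hit
    decide : Dec (levelAt s j ≡ h) → levelAt s j ≡ h
    decide (yes eq) = eq
    decide (no neq) = let i , E#0 = proj₂ (proj₂ hit) in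
      contradiction E#0 (#-irrefl {(E* h · bas s j) i} {0ℂ} (off-level h s j neq i))

  hasEndpoint : ∀ s → HasEndpoint (W s) (endpointOf (kind s))
  hasEndpoint s = ≡.subst (Supported (W s)) (ℕ.+-identityʳ (endpointOf (kind s))) (supported s zero)
                , λ h sup → let j , eq = supported-complete s h sup in
                            ≡.subst (endpointOf (kind s) ≤_) eq (ℕ.m≤m+n (endpointOf (kind s)) (toℕ j))

  moduleDiameter : ∀ s → ModuleDiameter (W s) (diameterOf (kind s))
  moduleDiameter s = record
    { elem = levelAt s ; injective = levelAt-injective s ; sound = supported s ; complete = supported-complete s }

  isPureBasis : ∀ s → IsPureBasis (W s) (bas s)
  isPureBasis s = W-basis s , levelAt s
                , (λ j → endpoint+≤4 (kind s) j , bas-nonzero s j , bas s j , _ , ≋-sym (on-level s j))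
                , λ i j i≤j → ℕ.+-monoʳ-≤ (endpointOf (kind s)) i≤j

-- The seeds and the bases of the statement in terms of labels

abstract
  permutation-exhaustive : ∀ i j k → i ≢ j → i ≢ k → j ≢ k →
    ∃[ π ] (permutation π 0F ≡ i × permutation π 1F ≡ j × permutation π 2F ≡ k)
  permutation-exhaustive = from-yes (Fin.all? λ i → Fin.all? λ j → Fin.all? λ k →
    ¬? (i Fin.≟ j) →-dec (¬? (i Fin.≟ k) →-dec (¬? (j Fin.≟ k) →-dec
    Fin.any? λ π → (permutation π 0F Fin.≟ i) ×-dec ((permutation π 1F Fin.≟ j) ×-dec (permutation π 2F Fin.≟ k)))))

permutation-of : (f : Fin 3 → Fin 3) → Injective _≡_ _≡_ f → ∃[ π ] ∀ i → permutation π i ≡ f i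
permutation-of f inj =
  let π , p₀ , p₁ , p₂ = permutation-exhaustive (f 0F) (f 1F) (f 2F)
                           (λ eq → contradiction (inj eq) λ ()) (λ eq → contradiction (inj eq) λ ())
                           (λ eq → contradiction (inj eq) λ ())
  in π , λ { 0F → p₀ ; 1F → p₁ ; 2F → p₂ }

p-label : Fin 3 → Fin 18
p-label k = 1 Fin.↑ʳ (k Fin.↑ˡ 14)

abstract
  p-label-level : ∀ k → level (p-label k) ≡ 1
  p-label-level = from-yes (Fin.all? λ k → level (p-label k) ℕ.≟ 1)

  level⇒p-label : ∀ i → level i ≡ 1 → ∃[ k ] p-label k ≡ i
  level⇒p-label = from-yes (Fin.all? λ i → (level i ℕ.≟ 1) →-dec Fin.any? λ k → p-label k Fin.≟ i)

  level⇒y-label : ∀ i → level i ≡ 2 → ∃[ k ] y-label k ≡ i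
  level⇒y-label = from-yes (Fin.all? λ i → (level i ℕ.≟ 2) →-dec Fin.any? λ k → y-label k Fin.≟ i)

q-label : Fin 6 → Fin 18
q-label k = 10 Fin.↑ʳ (k Fin.↑ˡ 2)

abstract
  level⇒q-label : ∀ i → level i ≡ 3 → ∃[ k ] q-label k ≡ i
  level⇒q-label = from-yes (Fin.all? λ i → (level i ℕ.≟ 3) →-dec Fin.any? λ k → q-label k Fin.≟ i)

u-label : Fin 2 → Fin 18
u-label k = 16 Fin.↑ʳ k

parity : Fin 6 → Fin 2
parity = lookup (0F ∷ 1F ∷ 0F ∷ 1F ∷ 0F ∷ 1F ∷ [])

abstract
  q-neighbor : ∀ k → neighbor (q-label k) 2F ≡ u-label (parity k)
  q-neighbor = from-yes (Fin.all? λ k → neighbor (q-label k) 2F Fin.≟ u-label (parity k))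

  block-6F : ∀ π ε k → lookup (block π ε 6F 0F) (q-label k)
                      ≡ (if does (parity k Fin.≟ ε) then + 1 else -1ℤ)
  block-6F = from-yes (Fin.all? λ π → Fin.all? λ ε → Fin.all? λ k →
    lookup (block π ε 6F 0F) (q-label k) ℤ.≟ (if does (parity k Fin.≟ ε) then + 1 else -1ℤ))

  block-0F : ∀ π ε h y → lookup (block π ε 0F h) y ≡ (if does (level y ℕ.≟ toℕ h) then + 1 else + 0)
  block-0F = from-yes (Fin.all? λ π → Fin.all? λ ε → Fin.all? λ h → Fin.all? λ y →
    lookup (block π ε 0F h) y ℤ.≟ (if does (level y ℕ.≟ toℕ h) then + 1 else + 0))

module Coordinates (ℝ : Reals) {Γ : Graph 18} (pappus : IsPappus Γ) {x : Fin 18}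
                   (labelling : Labelling (Graph._∼_ Γ) (Graph.d Γ) x) where
  open Linear ℝ
  open Terwilliger ℝ Γ 4 x renaming (V to ℂˣ) hiding (A)
  open LabelledVectors ℝ pappus labelling public
  open Modules ℝ Γ x using (fromℤ-sum; fromℤ-if)
  open Graph Γ using (d)
  open SetoidReasoning setoid

  lift : Vec ℤ 18 → ℂˣ
  lift u y = fromℤ (lookup u (index y))

  lift-label : ∀ u i → lift u (label i) ≡ fromℤ (lookup u i)
  lift-label u i = ≡.cong (λ j → fromℤ (lookup u j)) (index-label i)

  e*-label : ∀ h i → e* h (label i) ≡ (if does (level i ℕ.≟ h) then 1ℂ else 0ℂ)
  e*-label h i = ≡.cong (λ n → if does (n ℕ.≟ h) then 1ℂ else 0ℂ) (label-level i)

  E*-· : ∀ h v y → (E* h · v) y ≈ e* h y * v y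
  E*-· h v y = trans (sum-cong (λ z → term z (does (y Fin.≟ z)))) (sum-δ y (λ z → e* h y * v z))
    where
    term : ∀ z b → (if b then e* h y else 0ℂ) * v z ≈ (if b then 1ℂ else 0ℂ) * (e* h y * v z)
    term z true  = sym (*-identityˡ (e* h y * v z))
    term z false = trans (zeroˡ (v z)) (sym (zeroˡ (e* h y * v z)))

  E*-label : ∀ h v i → (E* h · v) (label i) ≈ (if does (level i ℕ.≟ h) then 1ℂ else 0ℂ) * v (label i)
  E*-label h v i = trans (E*-· h v (label i)) (*-congʳ {v (label i)} (reflexive (e*-label h i)))

  E*-on : ∀ h v i → level i ≡ h → (E* h · v) (label i) ≈ v (label i)
  E*-on h v i eq = trans (E*-label h v i) (trans
    (*-congʳ {v (label i)} (reflexive (≡.cong (if_then 1ℂ else 0ℂ) (dec-true (level i ℕ.≟ h) eq)))) (*-identityˡ (v (label i))))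

  E*-off : ∀ h v i → level i ≢ h → (E* h · v) (label i) ≈ 0ℂ
  E*-off h v i neq = trans (E*-label h v i) (trans
    (*-congʳ {v (label i)} (reflexive (≡.cong (if_then 1ℂ else 0ℂ) (dec-false (level i ℕ.≟ h) neq)))) (zeroˡ (v (label i))))

  A-lift : ∀ u i → (A · lift u) (label i) ≈ fromℤ (sumℤ λ k → lookup u (neighbor i k))
  A-lift u i = trans (A-label (lift u) i)
    (trans (sum-cong (λ k → reflexive (lift-label u (neighbor i k)))) (sym (fromℤ-sum (λ k → lookup u (neighbor i k)))))

  A-step : ∀ {v} u w → v ≋ lift u → (∀ i → (sumℤ λ k → lookup u (neighbor i k)) ≡ lookup w i) → A · v ≋ lift w
  A-step u w v≋u eq = by-label λ i → trans (·-congʳ A v≋u (label i)) (trans (A-lift u i)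
    (trans (reflexive (≡.cong fromℤ (eq i))) (sym (reflexive (lift-label w i)))))

  E*-A-step : ∀ {v} h u w → v ≋ lift u →
              (∀ i → level i ≡ h → (sumℤ λ k → lookup u (neighbor i k)) ≡ lookup w i) →
              (∀ i → level i ≢ h → lookup w i ≡ + 0) → E* h · A · v ≋ lift w
  E*-A-step {v} h u w v≋u on off = by-label λ i → cases i (level i ℕ.≟ h)
    where
    cases : ∀ i → Dec (level i ≡ h) → (E* h · A · v) (label i) ≈ lift w (label i)
    cases i (yes eq) = trans (E*-on h (A · v) i eq) (trans (·-congʳ A v≋u (label i)) (trans (A-lift u i)
      (trans (reflexive (≡.cong fromℤ (on i eq))) (sym (reflexive (lift-label w i))))))
    cases i (no neq) = trans (E*-off h (A · v) i neq)
      (sym (reflexive (≡.trans (lift-label w i) (≡.cong fromℤ (off i neq)))))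

  lift-dot : ∀ u w → lift u ∙ lift w ≈ fromℤ (dot u w)
  lift-dot u w = trans (sum-label (λ y → lift u y * lift w y))
    (trans (sum-cong (λ i → trans (*-cong (reflexive (lift-label u i)) (reflexive (lift-label w i)))
             (sym (fromℤ-* (lookup u i) (lookup w i)))))
      (sym (fromℤ-sum (λ i → lookup u i ℤ.* lookup w i))))

  module _ {P : Fin 18 → Set} {m : ℕ} (e : Enumeration P m) (a : Vec ℤ m) where
    essential-at : ∀ k → fromEssentialPart (elem e) a (elem e k) ≈ fromℤ (lookup a k)
    essential-at k = trans
      (sum-cong (λ l → trans (*-comm (fromℤ (lookup a l)) (𝟏 (elem e l , elem e k)))
        (*-congʳ {fromℤ (lookup a l)} (reflexive (≡.trans (𝟏-injective (Enumeration.injective e) l k) (𝟏-sym l k))))))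
      (sum-δ k (λ l → fromℤ (lookup a l)))

    essential-off : ∀ v → ¬ P v → fromEssentialPart (elem e) a v ≈ 0ℂ
    essential-off v ¬Pv = sum-zero λ l → trans
      (*-congˡ {fromℤ (lookup a l)} (reflexive (𝟏-≢ λ eq → ¬Pv (≡.subst P eq (Enumeration.sound e l)))))
      (zeroʳ (fromℤ (lookup a l)))

  essential-≋ : ∀ {h m} (e : Enumeration (λ v → d x v ≡ h) m) (a : Vec ℤ m) (w : Vec ℤ 18) →
                (∀ i → level i ≢ h → lookup w i ≡ + 0) →
                (∀ i → level i ≡ h → ∃[ k ] (elem e k ≡ label i × lookup a k ≡ lookup w i)) →
                fromEssentialPart (elem e) a ≋ lift w
  essential-≋ {h} e a w off on = by-label λ i → cases i (level i ℕ.≟ h)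
    where
    cases : ∀ i → Dec (level i ≡ h) → fromEssentialPart (elem e) a (label i) ≈ lift w (label i)
    cases i (yes eq) = let k , e≡ , a≡w = on i eq in trans
      (≡.subst (λ v → fromEssentialPart (elem e) a v ≈ fromℤ (lookup a k)) e≡ (essential-at e a k))
      (reflexive (≡.trans (≡.cong fromℤ a≡w) (≡.sym (lift-label w i))))
    cases i (no neq) = trans (essential-off e a (label i) (λ eq → neq (≡.trans (≡.sym (label-level i)) eq)))
      (sym (reflexive (≡.trans (lift-label w i) (≡.cong fromℤ (off i neq)))))

  -- The vectors `bas` are arbitrary up to `≋`, because those of the theorem are given as eᵢ*, ν, Aν
  -- and so on, not by integer coordinates.
  module BlockModel (π : Fin 6) (ε : Fin 2) (bas : ∀ s → Fin (dim (kind s)) → ℂˣ)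
                    (bas≋ : ∀ s j → bas s j ≋ lift (block π ε s j)) where
    b : ∀ s → Fin (dim (kind s)) → Vec ℤ 18
    b = block π ε

    levelOfBlock : ∀ s → Fin (dim (kind s)) → ℕ
    levelOfBlock s j = endpointOf (kind s) ℕ.+ toℕ j

    lift-represents : ∀ s → Represents A (fromRows (actionOf (kind s))) (λ j → lift (b s j))
    lift-represents s j = by-label λ i → begin
      (A · lift (b s j)) (label i)  ≈⟨ A-lift (b s j) i ⟩
      fromℤ (sumℤ λ k → lookup (b s j) (neighbor i k))  ≡⟨ ≡.cong fromℤ (block-action π ε s j i) ⟩
      fromℤ (sumℤ λ l → entry M l j ℤ.* lookup (b s l) i)  ≈⟨ fromℤ-sum (λ l → entry M l j ℤ.* lookup (b s l) i) ⟩
      sum (λ l → fromℤ (entry M l j ℤ.* lookup (b s l) i))  ≈⟨ sum-cong (λ l → fromℤ-* (entry M l j) (lookup (b s l) i)) ⟩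
      sum (λ l → fromℤ (entry M l j) * fromℤ (lookup (b s l) i))
        ≈⟨ sum-cong (λ l → *-congˡ {fromℤ (entry M l j)} (reflexive (lift-label (b s l) i))) ⟨
      sum (λ l → fromℤ (entry M l j) * lift (b s l) (label i))  ∎
      where
      M : Vec (Vec ℤ (dim (kind s))) (dim (kind s))
      M = actionOf (kind s)

    lift-on : ∀ s j → E* (levelOfBlock s j) · lift (b s j) ≋ lift (b s j)
    lift-on s j = by-label λ i → cases i (level i ℕ.≟ levelOfBlock s j)
      where
      cases : ∀ i → Dec (level i ≡ levelOfBlock s j) →
              (E* (levelOfBlock s j) · lift (b s j)) (label i) ≈ lift (b s j) (label i)
      cases i (yes eq) = E*-on (levelOfBlock s j) (lift (b s j)) i eq
      cases i (no neq) = trans (E*-off (levelOfBlock s j) (lift (b s j)) i neq)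
        (sym (reflexive (≡.trans (lift-label (b s j) i) (≡.cong fromℤ (block-level π ε s j i neq)))))

    lift-off : ∀ h s j → levelOfBlock s j ≢ h → E* h · lift (b s j) ≋ 𝟎
    lift-off h s j ≢h = by-label λ i → cases i (level i ℕ.≟ h)
      where
      cases : ∀ i → Dec (level i ≡ h) → (E* h · lift (b s j)) (label i) ≈ 0ℂ
      cases i (no neq) = E*-off h (lift (b s j)) i neq
      cases i (yes eq) = trans (E*-on h (lift (b s j)) i eq) (reflexive (≡.trans (lift-label (b s j) i)
        (≡.cong fromℤ (block-level π ε s j i (λ at → ≢h (≡.trans (≡.sym at) eq))))))

    bas-dot : ∀ s j t k → bas s j ∙ bas t k ≈ fromℤ (dot (b s j) (b t k))
    bas-dot s j t k = trans (sum-cong (λ y → *-cong (bas≋ s j y) (bas≋ t k y))) (lift-dot (b s j) (b t k))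

    fromℤ-δ : ∀ {n} (i j : Fin n) → fromℤ (if does (i Fin.≟ j) then + 36 else + 0) ≈ fromℤ (+ 36) * 𝟏 (i , j)
    fromℤ-δ i j = trans (fromℤ-if (does (i Fin.≟ j)) (+ 36)) (*-comm (𝟏 (i , j)) (fromℤ (+ 36)))

    model : Modules.Model ℝ Γ x
    model = record
      { bas          = bas
      ; A-represents = λ s → Represents-basis {B = A} {fromRows (actionOf (kind s))} (λ j → ≋-sym (bas≋ s j)) (lift-represents s)
      ; on-level     = λ s j → ≋-trans (·-congʳ (E* (levelOfBlock s j)) (bas≋ s j)) (≋-trans (lift-on s j) (≋-sym (bas≋ s j)))
      ; off-level    = λ h s j ≢h → ≋-trans (·-congʳ (E* h) (bas≋ s j)) (lift-off h s j ≢h)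
      ; bas-real     = λ s j y → trans (conj-cong (bas≋ s j y))
                         (trans (conj-fromℤ (lookup (b s j) (index y))) (sym (bas≋ s j y)))
      ; orthogonal   = λ s t s≢t j k → trans (bas-dot s j t k) (reflexive (≡.cong fromℤ (block-orthogonal π ε s t s≢t j k)))
      ; gram         = λ s j k → trans (*-congˡ {fromℤ (weight s j)} (bas-dot s j s k))
                         (trans (sym (fromℤ-* (weight s j) (dot (b s j) (b s k))))
                           (trans (reflexive (≡.cong fromℤ (block-gram π ε s j k))) (fromℤ-δ j k)))
      ; resolution   = λ y z → trans (sum-cong (λ s → sum-cong (λ j → product s j y z)))
                         (trans (sym (trans (fromℤ-sum (λ s → sumℤ λ j → G s j (index y) (index z)))
                                            (sum-cong (λ s → fromℤ-sum (λ j → G s j (index y) (index z))))))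
                           (trans (reflexive (≡.cong fromℤ (block-complete π ε (index y) (index z))))
                             (trans (fromℤ-δ (index y) (index z))
                               (*-congˡ {fromℤ (+ 36)} (reflexive (𝟏-injective index-injective y z))))))
      }
      where
      G : ∀ s → Fin (dim (kind s)) → Fin 18 → Fin 18 → ℤ
      G s j i k = weight s j ℤ.* (lookup (b s j) i ℤ.* lookup (b s j) k)
      product : ∀ s j y z → fromℤ (weight s j) * (bas s j y * bas s j z) ≈ fromℤ (G s j (index y) (index z))
      product s j y z = trans (*-congˡ {fromℤ (weight s j)} (trans (*-cong (bas≋ s j y) (bas≋ s j z))
          (sym (fromℤ-* (lookup (b s j) (index y)) (lookup (b s j) (index z))))))
        (sym (fromℤ-* (weight s j) (lookup (b s j) (index y) ℤ.* lookup (b s j) (index z))))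

abstract
  level⇒u-label : ∀ i → level i ≡ 4 → ∃[ k ] u-label k ≡ i
  level⇒u-label = from-yes (Fin.all? λ i → (level i ℕ.≟ 4) →-dec Fin.any? λ k → u-label k Fin.≟ i)

  only-two : ∀ (ε ε′ δ : Fin 2) → ε ≢ ε′ → δ ≢ ε → δ ≡ ε′
  only-two = from-yes (Fin.all? {2} λ ε → Fin.all? {2} λ ε′ → Fin.all? {2} λ δ →
    ¬? (ε Fin.≟ ε′) →-dec (¬? (δ Fin.≟ ε) →-dec (δ Fin.≟ ε′)))

blockSum : Fin 6 → Fin 2 → ∀ s → Fin (dim (kind s)) → Fin 18 → ℤ
blockSum π ε s j i = sumℤ λ k → lookup (block π ε s j) (neighbor i k)

abstract
  blockSum-1F : ∀ π ε i → blockSum π ε 1F 0F i ≡ lookup (block π ε 1F 1F) i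
  blockSum-1F = from-yes (Fin.all? λ π → Fin.all? λ ε → Fin.all? λ i →
    blockSum π ε 1F 0F i ℤ.≟ lookup (block π ε 1F 1F) i)

  blockSum-2F : ∀ π ε i → blockSum π ε 2F 0F i ≡ lookup (block π ε 2F 1F) i
  blockSum-2F = from-yes (Fin.all? λ π → Fin.all? λ ε → Fin.all? λ i →
    blockSum π ε 2F 0F i ℤ.≟ lookup (block π ε 2F 1F) i)

  blockSum-4F : ∀ π ε i → blockSum π ε 4F 0F i ≡ lookup (block π ε 4F 1F) i
  blockSum-4F = from-yes (Fin.all? λ π → Fin.all? λ ε → Fin.all? λ i →
    blockSum π ε 4F 0F i ℤ.≟ lookup (block π ε 4F 1F) i)

  blockSum-5F : ∀ π ε i → blockSum π ε 5F 0F i ≡ lookup (block π ε 5F 1F) i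
  blockSum-5F = from-yes (Fin.all? λ π → Fin.all? λ ε → Fin.all? λ i →
    blockSum π ε 5F 0F i ℤ.≟ lookup (block π ε 5F 1F) i)

  blockSum-6F : ∀ π ε i → blockSum π ε 6F 0F i ≡ lookup (block π ε 6F 1F) i
  blockSum-6F = from-yes (Fin.all? λ π → Fin.all? λ ε → Fin.all? λ i →
    blockSum π ε 6F 0F i ℤ.≟ lookup (block π ε 6F 1F) i)

  -- A sends the middle vector to twice the first plus the third, so agreement holds only on level
  -- 3; the part on level 1 is what `E* 3` removes.
  blockSum-1F-level : ∀ π ε i → level i ≡ 3 → blockSum π ε 1F 1F i ≡ lookup (block π ε 1F 2F) i
  blockSum-1F-level = from-yes (Fin.all? λ π → Fin.all? λ ε → Fin.all? λ i →
    (level i ℕ.≟ 3) →-dec (blockSum π ε 1F 1F i ℤ.≟ lookup (block π ε 1F 2F) i))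

  blockSum-2F-level : ∀ π ε i → level i ≡ 3 → blockSum π ε 2F 1F i ≡ lookup (block π ε 2F 2F) i
  blockSum-2F-level = from-yes (Fin.all? λ π → Fin.all? λ ε → Fin.all? λ i →
    (level i ℕ.≟ 3) →-dec (blockSum π ε 2F 1F i ℤ.≟ lookup (block π ε 2F 2F) i))

module Summands (ℝ : Reals) (√3 : Reals.Carrier ℝ) (√3-sqrt : Reals.IsSqrt ℝ √3 (+ 3))
                {Γ : Graph 18} (pappus : IsPappus Γ) (x : Fin 18)
                (Γ₁ : OrderingΓ₁ Γ x) (Γ₂ : OrderingΓ₂ Γ x) (Γ₃ : OrderingΓ₃ Γ x)
                (labelling : Labelling (Graph._∼_ Γ) (Graph.d Γ) x)
                (label-y : ∀ k → Labelling.label labelling (y-label k) ≡ elem (proj₁ Γ₂) k) where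
  open Linear ℝ
  open Terwilliger ℝ Γ 4 x renaming (V to ℂˣ) hiding (A)
  open PappusModules ℝ √3 Γ x Γ₁ Γ₂ Γ₃ hiding (-1ℤ; -2ℤ)
  open Coordinates ℝ pappus labelling
  open Modules ℝ Γ x using (fromℤ-if)
  open Graph Γ using (_∼_; d)
  open AdmissibleΓ₃ (proj₂ Γ₃)

  -- The labelling numbers the parents by their pairs. This is the place of each parent in the given
  -- ordering of Γ₁(x).
  position : Fin 3 → Fin 3
  position i = proj₁ (Enumeration.complete Γ₁ (label (p-label i)) (≡.trans (label-level (p-label i)) (p-label-level i)))

  elem-position : ∀ i → elem Γ₁ (position i) ≡ label (p-label i)
  elem-position i = proj₂ (Enumeration.complete Γ₁ (label (p-label i)) (≡.trans (label-level (p-label i)) (p-label-level i)))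

  position-injective : Injective _≡_ _≡_ position
  position-injective {i} {j} eq = Fin.↑ˡ-injective 14 i j (Fin.↑ʳ-injective 1 _ _ (label-injective
    (≡.trans (≡.sym (elem-position i)) (≡.trans (≡.cong (elem Γ₁) eq) (elem-position j)))))

  -- Tells which of the labels 16 and 17 is the k-th vertex of Γ₄(x) in the enumeration that comes
  -- with the ordering of Γ₃(x); for the first vertex this determines the sign.
  upper : ∀ k → ∃[ ε ] label (u-label ε) ≡ elem Γ₄ k
  upper k =
    let at-4 = ≡.trans (≡.sym (label-level (index (elem Γ₄ k))))
                 (≡.trans (≡.cong (d x) (label-index (elem Γ₄ k))) (Enumeration.sound Γ₄ k))
        ε , eq = level⇒u-label (index (elem Γ₄ k)) at-4
    in ε , ≡.trans (≡.cong label eq) (label-index (elem Γ₄ k))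

  π : Fin 6
  π = proj₁ (permutation-of position position-injective)

  permutation-π : ∀ i → permutation π i ≡ position i
  permutation-π = proj₂ (permutation-of position position-injective)

  ε ε′ : Fin 2
  ε  = proj₁ (upper 0F)
  ε′ = proj₁ (upper 1F)

  label-ε : label (u-label ε) ≡ elem Γ₄ 0F
  label-ε = proj₂ (upper 0F)

  label-ε′ : label (u-label ε′) ≡ elem Γ₄ 1F
  label-ε′ = proj₂ (upper 1F)

  ε≢ε′ : ε ≢ ε′
  ε≢ε′ eq = contradiction
    (Enumeration.injective Γ₄ (≡.trans (≡.sym label-ε) (≡.trans (≡.cong (λ ε → label (u-label ε)) eq) label-ε′))) λ ()

  seedΓ₁≋ : ∀ a w → (∀ i → level i ≢ 1 → lookup w i ≡ + 0) →
            (∀ k → lookup a (permutation π k) ≡ lookup w (p-label k)) →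
            fromEssentialPart (elem Γ₁) a ≋ lift w
  seedΓ₁≋ a w off on = essential-≋ Γ₁ a w off λ i at-1 →
    let k , eq = level⇒p-label i at-1 in
    permutation π k , ≡.trans (≡.cong (elem Γ₁) (permutation-π k)) (≡.trans (elem-position k) (≡.cong label eq))
                    , ≡.trans (on k) (≡.cong (lookup w) eq)

  seedΓ₂≋ : ∀ a w → (∀ i → level i ≢ 2 → lookup w i ≡ + 0) →
            (∀ k → lookup a k ≡ lookup w (y-label k)) →
            fromEssentialPart (elem (proj₁ Γ₂)) a ≋ lift w
  seedΓ₂≋ a w off on = essential-≋ (proj₁ Γ₂) a w off λ i at-2 →
    let k , eq = level⇒y-label i at-2 in
    k , ≡.trans (≡.sym (label-y k)) (≡.cong label eq) , ≡.trans (on k) (≡.cong (lookup w) eq)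

  signs : Vec ℤ 6
  signs = + 1 ∷ -1ℤ ∷ -1ℤ ∷ + 1 ∷ -1ℤ ∷ + 1 ∷ []

  z : Fin 6 → Fin 18
  z = elem (proj₁ Γ₃)

  sign-below-first : ∀ k → z k ∼ elem Γ₄ 0F → lookup signs k ≡ + 1
  sign-below-first k z∼ = cases (Equivalence.to (neighbors₁₄₆ (z k)) z∼)
    where
    at : ∀ l → z k ≡ z l → lookup signs k ≡ lookup signs l
    at l eq = ≡.cong (lookup signs) (Enumeration.injective (proj₁ Γ₃) eq)
    cases : z k ≡ z 0F ⊎ z k ≡ z 3F ⊎ z k ≡ z 5F → lookup signs k ≡ + 1
    cases (inj₁ eq)        = at 0F eq
    cases (inj₂ (inj₁ eq)) = at 3F eq
    cases (inj₂ (inj₂ eq)) = at 5F eq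

  sign-below-second : ∀ k → z k ∼ elem Γ₄ 1F → lookup signs k ≡ -1ℤ
  sign-below-second k z∼ = cases (Equivalence.to (neighbors₂₃₅ (z k)) z∼)
    where
    at : ∀ l → z k ≡ z l → lookup signs k ≡ lookup signs l
    at l eq = ≡.cong (lookup signs) (Enumeration.injective (proj₁ Γ₃) eq)
    cases : z k ≡ z 1F ⊎ z k ≡ z 2F ⊎ z k ≡ z 4F → lookup signs k ≡ -1ℤ
    cases (inj₁ eq)        = at 1F eq
    cases (inj₂ (inj₁ eq)) = at 2F eq
    cases (inj₂ (inj₂ eq)) = at 4F eq

  -- The seed is +1 below the first vertex of Γ₄(x) and -1 below the second, and the parity of a
  -- link label tells which of the two it lies below.
  sign-parity : ∀ k l → z k ≡ label (q-label l) →
                lookup signs k ≡ (if does (parity l Fin.≟ ε) then + 1 else -1ℤ)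
  sign-parity k l eq = cases (parity l Fin.≟ ε)
    where
    below : ∀ {δ v} → parity l ≡ δ → label (u-label δ) ≡ v → z k ∼ v
    below {δ} {v} parity≡ label≡ = ≡.subst₂ _∼_ (≡.sym eq)
      (≡.trans (≡.cong label (≡.trans (q-neighbor l) (≡.cong u-label parity≡))) label≡) (edge (q-label l) 2F)
    cases : Dec (parity l ≡ ε) → lookup signs k ≡ (if does (parity l Fin.≟ ε) then + 1 else -1ℤ)
    cases (yes p) = ≡.trans (sign-below-first k (below p label-ε))
      (≡.sym (≡.cong (if_then + 1 else -1ℤ) (dec-true (parity l Fin.≟ ε) p)))
    cases (no ¬p) = ≡.trans (sign-below-second k (below (only-two ε ε′ (parity l) ε≢ε′ ¬p) label-ε′))
      (≡.sym (≡.cong (if_then + 1 else -1ℤ) (dec-false (parity l Fin.≟ ε) ¬p)))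

  seedΓ₃≋ : fromEssentialPart z signs ≋ lift (block π ε 6F 0F)
  seedΓ₃≋ = essential-≋ (proj₁ Γ₃) signs (block π ε 6F 0F) (block-level π ε 6F 0F) at-level
    where
    at-level : ∀ i → level i ≡ 3 → ∃[ k ] (z k ≡ label i × lookup signs k ≡ lookup (block π ε 6F 0F) i)
    at-level i at-3 = k , z≡ , ≡.trans (sign-parity k l (≡.trans z≡ (≡.cong label (≡.sym q≡i))))
                                 (≡.trans (≡.sym (block-6F π ε l)) (≡.cong (lookup (block π ε 6F 0F)) q≡i))
      where
      l : Fin 6
      l = proj₁ (level⇒q-label i at-3)
      q≡i : q-label l ≡ i
      q≡i = proj₂ (level⇒q-label i at-3)
      k : Fin 6
      k = proj₁ (Enumeration.complete (proj₁ Γ₃) (label i) (≡.trans (label-level i) at-3))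
      z≡ : z k ≡ label i
      z≡ = proj₂ (Enumeration.complete (proj₁ Γ₃) (label i) (≡.trans (label-level i) at-3))

  -- The dimensions in `typeData` and `dim` agree only after `s` is matched, hence the case split.
  bas : ∀ s → Fin (dim (kind s)) → ℂˣ
  bas 0F = basis 0F
  bas 1F = basis 1F
  bas 2F = basis 2F
  bas 3F = basis 3F
  bas 4F = basis 4F
  bas 5F = basis 5F
  bas 6F = basis 6F

  seed≋ : ∀ s → seed s ≋ lift (block π ε (suc s) zero)
  seed≋ 0F = seedΓ₁≋ (+ 1 ∷ -1ℤ ∷ + 0 ∷ []) (block π ε 1F 0F) (block-level π ε 1F 0F) λ { 0F → ≡.refl ; 1F → ≡.refl ; 2F → ≡.refl }
  seed≋ 1F = seedΓ₁≋ (+ 1 ∷ + 1 ∷ -2ℤ ∷ []) (block π ε 2F 0F) (block-level π ε 2F 0F) λ { 0F → ≡.refl ; 1F → ≡.refl ; 2F → ≡.refl }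
  seed≋ 2F = seedΓ₂≋ (-1ℤ ∷ + 1 ∷ + 1 ∷ -1ℤ ∷ -1ℤ ∷ + 1 ∷ []) (block π ε 3F 0F) (block-level π ε 3F 0F)
    λ { 0F → ≡.refl ; 1F → ≡.refl ; 2F → ≡.refl ; 3F → ≡.refl ; 4F → ≡.refl ; 5F → ≡.refl }
  seed≋ 3F = seedΓ₂≋ (+ 1 ∷ -1ℤ ∷ + 0 ∷ + 0 ∷ -1ℤ ∷ + 1 ∷ []) (block π ε 4F 0F) (block-level π ε 4F 0F)
    λ { 0F → ≡.refl ; 1F → ≡.refl ; 2F → ≡.refl ; 3F → ≡.refl ; 4F → ≡.refl ; 5F → ≡.refl }
  seed≋ 4F = seedΓ₂≋ (+ 1 ∷ -1ℤ ∷ + 2 ∷ -2ℤ ∷ + 1 ∷ -1ℤ ∷ []) (block π ε 5F 0F) (block-level π ε 5F 0F)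
    λ { 0F → ≡.refl ; 1F → ≡.refl ; 2F → ≡.refl ; 3F → ≡.refl ; 4F → ≡.refl ; 5F → ≡.refl }
  seed≋ 5F = seedΓ₃≋

  bas≋ : ∀ s j → bas s j ≋ lift (block π ε s j)
  bas≋ 0F j = by-label λ i → trans (reflexive (e*-label (toℕ j) i)) (trans (sym (indicator (does (level i ℕ.≟ toℕ j))))
    (reflexive (≡.sym (≡.trans (lift-label (block π ε 0F j) i) (≡.cong fromℤ (block-0F π ε j i))))))
    where
    indicator : ∀ b → fromℤ (if b then + 1 else + 0) ≈ (if b then 1ℂ else 0ℂ)
    indicator true  = fromℤ-1
    indicator false = refl
  bas≋ 1F 0F = seed≋ 0F
  bas≋ 1F 1F = A-step (block π ε 1F 0F) (block π ε 1F 1F) (seed≋ 0F) (blockSum-1F π ε)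
  bas≋ 1F 2F = E*-A-step 3 (block π ε 1F 1F) (block π ε 1F 2F) (bas≋ 1F 1F) (blockSum-1F-level π ε) (block-level π ε 1F 2F)
  bas≋ 2F 0F = seed≋ 1F
  bas≋ 2F 1F = A-step (block π ε 2F 0F) (block π ε 2F 1F) (seed≋ 1F) (blockSum-2F π ε)
  bas≋ 2F 2F = E*-A-step 3 (block π ε 2F 1F) (block π ε 2F 2F) (bas≋ 2F 1F) (blockSum-2F-level π ε) (block-level π ε 2F 2F)
  bas≋ 3F 0F = seed≋ 2F
  bas≋ 4F 0F = seed≋ 3F
  bas≋ 4F 1F = A-step (block π ε 4F 0F) (block π ε 4F 1F) (seed≋ 3F) (blockSum-4F π ε)
  bas≋ 5F 0F = seed≋ 4F
  bas≋ 5F 1F = A-step (block π ε 5F 0F) (block π ε 5F 1F) (seed≋ 4F) (blockSum-5F π ε)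
  bas≋ 6F 0F = seed≋ 5F
  bas≋ 6F 1F = A-step (block π ε 6F 0F) (block π ε 6F 1F) (seed≋ 5F) (blockSum-6F π ε)

  model : Modules.Model ℝ Γ x
  model = BlockModel.model π ε bas bas≋

-- The data of the seven summands

module Conclusions (ℝ : Reals) (√3 : Reals.Carrier ℝ) (√3-sqrt : Reals.IsSqrt ℝ √3 (+ 3))
                   {Γ : Graph 18} (pappus : IsPappus Γ) (x : Fin 18)
                   (Γ₁ : OrderingΓ₁ Γ x) (Γ₂ : OrderingΓ₂ Γ x) (Γ₃ : OrderingΓ₃ Γ x)
                   (labelling : Labelling (Graph._∼_ Γ) (Graph.d Γ) x)
                   (label-y : ∀ k → Labelling.label labelling (y-label k) ≡ elem (proj₁ Γ₂) k) where
  open LinearAlgebra ℝ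
  open Terwilliger ℝ Γ 4 x renaming (V to ℂˣ)
  open PappusModules ℝ √3 Γ x Γ₁ Γ₂ Γ₃ hiding (-1ℤ; -2ℤ)
  open TypeData
  open Summands ℝ √3 √3-sqrt pappus x Γ₁ Γ₂ Γ₃ labelling label-y using (model)
  open TypeProperties ℝ Γ x model
  open Eigen ℝ √3 √3-sqrt using (action-eigenvalues)
  open Modules.Model model using (A-represents; on-level)

  multiplicities : ∀ s → HasMultiplicity W (W s) (multiplicity (typeData (kind s)))
  multiplicities 0F = hasMultiplicity 0F
  multiplicities 1F = hasMultiplicity 1F
  multiplicities 2F = hasMultiplicity 2F
  multiplicities 3F = hasMultiplicity 3F
  multiplicities 4F = hasMultiplicity 4F
  multiplicities 5F = hasMultiplicity 5F
  multiplicities 6F = hasMultiplicity 6F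

  hasTypeData : ∀ s → HasTypeData (W s) (typeData (kind s)) (basis s)
  hasTypeData 0F = record
    { hasEndpoint = hasEndpoint 0F ; hasDimension = basis 0F , W-basis 0F ; hasDiameter = moduleDiameter 0F
    ; hasShape = λ { 0F → image-dim 0F 0F ; 1F → image-dim 0F 1F ; 2F → image-dim 0F 2F
                   ; 3F → image-dim 0F 3F ; 4F → image-dim 0F 4F }
    ; isPureBasis = isPureBasis 0F ; represents = A-represents 0F ; hasEigenvalues = just (action-eigenvalues I) }
  hasTypeData 1F = record
    { hasEndpoint = hasEndpoint 1F ; hasDimension = basis 1F , W-basis 1F ; hasDiameter = moduleDiameter 1F
    ; hasShape = λ { 0F → image-dim 1F 0F ; 1F → image-dim 1F 1F ; 2F → image-dim 1F 2F }
    ; isPureBasis = isPureBasis 1F ; represents = A-represents 1F ; hasEigenvalues = just (action-eigenvalues II) }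
  hasTypeData 2F = record
    { hasEndpoint = hasEndpoint 2F ; hasDimension = basis 2F , W-basis 2F ; hasDiameter = moduleDiameter 2F
    ; hasShape = λ { 0F → image-dim 2F 0F ; 1F → image-dim 2F 1F ; 2F → image-dim 2F 2F }
    ; isPureBasis = isPureBasis 2F ; represents = A-represents 2F ; hasEigenvalues = just (action-eigenvalues II) }
  hasTypeData 3F = record
    { hasEndpoint = hasEndpoint 3F ; hasDimension = basis 3F , W-basis 3F ; hasDiameter = moduleDiameter 3F
    ; hasShape = λ { 0F → image-dim 3F 0F }
    ; isPureBasis = isPureBasis 3F ; represents = A-represents 3F ; hasEigenvalues = just (action-eigenvalues III) }
  hasTypeData 4F = record
    { hasEndpoint = hasEndpoint 4F ; hasDimension = basis 4F , W-basis 4F ; hasDiameter = moduleDiameter 4F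
    ; hasShape = λ { 0F → image-dim 4F 0F ; 1F → image-dim 4F 1F }
    ; isPureBasis = isPureBasis 4F ; represents = A-represents 4F ; hasEigenvalues = just (action-eigenvalues IV) }
  hasTypeData 5F = record
    { hasEndpoint = hasEndpoint 5F ; hasDimension = basis 5F , W-basis 5F ; hasDiameter = moduleDiameter 5F
    ; hasShape = λ { 0F → image-dim 5F 0F ; 1F → image-dim 5F 1F }
    ; isPureBasis = isPureBasis 5F ; represents = A-represents 5F ; hasEigenvalues = just (action-eigenvalues IV) }
  hasTypeData 6F = record
    { hasEndpoint = hasEndpoint 6F ; hasDimension = basis 6F , W-basis 6F ; hasDiameter = moduleDiameter 6F
    ; hasShape = λ { 0F → image-dim 6F 0F ; 1F → image-dim 6F 1F }
    ; isPureBasis = isPureBasis 6F ; represents = A-represents 6F ; hasEigenvalues = nothing }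

  seed-basis : ∀ s → IsBasis (Image (E* (endpoint (typeData (kind (suc s))))) (W (suc s))) (seed s F.∷ F.[])
  seed-basis 0F = image-basis 1F 0F λ i → Linear.refl ℝ
  seed-basis 1F = image-basis 2F 0F λ i → Linear.refl ℝ
  seed-basis 2F = image-basis 3F 0F λ i → Linear.refl ℝ
  seed-basis 3F = image-basis 4F 0F λ i → Linear.refl ℝ
  seed-basis 4F = image-basis 5F 0F λ i → Linear.refl ℝ
  seed-basis 5F = image-basis 6F 0F λ i → Linear.refl ℝ

  conclusion : Σ (Fin 7 → Pred ℂˣ 0ℓ) λ W →
      IsOrthogonalDecomposition W
    × (∀ s t → (W s ≅ W t) ⇔ (kind s ≡ kind t))
    × (∀ s → HasMultiplicity W (W s) (multiplicity (typeData (kind s))))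
    × (∀ s → HasTypeData (W s) (typeData (kind s)) (basis s))
    × (∀ s → IsBasis (Image (E* (endpoint (typeData (kind (suc s))))) (W (suc s)))
                     (seed s F.∷ F.[]))
    × (A · seed 0F ≋ E* 2 · A · seed 0F)
    × (A · seed 1F ≋ E* 2 · A · seed 1F)
    × (A · seed 3F ≋ E* 3 · A · seed 3F)
    × (A · seed 4F ≋ E* 3 · A · seed 4F)
    × (A · seed 5F ≋ E* 4 · A · seed 5F)
  conclusion = W , decomposition , isomorphic⇔ , multiplicities , hasTypeData , seed-basis
             , on-level-sym 1F 1F , on-level-sym 2F 1F , on-level-sym 4F 1F , on-level-sym 5F 1F , on-level-sym 6F 1F
    where
    on-level-sym : ∀ s j → Modules.Model.bas model s j ≋ E* (levelAt s j) · Modules.Model.bas model s j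
    on-level-sym s j = Linear.≋-sym ℝ (on-level s j)

open import Data.List.Base using ([]; _∷_)
open import Data.Nat.Base using (_+_; _^_)

mainTheorem6 :
  (ℝ : Reals) (√3 : Reals.Carrier ℝ) → Reals.IsSqrt ℝ √3 (+ 3) →
  (Γ : Graph 18) → IsPappus Γ →
  let open LinearAlgebra ℝ in
  HasSpectrum (adjacency Γ)
    ( (Complex.fromℤ ℝ (+ 3) , 1) ∷ (Complex.real ℝ √3 , 6) ∷ (Complex.fromℤ ℝ (+ 0) , 4)
    ∷ (Complex.real ℝ (Reals.-_ ℝ √3) , 6) ∷ (Complex.fromℤ ℝ -[1+ 2 ] , 1) ∷ [] )
  ×
  ((x : Fin 18) →
    let open Terwilliger ℝ Γ 4 x renaming (V to ℂˣ) in
    (OrderingΓ₁ Γ x × OrderingΓ₂ Γ x × OrderingΓ₃ Γ x)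
    ×
    ((Γ₁ : OrderingΓ₁ Γ x) (Γ₂ : OrderingΓ₂ Γ x) (Γ₃ : OrderingΓ₃ Γ x) →
      let open PappusModules ℝ √3 Γ x Γ₁ Γ₂ Γ₃
          open TypeData
      in
      Σ (Fin 7 → Pred ℂˣ 0ℓ) λ W →
        IsOrthogonalDecomposition W
      × (∀ s t → (W s ≅ W t) ⇔ (kind s ≡ kind t))
      × (∀ s → HasMultiplicity W (W s) (multiplicity (typeData (kind s))))
      × (∀ s → HasTypeData (W s) (typeData (kind s)) (basis s))
      × (∀ s → IsBasis (Image (E* (endpoint (typeData (kind (suc s))))) (W (suc s)))
                       (seed s F.∷ F.[]))
      × (A · seed 0F ≋ E* 2 · A · seed 0F)
      × (A · seed 1F ≋ E* 2 · A · seed 1F)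
      × (A · seed 3F ≋ E* 3 · A · seed 3F)
      × (A · seed 4F ≋ E* 3 · A · seed 4F)
      × (A · seed 5F ≋ E* 4 · A · seed 5F))
    ×
    HasDim T (5 ^ 2 + 3 ^ 2 + 1 ^ 2 + 2 ^ 2 + 2 ^ 2)
    × (5 ^ 2 + 3 ^ 2 + 1 ^ 2 + 2 ^ 2 + 2 ^ 2 ≡ 43))
mainTheorem6 ℝ √3 √3-sqrt Γ pappus = hasSpectrum , λ x →
  (orderingΓ₁ x , orderingΓ₂ x , orderingΓ₃ x) ,
  (λ Γ₁ Γ₂ Γ₃ → Conclusions.conclusion ℝ √3 √3-sqrt pappus x Γ₁ Γ₂ Γ₃ (labellingOf x Γ₂) (label-y x Γ₂)) ,
  -- T depends on x alone, so its dimension may be computed with the orderings just constructed.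
  TypeProperties.dimT ℝ Γ x
    (Summands.model ℝ √3 √3-sqrt pappus x (orderingΓ₁ x) (orderingΓ₂ x) (orderingΓ₃ x)
      (labellingOf x (orderingΓ₂ x)) (label-y x (orderingΓ₂ x))) ,
  ≡.refl
  where
  open Orderings pappus
  -- The spectrum does not involve a base vertex; the labelling from vertex `0F` is used.
  open Spectrum ℝ √3 √3-sqrt pappus (labellingOf 0F (orderingΓ₂ 0F)) using (hasSpectrum)
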